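{- For $R=\mathbb{Z}_{25}$ and for $R=\mathbb{S}_5=\mathbb{F}_5[X]/(X^2)$ we have $\mathrm{m}_3(R)\le 43$.
   Context: For a finite chain ring $R$ of length $2$ with residue field $\mathbb{F}_q$, the projective Hjelmslev plane $\mathrm{PHG}(2,R)$ is the incidence structure whose points are the free rank-$1$ submodules of the right module $R_R^3$, whose lines are the free rank-$2$ submodules of $R_R^3$, with incidence given by inclusion. A projective $(k,n)$-arc is a set of $k$ points meeting every line in at most $n$ points. For $0\le n\le q^2+q$, $\mathrm{m}_n(R)$ denotes the largest $k$ such that a projective $(k,n)$-arc exists in $\mathrm{PHG}(2,R)$. -}

module Defs where

open import Algebra.Bundles using (Ring; CommutativeRing)
open import Algebra.Module.Bundles using (RightModule)
import Algebra.Construct.Pointwise as Pointwise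
import Algebra.Properties.AbelianGroup as AbelianGroupProperties
import Algebra.Properties.CommutativeSemigroup as CommutativeSemigroupProperties
import Algebra.Properties.Monoid.Sum as Sum
import Algebra.Properties.Ring as RingProperties
import Algebra.Properties.Semiring.Divisibility as Divisibility
open import Data.Fin.Base using (Fin)
open import Data.Fin.Subset using (Subset; _∈_; ∣_∣)
open import Data.Integer.Base using (+_)
import Data.Integer.Properties as ℤ
open import Data.List.Base using (List; []; _∷_; map)
open import Data.Nat.Base using (ℕ; zero; suc; _≤_)
open import Data.Product.Base using (_×_; _,_; ∃)
open import Data.Vec.Functional using (Vector)
open import Function.Definitions using (Injective)
open import Level using (Level; 0ℓ; _⊔_) renaming (suc to lsuc)
open import Relation.Binary.Bundles using (Setoid)
open import Relation.Binary.Definitions using (_Respects_)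
open import Relation.Binary.PropositionalEquality.Core using (_≡_)
import Relation.Binary.Reasoning.Setoid as SetoidReasoning
open import Relation.Unary using (Pred; _⊆_; _≐_)

-- The quotient of a commutative ring by the principal ideal (a): the same
-- carrier and operations, with congruence modulo a as the equality.
module Quotient {c ℓ : Level} (R : CommutativeRing c ℓ) (a : CommutativeRing.Carrier R) where
  open CommutativeRing R
  open Divisibility semiring using (_∣_; _,_)
  open RingProperties ring using (-‿distribˡ-*; x[y-z]≈xy-xz; [y-z]x≈yx-zx)
  open AbelianGroupProperties +-abelianGroup using (⁻¹-anti-homo‿-; ⁻¹-∙-comm)
  open CommutativeSemigroupProperties +-commutativeSemigroup using (interchange)
  open SetoidReasoning setoid

  infix 4 _≈ₘ_

  record _≈ₘ_ (x y : Carrier) : Set (c ⊔ ℓ) where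
    constructor congruent
    field
      a∣x-y : a ∣ x - y

  private
    +-∣ : ∀ {x y} → a ∣ x → a ∣ y → a ∣ x + y
    +-∣ (p , pa≈x) (q , qa≈y) = p + q , trans (distribʳ a p q) (+-cong pa≈x qa≈y)

    *-∣ : ∀ z {x} → a ∣ x → a ∣ z * x
    *-∣ z (p , pa≈x) = z * p , trans (*-assoc z p a) (*-congˡ pa≈x)

    neg-∣ : ∀ {x} → a ∣ x → a ∣ - x
    neg-∣ (p , pa≈x) = - p , trans (sym (-‿distribˡ-* p a)) (-‿cong pa≈x)

    resp : ∀ {x y} → x ≈ y → a ∣ x → a ∣ y
    resp x≈y (p , pa≈x) = p , trans pa≈x x≈y

    telescope : ∀ x y z → (x - y) + (y - z) ≈ x - z
    telescope x y z = begin
      (x - y) + (y - z)    ≈⟨ +-assoc x (- y) (y - z) ⟩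
      x + (- y + (y - z))  ≈⟨ +-congˡ (+-assoc (- y) y (- z)) ⟨
      x + (- y + y - z)    ≈⟨ +-congˡ (+-congʳ (-‿inverseˡ y)) ⟩
      x + (0# - z)         ≈⟨ +-congˡ (+-identityˡ (- z)) ⟩
      x - z                ∎

  fromEq : ∀ {x y} → x ≈ y → x ≈ₘ y
  fromEq {x} {y} x≈y =
    congruent (0# , trans (zeroˡ a) (sym (trans (+-congʳ x≈y) (-‿inverseʳ y))))

  private
    symₘ : ∀ {x y} → x ≈ₘ y → y ≈ₘ x
    symₘ {x} {y} (congruent d) = congruent (resp (⁻¹-anti-homo‿- x y) (neg-∣ d))

    transₘ : ∀ {x y z} → x ≈ₘ y → y ≈ₘ z → x ≈ₘ z
    transₘ {x} {y} {z} (congruent d) (congruent e) =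
      congruent (resp (telescope x y z) (+-∣ d e))

    +-congₘ : ∀ {x y u v} → x ≈ₘ y → u ≈ₘ v → x + u ≈ₘ y + v
    +-congₘ {x} {y} {u} {v} (congruent d) (congruent e) = congruent (resp eq (+-∣ d e))
      where
      eq : (x - y) + (u - v) ≈ (x + u) - (y + v)
      eq = trans (interchange x (- y) u (- v)) (+-congˡ (⁻¹-∙-comm y v))

    neg-congₘ : ∀ {x y} → x ≈ₘ y → - x ≈ₘ - y
    neg-congₘ {x} {y} (congruent d) =
      congruent (resp (sym (⁻¹-∙-comm x (- y))) (neg-∣ d))

    *-congₘ : ∀ {x y u v} → x ≈ₘ y → u ≈ₘ v → x * u ≈ₘ y * v
    *-congₘ {x} {y} {u} {v} (congruent d) (congruent e) =
      congruent (resp eq (+-∣ (*-∣ u d) (*-∣ y e)))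
      where
      eq : u * (x - y) + y * (u - v) ≈ x * u - y * v
      eq = begin
        u * (x - y) + y * (u - v)          ≈⟨ +-cong (*-comm u (x - y)) (x[y-z]≈xy-xz y u v) ⟩
        (x - y) * u + (y * u - y * v)      ≈⟨ +-congʳ ([y-z]x≈yx-zx u x y) ⟩
        (x * u - y * u) + (y * u - y * v)  ≈⟨ telescope (x * u) (y * u) (y * v) ⟩
        x * u - y * v                      ∎

  quotientRing : CommutativeRing c (c ⊔ ℓ)
  quotientRing = record
    { Carrier = Carrier ; _≈_ = _≈ₘ_ ; _+_ = _+_ ; _*_ = _*_ ; -_ = -_ ; 0# = 0# ; 1# = 1#
    ; isCommutativeRing = record
      { isRing = record
        { +-isAbelianGroup = record
          { isGroup = record
            { isMonoid = record
              { isSemigroup = record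
                { isMagma = record
                  { isEquivalence = record { refl = fromEq refl ; sym = symₘ ; trans = transₘ }
                  ; ∙-cong = +-congₘ
                  }
                ; assoc = λ x y z → fromEq (+-assoc x y z)
                }
              ; identity = (λ x → fromEq (+-identityˡ x)) , (λ x → fromEq (+-identityʳ x))
              }
            ; inverse = (λ x → fromEq (-‿inverseˡ x)) , (λ x → fromEq (-‿inverseʳ x))
            ; ⁻¹-cong = neg-congₘ
            }
          ; comm = λ x y → fromEq (+-comm x y)
          }
        ; *-cong = *-congₘ
        ; *-assoc = λ x y z → fromEq (*-assoc x y z)
        ; *-identity = (λ x → fromEq (*-identityˡ x)) , (λ x → fromEq (*-identityʳ x))
        ; distrib = (λ x y z → fromEq (distribˡ x y z)) , (λ x y z → fromEq (distribʳ x y z))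
        }
      ; *-comm = λ x y → fromEq (*-comm x y)
      }
    }

open Quotient using (quotientRing)

-- Univariate polynomials as coefficient lists, constant term first.  Trailing
-- zeros are allowed, so equality is equality of all coefficients.
module Polynomial {c ℓ : Level} (R : CommutativeRing c ℓ) where
  open CommutativeRing R
  open CommutativeSemigroupProperties +-commutativeSemigroup using (interchange; x∙yz≈y∙xz)
  open RingProperties ring using (-0#≈0#)

  Poly : Set c
  Poly = List Carrier

  coeff : Poly → ℕ → Carrier
  coeff []      _       = 0#
  coeff (a ∷ p) zero    = a
  coeff (a ∷ p) (suc n) = coeff p n

  infix  4 _≈ₚ_
  infixl 6 _+ₚ_
  infixl 7 _*ₚ_ _·_

  record _≈ₚ_ (p q : Poly) : Set ℓ where
    constructor coeffwise
    field
      coeff-≈ : ∀ n → coeff p n ≈ coeff q n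

  open _≈ₚ_

  _+ₚ_ : Poly → Poly → Poly
  []      +ₚ q       = q
  (a ∷ p) +ₚ []      = a ∷ p
  (a ∷ p) +ₚ (b ∷ q) = (a + b) ∷ (p +ₚ q)

  -ₚ_ : Poly → Poly
  -ₚ_ = map (-_)

  _·_ : Carrier → Poly → Poly
  a · p = map (a *_) p

  -- (a + X p) q = a q + X (p q)
  _*ₚ_ : Poly → Poly → Poly
  []      *ₚ q = []
  (a ∷ p) *ₚ q = a · q +ₚ (0# ∷ p *ₚ q)

  1ₚ : Poly
  1ₚ = 1# ∷ []

  X : Poly
  X = 0# ∷ 1# ∷ []

  coeff-+ : ∀ p q n → coeff (p +ₚ q) n ≈ coeff p n + coeff q n
  coeff-+ []      q       n       = sym (+-identityˡ (coeff q n))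
  coeff-+ (a ∷ p) []      n       = sym (+-identityʳ (coeff (a ∷ p) n))
  coeff-+ (a ∷ p) (b ∷ q) zero    = refl
  coeff-+ (a ∷ p) (b ∷ q) (suc n) = coeff-+ p q n

  coeff-neg : ∀ p n → coeff (-ₚ p) n ≈ - coeff p n
  coeff-neg []      n       = sym -0#≈0#
  coeff-neg (a ∷ p) zero    = refl
  coeff-neg (a ∷ p) (suc n) = coeff-neg p n

  coeff-· : ∀ a p n → coeff (a · p) n ≈ a * coeff p n
  coeff-· a []      n       = sym (zeroʳ a)
  coeff-· a (b ∷ p) zero    = refl
  coeff-· a (b ∷ p) (suc n) = coeff-· a p n

  private
    setoidₚ : Setoid c ℓ
    setoidₚ = record
      { Carrier = Poly
      ; _≈_ = _≈ₚ_
      ; isEquivalence = record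
        { refl  = coeffwise λ n → refl
        ; sym   = λ e → coeffwise λ n → sym (coeff-≈ e n)
        ; trans = λ e f → coeffwise λ n → trans (coeff-≈ e n) (coeff-≈ f n)
        }
      }

    open Setoid setoidₚ using () renaming (refl to reflₚ; sym to symₚ; trans to transₚ)
    open SetoidReasoning setoidₚ

    ∷-cong : ∀ {a b p q} → a ≈ b → p ≈ₚ q → (a ∷ p) ≈ₚ (b ∷ q)
    ∷-cong a≈b e = coeffwise λ { zero → a≈b ; (suc n) → coeff-≈ e n }

    0∷[] : (0# ∷ []) ≈ₚ []
    0∷[] = coeffwise λ { zero → refl ; (suc n) → refl }

    +ₚ-cong : ∀ {p q r s} → p ≈ₚ q → r ≈ₚ s → p +ₚ r ≈ₚ q +ₚ s
    +ₚ-cong {p} {q} {r} {s} e f = coeffwise λ n →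
      trans (coeff-+ p r n) (trans (+-cong (coeff-≈ e n) (coeff-≈ f n)) (sym (coeff-+ q s n)))

    +ₚ-assoc : ∀ p q r → (p +ₚ q) +ₚ r ≈ₚ p +ₚ (q +ₚ r)
    +ₚ-assoc p q r = coeffwise λ n →
      trans (coeff-+ (p +ₚ q) r n) (trans (+-congʳ (coeff-+ p q n))
        (trans (+-assoc (coeff p n) (coeff q n) (coeff r n))
          (sym (trans (coeff-+ p (q +ₚ r) n) (+-congˡ (coeff-+ q r n))))))

    +ₚ-comm : ∀ p q → p +ₚ q ≈ₚ q +ₚ p
    +ₚ-comm p q = coeffwise λ n →
      trans (coeff-+ p q n) (trans (+-comm (coeff p n) (coeff q n)) (sym (coeff-+ q p n)))

    +ₚ-identityʳ : ∀ p → p +ₚ [] ≈ₚ p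
    +ₚ-identityʳ p = coeffwise λ n → trans (coeff-+ p [] n) (+-identityʳ (coeff p n))

    -ₚ-inverseʳ : ∀ p → p +ₚ (-ₚ p) ≈ₚ []
    -ₚ-inverseʳ p = coeffwise λ n →
      trans (coeff-+ p (-ₚ p) n) (trans (+-congˡ (coeff-neg p n)) (-‿inverseʳ (coeff p n)))

    -ₚ-cong : ∀ {p q} → p ≈ₚ q → -ₚ p ≈ₚ -ₚ q
    -ₚ-cong {p} {q} e = coeffwise λ n →
      trans (coeff-neg p n) (trans (-‿cong (coeff-≈ e n)) (sym (coeff-neg q n)))

    +ₚ-interchange : ∀ p q r s → (p +ₚ q) +ₚ (r +ₚ s) ≈ₚ (p +ₚ r) +ₚ (q +ₚ s)
    +ₚ-interchange p q r s = coeffwise λ n →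
      trans (coeff-+ (p +ₚ q) (r +ₚ s) n) (trans (+-cong (coeff-+ p q n) (coeff-+ r s n))
        (trans (interchange (coeff p n) (coeff q n) (coeff r n) (coeff s n))
          (sym (trans (coeff-+ (p +ₚ r) (q +ₚ s) n) (+-cong (coeff-+ p r n) (coeff-+ q s n))))))

    +ₚ-swap : ∀ p q r → p +ₚ (q +ₚ r) ≈ₚ q +ₚ (p +ₚ r)
    +ₚ-swap p q r = coeffwise λ n →
      trans (coeff-+ p (q +ₚ r) n) (trans (+-congˡ (coeff-+ q r n))
        (trans (x∙yz≈y∙xz (coeff p n) (coeff q n) (coeff r n))
          (sym (trans (coeff-+ q (p +ₚ r) n) (+-congˡ (coeff-+ p r n))))))

    ·-cong : ∀ a {p q} → p ≈ₚ q → a · p ≈ₚ a · q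
    ·-cong a {p} {q} e = coeffwise λ n →
      trans (coeff-· a p n) (trans (*-congˡ (coeff-≈ e n)) (sym (coeff-· a q n)))

    ·-distribˡ : ∀ a p q → a · (p +ₚ q) ≈ₚ a · p +ₚ a · q
    ·-distribˡ a p q = coeffwise λ n →
      trans (coeff-· a (p +ₚ q) n) (trans (*-congˡ (coeff-+ p q n))
        (trans (distribˡ a (coeff p n) (coeff q n))
          (sym (trans (coeff-+ (a · p) (a · q) n) (+-cong (coeff-· a p n) (coeff-· a q n))))))

    ·-distribʳ : ∀ a b p → (a + b) · p ≈ₚ a · p +ₚ b · p
    ·-distribʳ a b p = coeffwise λ n →
      trans (coeff-· (a + b) p n) (trans (distribʳ (coeff p n) a b)
        (sym (trans (coeff-+ (a · p) (b · p) n) (+-cong (coeff-· a p n) (coeff-· b p n)))))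

    ·-assoc : ∀ a b p → (a * b) · p ≈ₚ a · (b · p)
    ·-assoc a b p = coeffwise λ n →
      trans (coeff-· (a * b) p n) (trans (*-assoc a b (coeff p n))
        (sym (trans (coeff-· a (b · p) n) (*-congˡ (coeff-· b p n)))))

    ·-identity : ∀ p → 1# · p ≈ₚ p
    ·-identity p = coeffwise λ n → trans (coeff-· 1# p n) (*-identityˡ (coeff p n))

    ·-zero : ∀ p → 0# · p ≈ₚ []
    ·-zero p = coeffwise λ n → trans (coeff-· 0# p n) (zeroˡ (coeff p n))

    0∷-+ : ∀ p q → (0# ∷ (p +ₚ q)) ≈ₚ (0# ∷ p) +ₚ (0# ∷ q)
    0∷-+ p q = ∷-cong (sym (+-identityˡ 0#)) reflₚ

    *ₚ-congˡ : ∀ p {q r} → q ≈ₚ r → p *ₚ q ≈ₚ p *ₚ r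
    *ₚ-congˡ []      e = reflₚ
    *ₚ-congˡ (a ∷ p) e = +ₚ-cong (·-cong a e) (∷-cong refl (*ₚ-congˡ p e))

    *ₚ-zeroʳ : ∀ p → p *ₚ [] ≈ₚ []
    *ₚ-zeroʳ []      = reflₚ
    *ₚ-zeroʳ (a ∷ p) = transₚ (∷-cong refl (*ₚ-zeroʳ p)) 0∷[]

    *ₚ-∷ : ∀ p b q → p *ₚ (b ∷ q) ≈ₚ b · p +ₚ (0# ∷ p *ₚ q)
    *ₚ-∷ []      b q = symₚ 0∷[]
    *ₚ-∷ (a ∷ p) b q = ∷-cong (+-congʳ (*-comm a b)) (begin
      a · q +ₚ p *ₚ (b ∷ q)             ≈⟨ +ₚ-cong {a · q} reflₚ (*ₚ-∷ p b q) ⟩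
      a · q +ₚ (b · p +ₚ (0# ∷ p *ₚ q)) ≈⟨ +ₚ-swap (a · q) (b · p) (0# ∷ p *ₚ q) ⟩
      b · p +ₚ (a · q +ₚ (0# ∷ p *ₚ q)) ∎)

    *ₚ-comm : ∀ p q → p *ₚ q ≈ₚ q *ₚ p
    *ₚ-comm []      q = symₚ (*ₚ-zeroʳ q)
    *ₚ-comm (a ∷ p) q =
      transₚ (+ₚ-cong {a · q} reflₚ (∷-cong refl (*ₚ-comm p q))) (symₚ (*ₚ-∷ q a p))

    *ₚ-distribˡ : ∀ p q r → p *ₚ (q +ₚ r) ≈ₚ p *ₚ q +ₚ p *ₚ r
    *ₚ-distribˡ []      q r = reflₚ
    *ₚ-distribˡ (a ∷ p) q r = begin
      a · (q +ₚ r) +ₚ (0# ∷ p *ₚ (q +ₚ r))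
        ≈⟨ +ₚ-cong (·-distribˡ a q r) (transₚ (∷-cong refl (*ₚ-distribˡ p q r)) (0∷-+ (p *ₚ q) (p *ₚ r))) ⟩
      (a · q +ₚ a · r) +ₚ ((0# ∷ p *ₚ q) +ₚ (0# ∷ p *ₚ r))
        ≈⟨ +ₚ-interchange (a · q) (a · r) (0# ∷ p *ₚ q) (0# ∷ p *ₚ r) ⟩
      (a · q +ₚ (0# ∷ p *ₚ q)) +ₚ (a · r +ₚ (0# ∷ p *ₚ r)) ∎

    *ₚ-distribʳ : ∀ p q r → (q +ₚ r) *ₚ p ≈ₚ q *ₚ p +ₚ r *ₚ p
    *ₚ-distribʳ p q r = begin
      (q +ₚ r) *ₚ p      ≈⟨ *ₚ-comm (q +ₚ r) p ⟩
      p *ₚ (q +ₚ r)      ≈⟨ *ₚ-distribˡ p q r ⟩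
      p *ₚ q +ₚ p *ₚ r   ≈⟨ +ₚ-cong (*ₚ-comm p q) (*ₚ-comm p r) ⟩
      q *ₚ p +ₚ r *ₚ p   ∎

    ·-*ₚ : ∀ a p q → (a · p) *ₚ q ≈ₚ a · (p *ₚ q)
    ·-*ₚ a []      q = reflₚ
    ·-*ₚ a (b ∷ p) q = begin
      (a * b) · q +ₚ (0# ∷ (a · p) *ₚ q)
        ≈⟨ +ₚ-cong (·-assoc a b q) (∷-cong (sym (zeroʳ a)) (·-*ₚ a p q)) ⟩
      a · (b · q) +ₚ a · (0# ∷ p *ₚ q)
        ≈⟨ ·-distribˡ a (b · q) (0# ∷ p *ₚ q) ⟨
      a · (b · q +ₚ (0# ∷ p *ₚ q)) ∎

    0∷-*ₚ : ∀ p q → (0# ∷ p) *ₚ q ≈ₚ (0# ∷ p *ₚ q)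
    0∷-*ₚ p q = +ₚ-cong (·-zero q) (reflₚ {0# ∷ p *ₚ q})

    *ₚ-assoc : ∀ p q r → (p *ₚ q) *ₚ r ≈ₚ p *ₚ (q *ₚ r)
    *ₚ-assoc []      q r = reflₚ
    *ₚ-assoc (a ∷ p) q r = begin
      (a · q +ₚ (0# ∷ p *ₚ q)) *ₚ r
        ≈⟨ *ₚ-distribʳ r (a · q) (0# ∷ p *ₚ q) ⟩
      (a · q) *ₚ r +ₚ (0# ∷ p *ₚ q) *ₚ r
        ≈⟨ +ₚ-cong (·-*ₚ a q r) (transₚ (0∷-*ₚ (p *ₚ q) r) (∷-cong refl (*ₚ-assoc p q r))) ⟩
      a · (q *ₚ r) +ₚ (0# ∷ p *ₚ (q *ₚ r)) ∎

    *ₚ-cong : ∀ {p q r s} → p ≈ₚ q → r ≈ₚ s → p *ₚ r ≈ₚ q *ₚ s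
    *ₚ-cong {p} {q} {r} {s} e f = begin
      p *ₚ r  ≈⟨ *ₚ-congˡ p f ⟩
      p *ₚ s  ≈⟨ *ₚ-comm p s ⟩
      s *ₚ p  ≈⟨ *ₚ-congˡ s e ⟩
      s *ₚ q  ≈⟨ *ₚ-comm s q ⟩
      q *ₚ s  ∎

    *ₚ-identityˡ : ∀ p → 1ₚ *ₚ p ≈ₚ p
    *ₚ-identityˡ p = transₚ (+ₚ-cong (·-identity p) 0∷[]) (+ₚ-identityʳ p)

  polynomialRing : CommutativeRing c ℓ
  polynomialRing = record
    { Carrier = Poly ; _≈_ = _≈ₚ_ ; _+_ = _+ₚ_ ; _*_ = _*ₚ_ ; -_ = -ₚ_ ; 0# = [] ; 1# = 1ₚ
    ; isCommutativeRing = record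
      { isRing = record
        { +-isAbelianGroup = record
          { isGroup = record
            { isMonoid = record
              { isSemigroup = record
                { isMagma = record
                  { isEquivalence = Setoid.isEquivalence setoidₚ
                  ; ∙-cong = +ₚ-cong
                  }
                ; assoc = +ₚ-assoc
                }
              ; identity = (λ p → reflₚ) , +ₚ-identityʳ
              }
            ; inverse = (λ p → transₚ (+ₚ-comm (-ₚ p) p) (-ₚ-inverseʳ p)) , -ₚ-inverseʳ
            ; ⁻¹-cong = -ₚ-cong
            }
          ; comm = +ₚ-comm
          }
        ; *-cong = *ₚ-cong
        ; *-assoc = *ₚ-assoc
        ; *-identity = *ₚ-identityˡ , λ p → transₚ (*ₚ-comm p 1ₚ) (*ₚ-identityˡ p)
        ; distrib = *ₚ-distribˡ , *ₚ-distribʳ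
        }
      ; *-comm = *ₚ-comm
      }
    }

open Polynomial using (polynomialRing; X; _*ₚ_)

ℤ/_ : ℕ → CommutativeRing 0ℓ 0ℓ
ℤ/ n = quotientRing ℤ.+-*-commutativeRing (+ n)

𝔽₅ : CommutativeRing 0ℓ 0ℓ
𝔽₅ = ℤ/ 5

ℤ₂₅ : Ring 0ℓ 0ℓ
ℤ₂₅ = CommutativeRing.ring (ℤ/ 25)

𝕊₅ : Ring 0ℓ 0ℓ
𝕊₅ = CommutativeRing.ring (quotientRing (polynomialRing 𝔽₅) (_*ₚ_ 𝔽₅ (X 𝔽₅) (X 𝔽₅)))

module _ {r ℓr m ℓm : Level} {R : Ring r ℓr} (M : RightModule R m ℓm) where
  open Ring R using (Carrier; _≈_; 0#)
  open RightModule M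
  open Sum +ᴹ-monoid using (sum)

  record IsSubmodule {p : Level} (N : Pred Carrierᴹ p) : Set (r ⊔ m ⊔ ℓm ⊔ p) where
    field
      respects  : N Respects _≈ᴹ_
      0-closed  : N 0ᴹ
      +-closed  : ∀ {x y} → N x → N y → N (x +ᴹ y)
      *ᵣ-closed : ∀ {x} a → N x → N (x *ᵣ a)

  linearCombination : ∀ {n} → Vector Carrierᴹ n → Vector Carrier n → Carrierᴹ
  linearCombination b a = sum (λ i → b i *ᵣ a i)

  record IsBasisOf {p : Level} (N : Pred Carrierᴹ p) {n : ℕ} (b : Vector Carrierᴹ n)
                   : Set (r ⊔ ℓr ⊔ m ⊔ ℓm ⊔ p) where
    field
      member      : ∀ i → N (b i)
      spans       : ∀ {x} → N x → ∃ λ a → x ≈ᴹ linearCombination b a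
      independent : ∀ a → linearCombination b a ≈ᴹ 0ᴹ → ∀ i → a i ≈ 0#

  -- The level r ⊔ ℓm is where the span of a family of vectors lives.
  record FreeSubmodule (n : ℕ) : Set (lsuc r ⊔ ℓr ⊔ m ⊔ lsuc ℓm) where
    field
      carrier     : Pred Carrierᴹ (r ⊔ ℓm)
      isSubmodule : IsSubmodule carrier
      basis       : Vector Carrierᴹ n
      isBasis     : IsBasisOf carrier basis

infix 8 _^_

_^_ : ∀ {r ℓ} (R : Ring r ℓ) (n : ℕ) → RightModule R r ℓ
R ^ n = record
  { Carrierᴹ = Vector Carrier n
  ; _≈ᴹ_ = λ v w → ∀ i → v i ≈ w i
  ; _+ᴹ_ = λ v w i → v i + w i
  ; _*ᵣ_ = λ v a i → v i * a
  ; 0ᴹ = λ i → 0#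
  ; -ᴹ_ = λ v i → - v i
  ; isRightModule = record
    { isRightSemimodule = record
      { +ᴹ-isCommutativeMonoid = Pointwise.isCommutativeMonoid (Fin n) +-isCommutativeMonoid
      ; isPrerightSemimodule = record
        { *ᵣ-cong = λ v≈w a≈b i → *-cong (v≈w i) a≈b
        ; *ᵣ-zeroʳ = λ v i → zeroʳ (v i)
        ; *ᵣ-distribˡ = λ v a b i → distribˡ (v i) a b
        ; *ᵣ-identityʳ = λ v i → *-identityʳ (v i)
        ; *ᵣ-assoc = λ v a b i → *-assoc (v i) a b
        ; *ᵣ-zeroˡ = λ a i → zeroˡ a
        ; *ᵣ-distribʳ = λ a v w i → distribʳ a (v i) (w i)
        }
      }
    ; -ᴹ‿cong = λ v≈w i → -‿cong (v≈w i)
    ; -ᴹ‿inverse = (λ v i → -‿inverseˡ (v i)) , (λ v i → -‿inverseʳ (v i))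
    }
  }
  where open Ring R

module PHG {r ℓ : Level} (R : Ring r ℓ) where
  open FreeSubmodule

  Point : Set (lsuc r ⊔ lsuc ℓ)
  Point = FreeSubmodule (R ^ 3) 1

  Line : Set (lsuc r ⊔ lsuc ℓ)
  Line = FreeSubmodule (R ^ 3) 2

  infix 4 _≈ᴾ_ _on_

  -- A FreeSubmodule carries a chosen basis; points are equal as submodules.
  _≈ᴾ_ : Point → Point → Set (r ⊔ ℓ)
  P ≈ᴾ Q = carrier P ≐ carrier Q

  _on_ : Point → Line → Set (r ⊔ ℓ)
  P on L = carrier P ⊆ carrier L

  -- A set of k points is an injective enumeration by Fin k; a line meets it in
  -- at most n points when every subset of its points on that line has size ≤ n.
  record ProjectiveArc (k n : ℕ) : Set (lsuc r ⊔ lsuc ℓ) where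
    field
      point    : Fin k → Point
      distinct : Injective _≡_ _≈ᴾ_ point
      secant   : ∀ (L : Line) (S : Subset k) → (∀ {i} → i ∈ S → point i on L) → ∣ S ∣ ≤ n

-- IsMaxArcSize R n k says that m_n(R) = k.
record IsMaxArcSize {r ℓ : Level} (R : Ring r ℓ) (n k : ℕ) : Set (lsuc r ⊔ lsuc ℓ) where
  open PHG R
  field
    attained : ProjectiveArc k n
    largest  : ∀ {j} → ProjectiveArc j n → j ≤ k

{-# OPTIONS --safe #-}
-- Both rings are chain rings of length 2 with residue field 𝔽₅, and reduction
-- modulo the radical maps the plane onto PG(2,5).  Suppose 44 points meet every
-- line in at most 3.  Let u be the number of them in a given point class (an
-- affine plane AG(2,5)), and N the number of them in the classes on a given line
-- class.  The lines of a line class meet each of its 6 point classes in 5 parallel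
-- segments; counting along the 5 lines through a segment with h points gives
--   N + 5 h ≤ 15 + u.
-- In the dual AG(2,5) formed by the lines of a line class, the same count shows
-- N ≤ 12 if all u ≤ 4, and N ≤ 11 if all u ≤ 3 (the dual of the nonexistence of
-- a (12,3)-arc in PG(2,5)).  Summing over the 6 line classes through a point
-- class, where any two points of the class share a segment exactly once, excludes
-- u = 5, 4, 3 in turn.  With all u ≤ 2, a class with u = 2 has its own line class
-- with N ≤ 7, which contradicts the second moment Σ N² = 44² + 5 Σ u².
--
-- The maximum exists because it is decidable, by search through the finitely many
-- families of vectors, whether there is an arc of a given size.
module Submission where

open import Defs
open import Data.Nat.Base using (_≤_)
open import Data.Product.Base using (_×_; _,_; ∃)
import Relation.Binary.PropositionalEquality as ≡


-- Over the six line classes through a point class with U arc points, two quantities have known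
-- totals: N sums to 44 + 5 U, and Q, the sum of the squared segment sizes in the class, sums to U²
-- + 5 U. Each exclusion of a value of u therefore rests on a linear inequality α N + β Q ≤ γ, valid
-- for every split of the u points into segments, with 6 γ below the combined total. The cap N ≤ 10
-- + u, read off from a nonempty segment, is too weak for u = 4 and u = 3: N has to be brought down
-- to 12 and to 11 before such an inequality exists. The two rings differ only in a carry. When the
-- residues of a line vector and of a point vector have integer product 5 q, the product in the ring
-- acquires the term ε q θ. For a fixed pair of classes this shifts all segment labels by one
-- constant, so it never changes which points share a segment, and the counting is done modulo 5
-- with an arbitrary shift κ.

-- Finite sums and Kronecker deltas

module Summation where

  import Algebra.Properties.Semiring.Sum as SemiringSum
  open import Data.Bool.Base using (Bool; true; false; if_then_else_)
  open import Data.Fin.Base using (Fin; zero; suc)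
  open import Data.Fin.Patterns using (0F; 1F; 2F; 3F; 4F)
  open import Data.Fin.Properties using (suc-injective) renaming (_≟_ to _≟ᶠ_)
  open import Data.Fin.Subset using (∣_∣)
  open import Data.Nat.Base
  open import Data.Nat.Properties hiding (suc-injective)
  open import Data.Nat.Tactic.RingSolver using (solve-∀)
  open import Data.Product.Base using (_×_; _,_; ∃; ∃₂)
  open import Data.Vec.Base using (tabulate)
  open import Function.Base using (_∘_)
  open import Relation.Binary.PropositionalEquality
  open import Relation.Nullary.Decidable using (yes; no)
  open import Relation.Nullary.Negation using (contradiction)

  private module Σ = SemiringSum +-*-semiring

  private
    variable
      n : ℕ

  δ : Fin n → Fin n → ℕ
  δ zero    zero    = 1
  δ zero    (suc j) = 0
  δ (suc i) zero    = 0
  δ (suc i) (suc j) = δ i j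

  δ-refl : (i : Fin n) → δ i i ≡ 1
  δ-refl zero    = refl
  δ-refl (suc i) = δ-refl i

  δ-≢ : {i j : Fin n} → i ≢ j → δ i j ≡ 0
  δ-≢ {i = zero}  {zero}  i≢j = contradiction refl i≢j
  δ-≢ {i = zero}  {suc j} i≢j = refl
  δ-≢ {i = suc i} {zero}  i≢j = refl
  δ-≢ {i = suc i} {suc j} i≢j = δ-≢ (i≢j ∘ cong suc)

  δ≡1⇒≡ : (i j : Fin n) → δ i j ≡ 1 → i ≡ j
  δ≡1⇒≡ zero    zero    _  = refl
  δ≡1⇒≡ (suc i) (suc j) eq = cong suc (δ≡1⇒≡ i j eq)

  δ-sym : (i j : Fin n) → δ i j ≡ δ j i
  δ-sym zero    zero    = refl
  δ-sym zero    (suc j) = refl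
  δ-sym (suc i) zero    = refl
  δ-sym (suc i) (suc j) = δ-sym i j

  -- Opaque, so that sums over index sets of fixed size are not unfolded.
  opaque
    sum : (Fin n → ℕ) → ℕ
    sum = Σ.sum

  opaque
    unfolding sum

    sum-cong-≗ : {f g : Fin n → ℕ} → (∀ i → f i ≡ g i) → sum f ≡ sum g
    sum-cong-≗ = Σ.sum-cong-≗

    ∑-distrib-+ : (f g : Fin n → ℕ) → sum (λ i → f i + g i) ≡ sum f + sum g
    ∑-distrib-+ = Σ.∑-distrib-+

    ∑-comm : ∀ {m n} (f : Fin m → Fin n → ℕ) →
             sum (λ i → sum (λ j → f i j)) ≡ sum (λ j → sum (λ i → f i j))
    ∑-comm = Σ.∑-comm

    sum-mono-≤ : {f g : Fin n → ℕ} → (∀ i → f i ≤ g i) → sum f ≤ sum g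
    sum-mono-≤ {zero}  f≤g = z≤n
    sum-mono-≤ {suc n} f≤g = +-mono-≤ (f≤g zero) (sum-mono-≤ (f≤g ∘ suc))

    sum-const : ∀ n c → sum {n} (λ _ → c) ≡ n * c
    sum-const zero    c = refl
    sum-const (suc n) c = cong (c +_) (sum-const n c)

    term≤sum : (f : Fin n → ℕ) (i : Fin n) → f i ≤ sum f
    term≤sum f zero    = m≤m+n (f zero) _
    term≤sum f (suc i) = ≤-trans (term≤sum (f ∘ suc) i) (m≤n+m _ (f zero))

    sum-δˡ : (j : Fin n) (f : Fin n → ℕ) → sum (λ i → δ j i * f i) ≡ f j
    sum-δˡ {suc n} zero    f = trans (cong (f zero + 0 +_) (trans (sum-const n 0) (*-zeroʳ n)))
                                     (trans (+-identityʳ _) (+-identityʳ _))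
    sum-δˡ {suc n} (suc j) f = sum-δˡ j (f ∘ suc)

    sum-*ˡ : ∀ x (f : Fin n → ℕ) → sum (λ i → x * f i) ≡ x * sum f
    sum-*ˡ x f = sym (Σ.*-distribˡ-sum x f)

    sum-*ʳ : ∀ x (f : Fin n → ℕ) → sum (λ i → f i * x) ≡ sum f * x
    sum-*ʳ x f = sym (Σ.*-distribʳ-sum x f)

    -- A change of one term, written without subtraction. It serves double counts in which one class
    -- behaves unlike the other five.
    sum-except : (f g : Fin n → ℕ) (i : Fin n) → (∀ j → i ≢ j → f j ≡ g j) →
                 sum f + g i ≡ sum g + f i
    sum-except {suc n} f g zero f≡g = begin
      (f zero + sum (f ∘ suc)) + g zero  ≡⟨ cong (λ x → f zero + x + g zero) (sum-cong-≗ λ j → f≡g (suc j) λ ()) ⟩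
      (f zero + sum (g ∘ suc)) + g zero  ≡⟨ swap (f zero) (sum (g ∘ suc)) (g zero) ⟩
      (g zero + sum (g ∘ suc)) + f zero  ∎
      where
      open ≡-Reasoning
      swap : ∀ a b c → (a + b) + c ≡ (c + b) + a
      swap = solve-∀
    sum-except {suc n} f g (suc i) f≡g = begin
      (f zero + sum (f ∘ suc)) + g (suc i)  ≡⟨ +-assoc (f zero) _ _ ⟩
      f zero + (sum (f ∘ suc) + g (suc i))  ≡⟨ cong₂ _+_ (f≡g zero λ ()) (sum-except (f ∘ suc) (g ∘ suc) i λ j i≢j → f≡g (suc j) (i≢j ∘ suc-injective)) ⟩
      g zero + (sum (g ∘ suc) + f (suc i))  ≡⟨ +-assoc (g zero) _ _ ⟨
      (g zero + sum (g ∘ suc)) + f (suc i)  ∎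
      where open ≡-Reasoning

    sum-positive : (f : Fin n → ℕ) → 1 ≤ sum f → ∃ λ i → 1 ≤ f i
    sum-positive {suc n} f 1≤Σ with f zero in eq
    ... | suc x = zero , subst (1 ≤_) (sym eq) (s≤s z≤n)
    ... | zero  with i , 1≤fi ← sum-positive (f ∘ suc) 1≤Σ = suc i , 1≤fi

    sum-two : (f : Fin n → ℕ) → (∀ i → f i ≤ 1) → 2 ≤ sum f → ∃₂ λ i j → i ≢ j × 1 ≤ f i × 1 ≤ f j
    sum-two {suc n} f f≤1 2≤Σ with f zero in eq | f≤1 zero
    ... | zero  | _ with i , j , i≢j , p , q ← sum-two (f ∘ suc) (f≤1 ∘ suc) 2≤Σ =
      suc i , suc j , i≢j ∘ suc-injective , p , q
    ... | suc .0 | s≤s z≤n with j , q ← sum-positive (f ∘ suc) (s≤s⁻¹ 2≤Σ) =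
      zero , suc j , (λ ()) , subst (1 ≤_) (sym eq) ≤-refl , q

  sum-δʳ : (j : Fin n) (f : Fin n → ℕ) → sum (λ i → δ i j * f i) ≡ f j
  sum-δʳ j f = trans (sum-cong-≗ λ i → cong (_* f i) (δ-sym i j)) (sum-δˡ j f)

  sum-*-sum : ∀ {m n} (f : Fin m → ℕ) (g : Fin n → ℕ) →
              sum (λ i → sum (λ j → f i * g j)) ≡ sum f * sum g
  sum-*-sum f g = trans (sum-cong-≗ λ i → sum-*ˡ (f i) g) (sum-*ʳ (sum g) f)

  δ-subst : (f : Fin n → ℕ) (i j : Fin n) → δ i j * f i ≡ δ i j * f j
  δ-subst f i j with i ≟ᶠ j
  ... | yes refl = refl
  ... | no  i≢j  = trans (cong (_* f i) (δ-≢ i≢j)) (sym (cong (_* f j) (δ-≢ i≢j)))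

  δ-idem : (i j : Fin n) → δ i j * δ i j ≡ δ i j
  δ-idem zero    zero    = refl
  δ-idem zero    (suc j) = refl
  δ-idem (suc i) zero    = refl
  δ-idem (suc i) (suc j) = δ-idem i j

  opaque
    unfolding sum

    sum₅ : (f : Fin 5 → ℕ) →
           sum f ≡ f 0F + (f 1F + (f 2F + (f 3F + (f 4F + 0))))
    sum₅ f = refl

  sum-δ : (j : Fin n) → sum (δ j) ≡ 1
  sum-δ j = trans (sum-cong-≗ λ i → sym (*-identityʳ (δ j i))) (sum-δˡ j (λ _ → 1))

  δ-≡ : {i j : Fin n} → i ≡ j → δ i j ≡ 1
  δ-≡ {i = i} refl = δ-refl i

  δ≤1 : (i j : Fin n) → δ i j ≤ 1
  δ≤1 zero    zero    = ≤-refl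
  δ≤1 zero    (suc j) = z≤n
  δ≤1 (suc i) zero    = z≤n
  δ≤1 (suc i) (suc j) = δ≤1 i j

  δ≥1⇒≡ : (i j : Fin n) → 1 ≤ δ i j → i ≡ j
  δ≥1⇒≡ i j 1≤δ = δ≡1⇒≡ i j (≤-antisym (δ≤1 i j) 1≤δ)

  opaque
    unfolding sum

    -- No term can have slack when the totals leave none. This turns one-sided bounds together with
    -- a total into exact incidence counts.
    sum-tight : {f g : Fin n → ℕ} → (∀ i → f i ≤ g i) → sum g ≤ sum f → ∀ i → f i ≡ g i
    sum-tight {suc n} {f} {g} f≤g Σg≤Σf zero = ≤-antisym (f≤g zero)
      (+-cancelʳ-≤ (sum (g ∘ suc)) _ _ (≤-trans Σg≤Σf (+-monoʳ-≤ (f zero) (sum-mono-≤ (f≤g ∘ suc)))))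
    sum-tight {suc n} {f} {g} f≤g Σg≤Σf (suc i) = sum-tight (f≤g ∘ suc)
      (+-cancelˡ-≤ (g zero) _ _ (≤-trans Σg≤Σf (+-monoˡ-≤ (sum (f ∘ suc)) (f≤g zero)))) i

    two-terms≤sum : (f : Fin n → ℕ) {i j : Fin n} → i ≢ j → f i + f j ≤ sum f
    two-terms≤sum f {zero}  {zero}  i≢j = contradiction refl i≢j
    two-terms≤sum f {zero}  {suc j} i≢j = +-monoʳ-≤ (f zero) (term≤sum (f ∘ suc) j)
    two-terms≤sum f {suc i} {zero}  i≢j = ≤-trans (≤-reflexive (+-comm (f (suc i)) (f zero)))
                                            (+-monoʳ-≤ (f zero) (term≤sum (f ∘ suc) i))
    two-terms≤sum f {suc i} {suc j} i≢j = ≤-trans (two-terms≤sum (f ∘ suc) (i≢j ∘ cong suc)) (m≤n+m _ (f zero))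

  m*n≥1⇒m≥1 : ∀ m n → 1 ≤ m * n → 1 ≤ m
  m*n≥1⇒m≥1 (suc m) n _ = s≤s z≤n

  opaque
    unfolding sum

    sum-tabulate : (f : Fin n → Bool) → ∣ tabulate f ∣ ≡ sum (λ i → if f i then 1 else 0)
    sum-tabulate {zero}  f = refl
    sum-tabulate {suc n} f with f zero
    ... | true  = cong suc (sum-tabulate (f ∘ suc))
    ... | false = sum-tabulate (f ∘ suc)

-- Counting inside one line class

module LineClass where

  open Summation
  open import Data.Empty using (⊥)
  open import Data.Fin.Base using (Fin; zero; suc)
  open import Data.Fin.Properties using (any?) renaming (_≟_ to _≟ᶠ_)
  open import Data.Nat.Base
  open import Data.Nat.Divisibility using (_∣?_; divides; ∣m+n∣m⇒∣n; m∣m*n)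
  open import Data.Nat.Properties
  open import Data.Nat.Tactic.RingSolver using (solve-∀)
  open import Data.Product.Base using (_,_; ∃; proj₁; proj₂)
  open import Data.Sum.Base using (inj₁; inj₂)
  open import Relation.Binary.PropositionalEquality
  open import Relation.Nullary.Decidable using (yes; no; from-no; from-yes)
  open import Relation.Nullary.Negation using (contradiction)

  zeroᵇ : ℕ → ℕ
  zeroᵇ zero    = 1
  zeroᵇ (suc _) = 0

  posᵇ : ℕ → ℕ
  posᵇ zero    = 0
  posᵇ (suc _) = 1

  zeroᵇ+posᵇ : ∀ x → zeroᵇ x + posᵇ x ≡ 1
  zeroᵇ+posᵇ zero    = refl
  zeroᵇ+posᵇ (suc _) = refl

  zeroᵇ≤1 : ∀ x → zeroᵇ x ≤ 1
  zeroᵇ≤1 zero    = ≤-refl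
  zeroᵇ≤1 (suc _) = z≤n

  ≤1⇒idem : ∀ x → x ≤ 1 → x * x ≡ x
  ≤1⇒idem 0 _ = refl
  ≤1⇒idem 1 _ = refl
  ≤1⇒idem (suc (suc _)) (s≤s ())

  -- (x - 10) (x - 11) ≥ 0
  21n≤n²+110 : ∀ x → 21 * x ≤ x * x + 110
  21n≤n²+110 x with x ≤? 10
  ... | yes x≤10 = ≤-trans (m≤m+n (21 * x) (y * (y + 1))) (≤-reflexive (trans (cong (λ z → (z + z + 1) * x + y * (y + 1)) (sym x+y≡10))
                      (trans (identity x y) (cong (λ z → x * x + (z * z + z)) x+y≡10))))
    where
    y = 10 ∸ x
    x+y≡10 : x + y ≡ 10
    x+y≡10 = m+[n∸m]≡n x≤10
    identity : ∀ x y → ((x + y) + (x + y) + 1) * x + y * (y + 1) ≡ x * x + ((x + y) * (x + y) + (x + y))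
    identity = solve-∀
  ... | no  x≰10 = subst (λ z → 21 * z ≤ z * z + 110) (m+[n∸m]≡n (≰⇒> x≰10))
                     (≤-trans (m≤m+n (21 * (11 + y)) (y * (y + 1))) (≤-reflexive (identity y)))
    where
    y = x ∸ 11
    identity : ∀ y → 21 * (11 + y) + y * (y + 1) ≡ (11 + y) * (11 + y) + 110
    identity = solve-∀

  zeroᵇ⇒≡0 : ∀ x → 1 ≤ zeroᵇ x → x ≡ 0
  zeroᵇ⇒≡0 zero _ = refl

  -- The lines of a line class form an AG(2,5) with points t : Fin 25, whose lines
  -- are the segments (e , s) of the 6 point classes e; h e s counts the arc points
  -- in a segment.
  module Net
    (seg  : Fin 6 → Fin 25 → Fin 5)
    (net₁ : ∀ e s → sum (λ t → δ (seg e t) s) ≡ 5)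
    (net₂ : ∀ e e′ → e ≢ e′ → ∀ s s′ → sum (λ t → δ (seg e t) s * δ (seg e′ t) s′) ≡ 1)
    (h : Fin 6 → Fin 5 → ℕ)
    where

    open ≡-Reasoning

    u : Fin 6 → ℕ
    u e = sum (h e)

    N : ℕ
    N = sum u

    Q : Fin 6 → ℕ
    Q e = sum (λ s → h e s * h e s)

    deg : Fin 25 → ℕ
    deg t = sum (λ e → h e (seg e t))

    -- By `net₁` every segment lies on exactly 5 lines of the class.
    sum-seg : ∀ e (F : Fin 5 → ℕ) → sum (λ t → F (seg e t)) ≡ 5 * sum F
    sum-seg e F = begin
      sum (λ t → F (seg e t))                         ≡⟨ sum-cong-≗ (λ t → sum-δˡ (seg e t) F) ⟨
      sum (λ t → sum (λ s → δ (seg e t) s * F s))     ≡⟨ ∑-comm (λ t s → δ (seg e t) s * F s) ⟩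
      sum (λ s → sum (λ t → δ (seg e t) s * F s))     ≡⟨ sum-cong-≗ (λ s → sum-*ʳ (F s) (λ t → δ (seg e t) s)) ⟩
      sum (λ s → sum (λ t → δ (seg e t) s) * F s)     ≡⟨ sum-cong-≗ (λ s → cong (_* F s) (net₁ e s)) ⟩
      sum (λ s → 5 * F s)                             ≡⟨ sum-*ˡ 5 F ⟩
      5 * sum F                                       ∎

    -- By `net₂` the lines correspond to the pairs of segments of two different classes, so the sum
    -- over lines factors.
    sum-seg² : ∀ {e e′} → e ≢ e′ → (F G : Fin 5 → ℕ) →
               sum (λ t → F (seg e t) * G (seg e′ t)) ≡ sum F * sum G
    sum-seg² {e} {e′} e≢e′ F G = begin
      sum (λ t → F (seg e t) * G (seg e′ t))
        ≡⟨ sum-cong-≗ (λ t → cong₂ _*_ (sum-δˡ (seg e t) F) (sum-δˡ (seg e′ t) G)) ⟨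
      sum (λ t → sum (λ s → δ (seg e t) s * F s) * sum (λ s′ → δ (seg e′ t) s′ * G s′))
        ≡⟨ sum-cong-≗ (λ t → sum-*-sum (λ s → δ (seg e t) s * F s) (λ s′ → δ (seg e′ t) s′ * G s′)) ⟨
      sum (λ t → sum (λ s → sum (λ s′ → δ (seg e t) s * F s * (δ (seg e′ t) s′ * G s′))))
        ≡⟨ ∑-comm (λ t s → sum (λ s′ → δ (seg e t) s * F s * (δ (seg e′ t) s′ * G s′))) ⟩
      sum (λ s → sum (λ t → sum (λ s′ → δ (seg e t) s * F s * (δ (seg e′ t) s′ * G s′))))
        ≡⟨ sum-cong-≗ (λ s → ∑-comm (λ t s′ → δ (seg e t) s * F s * (δ (seg e′ t) s′ * G s′))) ⟩
      sum (λ s → sum (λ s′ → sum (λ t → δ (seg e t) s * F s * (δ (seg e′ t) s′ * G s′))))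
        ≡⟨ sum-cong-≗ (λ s → sum-cong-≗ (λ s′ → coefficient s s′)) ⟩
      sum (λ s → sum (λ s′ → F s * G s′))
        ≡⟨ sum-*-sum F G ⟩
      sum F * sum G ∎
      where
      interchange : ∀ a b c d → a * b * (c * d) ≡ a * c * (b * d)
      interchange = solve-∀
      coefficient : ∀ s s′ → sum (λ t → δ (seg e t) s * F s * (δ (seg e′ t) s′ * G s′)) ≡ F s * G s′
      coefficient s s′ = begin
        sum (λ t → δ (seg e t) s * F s * (δ (seg e′ t) s′ * G s′))
          ≡⟨ sum-cong-≗ (λ t → interchange (δ (seg e t) s) (F s) (δ (seg e′ t) s′) (G s′)) ⟩
        sum (λ t → δ (seg e t) s * δ (seg e′ t) s′ * (F s * G s′))
          ≡⟨ sum-*ʳ (F s * G s′) (λ t → δ (seg e t) s * δ (seg e′ t) s′) ⟩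
        sum (λ t → δ (seg e t) s * δ (seg e′ t) s′) * (F s * G s′)
          ≡⟨ cong (_* (F s * G s′)) (net₂ e e′ e≢e′ s s′) ⟩
        1 * (F s * G s′)
          ≡⟨ *-identityˡ _ ⟩
        F s * G s′ ∎

    -- A double count of incidences in which a line is weighted through its segment in `e`. The
    -- other five classes factor by `sum-seg²`; for `e` itself both values sit at the same segment.
    -- Taking `F = h e` yields the second moment of `deg`, and the indicator of a segment yields the
    -- count through that segment.
    sum-deg-weighted : ∀ e (F : Fin 5 → ℕ) →
      sum (λ t → F (seg e t) * deg t) + sum F * u e ≡ sum F * N + 5 * sum (λ s → F s * h e s)
    sum-deg-weighted e F = begin
      sum (λ t → F (seg e t) * deg t) + sum F * u e
        ≡⟨ cong (_+ sum F * u e) (sum-cong-≗ λ t → sum-*ˡ (F (seg e t)) (λ e′ → h e′ (seg e′ t))) ⟨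
      sum (λ t → sum (λ e′ → F (seg e t) * h e′ (seg e′ t))) + sum F * u e
        ≡⟨ cong (_+ sum F * u e) (∑-comm (λ t e′ → F (seg e t) * h e′ (seg e′ t))) ⟩
      sum (λ e′ → sum (λ t → F (seg e t) * h e′ (seg e′ t))) + sum F * u e
        ≡⟨ sum-except (λ e′ → sum (λ t → F (seg e t) * h e′ (seg e′ t))) (λ e′ → sum F * u e′) e
             (λ e′ e≢e′ → sum-seg² e≢e′ F (h e′)) ⟩
      sum (λ e′ → sum F * u e′) + sum (λ t → F (seg e t) * h e (seg e t))
        ≡⟨ cong₂ _+_ (sum-*ˡ (sum F) u) (sum-seg e (λ s → F s * h e s)) ⟩
      sum F * N + 5 * sum (λ s → F s * h e s) ∎

    sum-deg : sum deg ≡ 5 * N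
    sum-deg = begin
      sum deg                      ≡⟨ ∑-comm (λ t e → h e (seg e t)) ⟩
      sum (λ e → sum (λ t → h e (seg e t)))  ≡⟨ sum-cong-≗ (λ e → sum-seg e (h e)) ⟩
      sum (λ e → 5 * u e)          ≡⟨ sum-*ˡ 5 u ⟩
      5 * N                        ∎

    sum-deg² : sum (λ t → deg t * deg t) + sum (λ e → u e * u e) ≡ N * N + 5 * sum Q
    sum-deg² = begin
      sum (λ t → deg t * deg t) + sum (λ e → u e * u e)
        ≡⟨ cong (_+ sum (λ e → u e * u e)) (sum-cong-≗ λ t → sum-*ʳ (deg t) (λ e → h e (seg e t))) ⟨
      sum (λ t → sum (λ e → h e (seg e t) * deg t)) + sum (λ e → u e * u e)
        ≡⟨ cong (_+ sum (λ e → u e * u e)) (∑-comm (λ t e → h e (seg e t) * deg t)) ⟩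
      sum (λ e → sum (λ t → h e (seg e t) * deg t)) + sum (λ e → u e * u e)
        ≡⟨ ∑-distrib-+ (λ e → sum (λ t → h e (seg e t) * deg t)) (λ e → u e * u e) ⟨
      sum (λ e → sum (λ t → h e (seg e t) * deg t) + u e * u e)
        ≡⟨ sum-cong-≗ (λ e → sum-deg-weighted e (h e)) ⟩
      sum (λ e → u e * N + 5 * Q e)
        ≡⟨ ∑-distrib-+ (λ e → u e * N) (λ e → 5 * Q e) ⟩
      sum (λ e → u e * N) + sum (λ e → 5 * Q e)
        ≡⟨ cong₂ _+_ (sum-*ʳ N u) (sum-*ˡ 5 Q) ⟩
      N * N + 5 * sum Q ∎

    row : (Fin 25 → ℕ) → Fin 6 → Fin 5 → ℕ
    row f e s = sum (λ t → δ (seg e t) s * f t)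

    sum-row : ∀ f e → sum (row f e) ≡ sum f
    sum-row f e = begin
      sum (λ s → sum (λ t → δ (seg e t) s * f t))  ≡⟨ ∑-comm (λ s t → δ (seg e t) s * f t) ⟩
      sum (λ t → sum (λ s → δ (seg e t) s * f t))  ≡⟨ sum-cong-≗ (λ t → sum-δˡ (seg e t) (λ _ → f t)) ⟩
      sum f                                        ∎

    term≤row : ∀ f e t → f t ≤ row f e (seg e t)
    term≤row f e t = ≤-trans
      (≤-reflexive (sym (trans (cong (_* f t) (δ-refl (seg e t))) (+-identityʳ (f t)))))
      (term≤sum (λ t′ → δ (seg e t′) (seg e t) * f t′) t)

    module _ (deg≤3 : ∀ t → deg t ≤ 3) where

      defect : Fin 25 → ℕ
      defect t = 3 ∸ deg t

      defect+deg : ∀ t → defect t + deg t ≡ 3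
      defect+deg t = m∸n+n≡m (deg≤3 t)

      -- The five lines through a segment cover every other class once and contain the segment
      -- itself five times.
      row-deg : ∀ e s → row deg e s + u e ≡ N + 5 * h e s
      row-deg e s = begin
        row deg e s + u e
          ≡⟨ cong (row deg e s +_) (trans (cong (_* u e) Σδ) (*-identityˡ (u e))) ⟨
        row deg e s + sum (λ s′ → δ s′ s) * u e
          ≡⟨ sum-deg-weighted e (λ s′ → δ s′ s) ⟩
        sum (λ s′ → δ s′ s) * N + 5 * sum (λ s′ → δ s′ s * h e s′)
          ≡⟨ cong₂ _+_ (trans (cong (_* N) Σδ) (*-identityˡ N)) (cong (5 *_) (sum-δʳ s (h e))) ⟩
        N + 5 * h e s ∎
        where
        Σδ : sum (λ s′ → δ s′ s) ≡ 1
        Σδ = trans (sum-cong-≗ λ s′ → sym (*-identityʳ (δ s′ s))) (sum-δʳ s (λ _ → 1))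

      -- The slack in `N + 5 h ≤ 15 + u` is kept as an explicit term, since the cases of large N use
      -- its exact value.
      row-defect : ∀ e s → row defect e s + (N + 5 * h e s) ≡ 15 + u e
      row-defect e s = begin
        row defect e s + (N + 5 * h e s)        ≡⟨ cong (row defect e s +_) (row-deg e s) ⟨
        row defect e s + (row deg e s + u e)    ≡⟨ +-assoc (row defect e s) _ _ ⟨
        row defect e s + row deg e s + u e      ≡⟨ cong (_+ u e) total ⟩
        15 + u e ∎
        where
        total : row defect e s + row deg e s ≡ 15
        total = begin
          row defect e s + row deg e s
            ≡⟨ ∑-distrib-+ (λ t → δ (seg e t) s * defect t) (λ t → δ (seg e t) s * deg t) ⟨
          sum (λ t → δ (seg e t) s * defect t + δ (seg e t) s * deg t)
            ≡⟨ sum-cong-≗ (λ t → *-distribˡ-+ (δ (seg e t) s) (defect t) (deg t)) ⟨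
          sum (λ t → δ (seg e t) s * (defect t + deg t))
            ≡⟨ sum-cong-≗ (λ t → cong (δ (seg e t) s *_) (defect+deg t)) ⟩
          sum (λ t → δ (seg e t) s * 3)
            ≡⟨ sum-*ʳ 3 (λ t → δ (seg e t) s) ⟩
          sum (λ t → δ (seg e t) s) * 3
            ≡⟨ cong (_* 3) (net₁ e s) ⟩
          15 ∎

      N+5h≤15+u : ∀ e s → N + 5 * h e s ≤ 15 + u e
      N+5h≤15+u e s = ≤-trans (m≤n+m _ (row defect e s)) (≤-reflexive (row-defect e s))

      -- A nonempty class has a nonempty segment, to which the cap `N + 5 h ≤ 15 + u` applies with h
      -- at least 1.
      N≤10+u : ∀ e → 1 ≤ u e → N ≤ 10 + u e
      N≤10+u e 1≤u with s , 1≤h ← sum-positive (h e) 1≤u =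
        +-cancelʳ-≤ 5 N (10 + u e) (≤-trans (+-monoʳ-≤ N (*-monoʳ-≤ 5 1≤h))
          (≤-trans (N+5h≤15+u e s) (≤-reflexive (+-comm 5 (10 + u e)))))

      -- Segments of different classes lie on a common line, which would carry at least 4 arc
      -- points.
      heavy-unique : ∀ {e e′ s s′} → 2 ≤ h e s → 2 ≤ h e′ s′ → e ≡ e′
      heavy-unique {e} {e′} {s} {s′} 2≤h 2≤h′ with e ≟ᶠ e′
      ... | yes e≡e′ = e≡e′
      ... | no  e≢e′ = contradiction (≤-trans 4≤deg (deg≤3 t)) (λ { (s≤s (s≤s (s≤s ()))) })
        where
        common : ∃ λ t → 1 ≤ δ (seg e t) s * δ (seg e′ t) s′
        common = sum-positive _ (≤-reflexive (sym (net₂ e e′ e≢e′ s s′)))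
        t = proj₁ common
        seg≡s : seg e t ≡ s
        seg≡s = δ≥1⇒≡ _ _ (m*n≥1⇒m≥1 _ _ (proj₂ common))
        seg′≡s′ : seg e′ t ≡ s′
        seg′≡s′ = δ≥1⇒≡ _ _ (m*n≥1⇒m≥1 (δ (seg e′ t) s′) (δ (seg e t) s)
                    (subst (1 ≤_) (*-comm (δ (seg e t) s) _) (proj₂ common)))
        4≤deg : 4 ≤ deg t
        4≤deg = ≤-trans (+-mono-≤ (≤-trans 2≤h (≤-reflexive (cong (h e) (sym seg≡s))))
                                  (≤-trans 2≤h′ (≤-reflexive (cong (h e′) (sym seg′≡s′)))))
                        (two-terms≤sum (λ e″ → h e″ (seg e″ t)) e≢e′)

      Z : ℕ
      Z = sum (λ t → zeroᵇ (deg t))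

      module Dense (u+9≤N : ∀ e → u e + 9 ≤ N) where

        -- A segment with two points would give `N + 10 ≤ 15 + u`, against `u + 9 ≤ N`.
        h≤1 : ∀ e s → h e s ≤ 1
        h≤1 e s with h e s | N+5h≤15+u e s
        ... | zero        | _ = z≤n
        ... | suc zero    | _ = ≤-refl
        ... | suc (suc x) | N+5h≤ = contradiction
          (+-cancelˡ-≤ (u e + 9) _ _ (≤-trans (+-monoˡ-≤ (5 * suc (suc x)) (u+9≤N e))
            (≤-trans N+5h≤ (≤-reflexive (rearrange (u e))))))
          (<⇒≱ (≤-trans (from-yes (7 ≤? 10)) (*-monoʳ-≤ 5 {2} (s≤s (s≤s z≤n)))))
          where
          rearrange : ∀ x → 15 + x ≡ x + 9 + 6
          rearrange = solve-∀

        -- A line with a single arc point has defect 2, which is too much for the lines through the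
        -- segment of that point: `2 + N + 5 ≤ 15 + u` contradicts `u + 9 ≤ N`. So all degrees are
        -- 0, 2 or 3.
        deg≢1 : ∀ t → deg t ≢ 1
        deg≢1 t deg≡1 with e , 1≤h ← sum-positive (λ e → h e (seg e t)) (≤-reflexive (sym deg≡1)) =
          contradiction (+-cancelˡ-≤ (u e) 16 15 (too-many e 1≤h)) (from-no (16 ≤? 15))
          where
          2≤defect : 2 ≤ defect t
          2≤defect = ≤-reflexive (cong (3 ∸_) (sym deg≡1))
          rearrange : ∀ x → x + 16 ≡ 2 + (x + 9 + 5)
          rearrange = solve-∀
          too-many : ∀ e → 1 ≤ h e (seg e t) → u e + 16 ≤ u e + 15
          too-many e 1≤h = ≤-trans (≤-reflexive (rearrange (u e)))
            (≤-trans (+-mono-≤ (≤-trans 2≤defect (term≤row defect e t)) (+-mono-≤ (u+9≤N e) (*-monoʳ-≤ 5 1≤h)))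
            (≤-trans (≤-reflexive (row-defect e (seg e t))) (≤-reflexive (+-comm 15 (u e)))))

        sum-Q : sum Q ≡ N
        sum-Q = sum-cong-≗ λ e → sum-cong-≗ λ s → ≤1⇒idem (h e s) (h≤1 e s)

        -- On the degrees 0, 2, 3 the product `(deg - 2) (deg - 3)` is 6 at 0 and vanishes
        -- otherwise. The identity is its sum over the 25 lines, simplified by `sum Q = N`.
        spectrum : N * N + 150 ≡ 20 * N + (6 * Z + sum (λ e → u e * u e))
        spectrum = +-cancelˡ-≡ (5 * N) _ _ (begin
          5 * N + (N * N + 150)        ≡⟨ r₁ N ⟩
          (N * N + 5 * N) + 150        ≡⟨ cong (_+ 150) (trans sum-deg² (cong (λ x → N * N + 5 * x) sum-Q)) ⟨
          (D2 + U2) + 150              ≡⟨ r₂ D2 U2 ⟩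
          (D2 + 150) + U2              ≡⟨ cong (_+ U2) pointwise ⟩
          (5 * sum deg + 6 * Z) + U2   ≡⟨ cong (λ x → 5 * x + 6 * Z + U2) sum-deg ⟩
          (5 * (5 * N) + 6 * Z) + U2   ≡⟨ r₃ N (6 * Z) U2 ⟩
          5 * N + (20 * N + (6 * Z + U2)) ∎)
          where
          D2 = sum (λ t → deg t * deg t)
          U2 = sum (λ e → u e * u e)
          r₁ : ∀ x → 5 * x + (x * x + 150) ≡ (x * x + 5 * x) + 150
          r₁ = solve-∀
          r₂ : ∀ x y → (x + y) + 150 ≡ (x + 150) + y
          r₂ = solve-∀
          r₃ : ∀ x y z → (5 * (5 * x) + y) + z ≡ 5 * x + (20 * x + (y + z))
          r₃ = solve-∀
          quadratic : ∀ g → g ≤ 3 → g ≢ 1 → g * g + 6 ≡ 5 * g + 6 * zeroᵇ g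
          quadratic 0 _ _ = refl
          quadratic 1 _ g≢1 = contradiction refl g≢1
          quadratic 2 _ _ = refl
          quadratic 3 _ _ = refl
          quadratic (suc (suc (suc (suc _)))) (s≤s (s≤s (s≤s ()))) _
          pointwise : D2 + 150 ≡ 5 * sum deg + 6 * Z
          pointwise = begin
            D2 + 150
              ≡⟨ cong (D2 +_) (sum-const 25 6) ⟨
            D2 + sum (λ (_ : Fin 25) → 6)
              ≡⟨ ∑-distrib-+ (λ t → deg t * deg t) (λ _ → 6) ⟨
            sum (λ t → deg t * deg t + 6)
              ≡⟨ sum-cong-≗ (λ t → quadratic (deg t) (deg≤3 t) (deg≢1 t)) ⟩
            sum (λ t → 5 * deg t + 6 * zeroᵇ (deg t))
              ≡⟨ ∑-distrib-+ (λ t → 5 * deg t) (λ t → 6 * zeroᵇ (deg t)) ⟩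
            sum (λ t → 5 * deg t) + sum (λ t → 6 * zeroᵇ (deg t))
              ≡⟨ cong₂ _+_ (sum-*ˡ 5 deg) (sum-*ˡ 6 (λ t → zeroᵇ (deg t))) ⟩
            5 * sum deg + 6 * Z ∎

      -- With all u at most 4, N = 14 would force every nonzero u to be 4, and
      -- N = 13 every nonzero u to be 3 or 4, where the spectrum fails modulo 6.
      u≤4⇒N≤12 : (∀ e → u e ≤ 4) → N ≤ 12
      u≤4⇒N≤12 u≤4 = ≮⇒≥ λ 12<N → refute 12<N
        where
        n = sum (λ e → posᵇ (u e))

        module _ (12<N : 12 < N) where
          open Dense (λ e → ≤-trans (+-monoˡ-≤ 9 (u≤4 e)) 12<N)

          N≤14 : N ≤ 14
          N≤14 with e , 1≤u ← sum-positive u (≤-trans (s≤s z≤n) 12<N) =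
            ≤-trans (N≤10+u e 1≤u) (+-monoʳ-≤ 10 (u≤4 e))

          N≢14 : N ≢ 14
          N≢14 N≡14 = from-no (4 ∣? 14) (divides n (begin
            14                         ≡⟨ N≡14 ⟨
            N                          ≡⟨ sum-cong-≗ (λ e → value (u e) (u≤4 e) (bound e)) ⟩
            sum (λ e → posᵇ (u e) * 4) ≡⟨ sum-*ʳ 4 (λ e → posᵇ (u e)) ⟩
            n * 4                      ∎))
            where
            bound : ∀ e → 1 ≤ u e → 4 ≤ u e
            bound e 1≤u = +-cancelˡ-≤ 10 4 _ (subst (_≤ 10 + u e) N≡14 (N≤10+u e 1≤u))
            value : ∀ x → x ≤ 4 → (1 ≤ x → 4 ≤ x) → x ≡ posᵇ x * 4
            value zero    _   _   = refl
            value (suc x) x≤4 4≤x = ≤-antisym x≤4 (4≤x (s≤s z≤n))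

          N≢13 : N ≢ 13
          N≢13 N≡13 = from-no (6 ∣? 32) (∣m+n∣m⇒∣n
            (divides (n * 2) (trans (sym 12n) (trans (*-comm 12 n) (sym (*-assoc n 2 6))))) (m∣m*n Z))
            where
            U2 = sum (λ e → u e * u e)
            bound : ∀ e → 1 ≤ u e → 3 ≤ u e
            bound e 1≤u = +-cancelˡ-≤ 10 3 _ (subst (_≤ 10 + u e) N≡13 (N≤10+u e 1≤u))
            -- The product `(x - 3) (x - 4)` vanishes at the nonzero sizes 3 and 4, and is 12 at 0.
            square : ∀ x → x ≤ 4 → (1 ≤ x → 3 ≤ x) → x * x + 12 * posᵇ x ≡ 7 * x
            square 0 _ _ = refl
            square 1 _ 3≤x = contradiction (3≤x ≤-refl) (from-no (3 ≤? 1))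
            square 2 _ 3≤x = contradiction (3≤x (s≤s z≤n)) (from-no (3 ≤? 2))
            square 3 _ _ = refl
            square 4 _ _ = refl
            square (suc (suc (suc (suc (suc _))))) (s≤s (s≤s (s≤s (s≤s ())))) _
            U2+12n : U2 + 12 * n ≡ 91
            U2+12n = begin
              U2 + 12 * n                           ≡⟨ cong (U2 +_) (sum-*ˡ 12 (λ e → posᵇ (u e))) ⟨
              U2 + sum (λ e → 12 * posᵇ (u e))      ≡⟨ ∑-distrib-+ (λ e → u e * u e) (λ e → 12 * posᵇ (u e)) ⟨
              sum (λ e → u e * u e + 12 * posᵇ (u e)) ≡⟨ sum-cong-≗ (λ e → square (u e) (u≤4 e) (bound e)) ⟩
              sum (λ e → 7 * u e)                   ≡⟨ sum-*ˡ 7 u ⟩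
              7 * N                                 ≡⟨ cong (7 *_) N≡13 ⟩
              91                                    ∎
            59≡ : 59 ≡ 6 * Z + U2
            59≡ = +-cancelˡ-≡ 260 _ _ (subst (λ x → x * x + 150 ≡ 20 * x + (6 * Z + U2)) N≡13 spectrum)
            12n : 12 * n ≡ 6 * Z + 32
            12n = +-cancelˡ-≡ 59 _ _ (begin
              59 + 12 * n             ≡⟨ cong (_+ 12 * n) 59≡ ⟩
              6 * Z + U2 + 12 * n     ≡⟨ +-assoc (6 * Z) U2 (12 * n) ⟩
              6 * Z + (U2 + 12 * n)   ≡⟨ cong (6 * Z +_) U2+12n ⟩
              6 * Z + 91              ≡⟨ rearrange (6 * Z) ⟩
              59 + (6 * Z + 32)       ∎)
              where
              rearrange : ∀ x → x + 91 ≡ 59 + (x + 32)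
              rearrange = solve-∀

          refute : ⊥
          refute with m≤n⇒m<n∨m≡n 12<N
          ... | inj₂ 13≡N = N≢13 (sym 13≡N)
          ... | inj₁ 13<N = N≢14 (≤-antisym N≤14 13<N)

      -- The dual of the nonexistence of a (12,3)-arc in PG(2,5).
      u≤3⇒N≤11 : (∀ e → u e ≤ 3) → N ≤ 11
      u≤3⇒N≤11 u≤3 = ≮⇒≥ λ 11<N → refute 11<N
        where
        n = sum (λ e → posᵇ (u e))

        module _ (11<N : 11 < N) where
          open Dense (λ e → ≤-trans (+-monoˡ-≤ 9 (u≤3 e)) 11<N)

          N≤13 : N ≤ 13
          N≤13 with e , 1≤u ← sum-positive u (≤-trans (s≤s z≤n) 11<N) =
            ≤-trans (N≤10+u e 1≤u) (+-monoʳ-≤ 10 (u≤3 e))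

          module _ (u∈03 : ∀ e → u e ≡ posᵇ (u e) * 3) where
            N≡n*3 : N ≡ n * 3
            N≡n*3 = trans (sum-cong-≗ u∈03) (sum-*ʳ 3 (λ e → posᵇ (u e)))

          N≢13 : N ≢ 13
          N≢13 N≡13 = from-no (3 ∣? 13) (divides n (trans (sym N≡13) (N≡n*3 λ e → value (u e) (u≤3 e) (bound e))))
            where
            bound : ∀ e → 1 ≤ u e → 3 ≤ u e
            bound e 1≤u = +-cancelˡ-≤ 10 3 _ (subst (_≤ 10 + u e) N≡13 (N≤10+u e 1≤u))
            value : ∀ x → x ≤ 3 → (1 ≤ x → 3 ≤ x) → x ≡ posᵇ x * 3
            value zero    _   _   = refl
            value (suc x) x≤3 3≤x = ≤-antisym x≤3 (3≤x (s≤s z≤n))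

          module _ (N≡12 : N ≡ 12) where
            U2 = sum (λ e → u e * u e)

            2≤u : ∀ e → 1 ≤ u e → 2 ≤ u e
            2≤u e 1≤u = +-cancelˡ-≤ 10 2 _ (subst (_≤ 10 + u e) N≡12 (N≤10+u e 1≤u))

            -- At N = 12 the spectrum reads `6 Z + U2 = 54`. The nonzero sizes are 2 and 3, the
            -- roots of `x² - 5 x + 6`, so that also `U2 + 6 n = 60`.
            n≡1+Z : n ≡ 1 + Z
            n≡1+Z = *-cancelˡ-≡ n (1 + Z) 6 (+-cancelˡ-≡ 54 _ _ (begin
              54 + 6 * n             ≡⟨ cong (_+ 6 * n) 54≡ ⟩
              6 * Z + U2 + 6 * n     ≡⟨ +-assoc (6 * Z) U2 (6 * n) ⟩
              6 * Z + (U2 + 6 * n)   ≡⟨ cong (6 * Z +_) U2+6n ⟩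
              6 * Z + 60             ≡⟨ rearrange Z ⟩
              54 + 6 * (1 + Z)       ∎))
              where
              rearrange : ∀ x → 6 * x + 60 ≡ 54 + 6 * (1 + x)
              rearrange = solve-∀
              square : ∀ x → x ≤ 3 → (1 ≤ x → 2 ≤ x) → x * x + 6 * posᵇ x ≡ 5 * x
              square 0 _ _ = refl
              square 1 _ 2≤x = contradiction (2≤x ≤-refl) (from-no (2 ≤? 1))
              square 2 _ _ = refl
              square 3 _ _ = refl
              square (suc (suc (suc (suc _)))) (s≤s (s≤s (s≤s ()))) _
              U2+6n : U2 + 6 * n ≡ 60
              U2+6n = begin
                U2 + 6 * n                             ≡⟨ cong (U2 +_) (sum-*ˡ 6 (λ e → posᵇ (u e))) ⟨
                U2 + sum (λ e → 6 * posᵇ (u e))        ≡⟨ ∑-distrib-+ (λ e → u e * u e) (λ e → 6 * posᵇ (u e)) ⟨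
                sum (λ e → u e * u e + 6 * posᵇ (u e)) ≡⟨ sum-cong-≗ (λ e → square (u e) (u≤3 e) (2≤u e)) ⟩
                sum (λ e → 5 * u e)                    ≡⟨ sum-*ˡ 5 u ⟩
                5 * N                                  ≡⟨ cong (5 *_) N≡12 ⟩
                60                                     ∎
              54≡ : 54 ≡ 6 * Z + U2
              54≡ = +-cancelˡ-≡ 240 _ _ (subst (λ x → x * x + 150 ≡ 20 * x + (6 * Z + U2)) N≡12 spectrum)

            -- A defect is 0, 1 or 3, and the 3s are the lines of degree 0.
            single : ℕ → ℕ
            single 2 = 1
            single _ = 0

            split-≤3 : ∀ g → g ≤ 3 → g ≢ 1 → 3 ∸ g ≡ 3 * zeroᵇ g + single g
            split-≤3 0 _ _ = refl
            split-≤3 1 _ g≢1 = contradiction refl g≢1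
            split-≤3 2 _ _ = refl
            split-≤3 3 _ _ = refl
            split-≤3 (suc (suc (suc (suc _)))) (s≤s (s≤s (s≤s ()))) _

            defect-split : ∀ t → defect t ≡ 3 * zeroᵇ (deg t) + single (deg t)
            defect-split t = split-≤3 (deg t) (deg≤3 t) (deg≢1 t)

            zeros singles : Fin 6 → Fin 5 → ℕ
            zeros   = row (λ t → zeroᵇ (deg t))
            singles = row (λ t → single (deg t))

            -- This is `row-defect` at N = 12, where a line of degree 0 contributes 3 to the defect,
            -- a line of degree 2 contributes 1, and a line of degree 3 nothing.
            row-split : ∀ e s → 3 * zeros e s + singles e s + 5 * h e s ≡ 3 + u e
            row-split e s = +-cancelˡ-≡ 12 _ _ (begin
              12 + (3 * zeros e s + singles e s + 5 * h e s)
                ≡⟨ rearrange (3 * zeros e s + singles e s) (5 * h e s) ⟩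
              (3 * zeros e s + singles e s) + (12 + 5 * h e s)
                ≡⟨ cong₂ _+_ split (cong (_+ 5 * h e s) N≡12) ⟨
              row defect e s + (N + 5 * h e s)
                ≡⟨ row-defect e s ⟩
              15 + u e ∎)
              where
              rearrange : ∀ x y → 12 + (x + y) ≡ x + (12 + y)
              rearrange = solve-∀
              move : ∀ a b c → a * (3 * b + c) ≡ 3 * (a * b) + a * c
              move = solve-∀
              split : row defect e s ≡ 3 * zeros e s + singles e s
              split = begin
                row defect e s
                  ≡⟨ sum-cong-≗ (λ t → trans (cong (δ (seg e t) s *_) (defect-split t))
                       (move (δ (seg e t) s) (zeroᵇ (deg t)) (single (deg t)))) ⟩
                sum (λ t → 3 * (δ (seg e t) s * zeroᵇ (deg t)) + δ (seg e t) s * single (deg t))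
                  ≡⟨ ∑-distrib-+ (λ t → 3 * (δ (seg e t) s * zeroᵇ (deg t))) (λ t → δ (seg e t) s * single (deg t)) ⟩
                sum (λ t → 3 * (δ (seg e t) s * zeroᵇ (deg t))) + singles e s
                  ≡⟨ cong (_+ singles e s) (sum-*ˡ 3 (λ t → δ (seg e t) s * zeroᵇ (deg t))) ⟩
                3 * zeros e s + singles e s ∎

            -- For u = 2 every row satisfies 3 zeros + singles + 5 h = 5, hence zeros + h ≤ 1.
            -- Adding the five rows gives `Z + 2 ≤ 5`, so there are at most 4 nonempty classes; one
            -- of size 2 and three of size at most 3 cannot hold 12 points.
            u≢2 : ∀ e → u e ≢ 2
            u≢2 e₀ u≡2 = contradiction 13≤12 (from-no (13 ≤? 12))
              where
              zeros+h≤1 : ∀ s → zeros e₀ s + h e₀ s ≤ 1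
              zeros+h≤1 s = s≤s⁻¹ (*-cancelˡ-< 3 _ 2 (s≤s (≤-trans
                (≤-reflexive (*-distribˡ-+ 3 (zeros e₀ s) (h e₀ s)))
                (≤-trans (+-mono-≤ (m≤m+n (3 * zeros e₀ s) (singles e₀ s)) (*-monoˡ-≤ (h e₀ s) {3} {5} (from-yes (3 ≤? 5))))
                (≤-reflexive (trans (row-split e₀ s) (cong (3 +_) u≡2)))))))
              Z+2≤5 : Z + 2 ≤ 5
              Z+2≤5 = ≤-trans (≤-reflexive (sym (begin
                sum (λ s → zeros e₀ s + h e₀ s)  ≡⟨ ∑-distrib-+ (zeros e₀) (h e₀) ⟩
                sum (zeros e₀) + u e₀            ≡⟨ cong₂ _+_ (sum-row (λ t → zeroᵇ (deg t)) e₀) u≡2 ⟩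
                Z + 2                            ∎)))
                (≤-trans (sum-mono-≤ zeros+h≤1) (≤-reflexive (sum-const 5 1)))
              n≤4 : n ≤ 4
              n≤4 = ≤-trans (≤-reflexive n≡1+Z) (s≤s (+-cancelʳ-≤ 2 Z 3 Z+2≤5))
              u+δ≤ : ∀ e → u e + δ e₀ e * 1 ≤ posᵇ (u e) * 3
              u+δ≤ e with e₀ ≟ᶠ e
              ... | yes refl = ≤-reflexive (trans (cong₂ _+_ u≡2 (cong (_* 1) (δ-refl e₀))) (cong (λ x → posᵇ x * 3) (sym u≡2)))
              ... | no e₀≢e = ≤-trans (≤-reflexive (trans (cong (λ x → u e + x * 1) (δ-≢ e₀≢e)) (+-identityʳ (u e)))) (bounded (u e) (u≤3 e))
                where
                bounded : ∀ x → x ≤ 3 → x ≤ posᵇ x * 3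
                bounded zero    _   = z≤n
                bounded (suc x) x≤3 = x≤3
              13≤12 : 13 ≤ 12
              13≤12 = ≤-trans (≤-reflexive (sym (begin
                sum (λ e → u e + δ e₀ e * 1)       ≡⟨ ∑-distrib-+ u (λ e → δ e₀ e * 1) ⟩
                N + sum (λ e → δ e₀ e * 1)         ≡⟨ cong₂ _+_ N≡12 (sum-δˡ e₀ (λ _ → 1)) ⟩
                13                                 ∎)))
                (≤-trans (sum-mono-≤ u+δ≤) (≤-trans (≤-reflexive (sum-*ʳ 3 (λ e → posᵇ (u e)))) (*-monoˡ-≤ 3 n≤4)))

            u∈03 : ∀ e → u e ≡ posᵇ (u e) * 3
            u∈03 e = value (u e) (u≤3 e) (2≤u e) (u≢2 e)
              where
              value : ∀ x → x ≤ 3 → (1 ≤ x → 2 ≤ x) → x ≢ 2 → x ≡ posᵇ x * 3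
              value 0 _ _ _ = refl
              value 1 _ 2≤1 _ = contradiction (2≤1 ≤-refl) (from-no (2 ≤? 1))
              value 2 _ _ 2≢2 = contradiction refl 2≢2
              value 3 _ _ _ = refl
              value (suc (suc (suc (suc _)))) (s≤s (s≤s (s≤s ()))) _ _

            n≡4 : n ≡ 4
            n≡4 = *-cancelʳ-≡ n 4 3 (trans (sym (N≡n*3 u∈03)) N≡12)

            Z≡3 : Z ≡ 3
            Z≡3 = cong pred (trans (sym n≡1+Z) n≡4)

            zero-classes : sum (λ e → zeroᵇ (u e)) ≡ 2
            zero-classes = +-cancelʳ-≡ 4 _ _ (begin
              sum (λ e → zeroᵇ (u e)) + 4                ≡⟨ cong (sum (λ e → zeroᵇ (u e)) +_) n≡4 ⟨
              sum (λ e → zeroᵇ (u e)) + n                ≡⟨ ∑-distrib-+ (λ e → zeroᵇ (u e)) (λ e → posᵇ (u e)) ⟨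
              sum (λ e → zeroᵇ (u e) + posᵇ (u e))       ≡⟨ sum-cong-≗ (λ e → zeroᵇ+posᵇ (u e)) ⟩
              sum (λ (_ : Fin 6) → 1)                    ≡⟨ sum-const 6 1 ⟩
              6                                          ∎)

            -- The total defect is 25 * 3 - 5 * 12 = 15, of which the 3 lines of degree 0 account
            -- for 9.
            sum-singles : sum (λ t → single (deg t)) ≡ 6
            sum-singles = +-cancelˡ-≡ 69 _ _ (begin
              69 + S                                 ≡⟨ rearrange S ⟩
              3 * 3 + S + 60                         ≡⟨ cong₂ (λ x y → 3 * x + S + y) Z≡3 (trans sum-deg (cong (5 *_) N≡12)) ⟨
              3 * Z + S + sum deg                    ≡⟨ cong (λ x → x + S + sum deg) (sum-*ˡ 3 (λ t → zeroᵇ (deg t))) ⟨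
              sum (λ t → 3 * zeroᵇ (deg t)) + S + sum deg
                ≡⟨ cong (_+ sum deg) (∑-distrib-+ (λ t → 3 * zeroᵇ (deg t)) (λ t → single (deg t))) ⟨
              sum (λ t → 3 * zeroᵇ (deg t) + single (deg t)) + sum deg
                ≡⟨ cong (_+ sum deg) (sum-cong-≗ defect-split) ⟨
              sum defect + sum deg                   ≡⟨ ∑-distrib-+ defect deg ⟨
              sum (λ t → defect t + deg t)           ≡⟨ sum-cong-≗ defect+deg ⟩
              sum (λ (_ : Fin 25) → 3)               ≡⟨ sum-const 25 3 ⟩
              75                                     ∎)
              where
              S = sum (λ t → single (deg t))
              rearrange : ∀ x → 69 + x ≡ 9 + x + 60
              rearrange = solve-∀

            -- On a class with u = 0 each row is either free of singles or free
            -- of zeros; A marks the latter.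
            module _ (e : Fin 6) (u≡0 : u e ≡ 0) where
              A : Fin 5 → ℕ
              A s = 1 ∸ zeros e s

              row≡3 : ∀ s → 3 * zeros e s + singles e s ≡ 3
              row≡3 s = begin
                3 * zeros e s + singles e s                ≡⟨ +-identityʳ _ ⟨
                3 * zeros e s + singles e s + 5 * 0        ≡⟨ cong (λ x → 3 * zeros e s + singles e s + 5 * x) h≡0 ⟨
                3 * zeros e s + singles e s + 5 * h e s    ≡⟨ row-split e s ⟩
                3 + u e                                    ≡⟨ cong (3 +_) u≡0 ⟩
                3 ∎
                where
                h≡0 : h e s ≡ 0
                h≡0 = n≤0⇒n≡0 (subst (h e s ≤_) u≡0 (term≤sum (h e) s))

              zeros≤1 : ∀ s → zeros e s ≤ 1
              zeros≤1 s = *-cancelˡ-≤ 3 (≤-trans (m≤m+n (3 * zeros e s) (singles e s)) (≤-reflexive (row≡3 s)))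

              sum-A : sum A ≡ 2
              sum-A = +-cancelʳ-≡ 3 _ _ (begin
                sum A + 3                        ≡⟨ cong (sum A +_) (trans (sum-row (λ t → zeroᵇ (deg t)) e) Z≡3) ⟨
                sum A + sum (zeros e)            ≡⟨ ∑-distrib-+ A (zeros e) ⟨
                sum (λ s → A s + zeros e s)      ≡⟨ sum-cong-≗ (λ s → m∸n+n≡m (zeros≤1 s)) ⟩
                sum (λ (_ : Fin 5) → 1)          ≡⟨ sum-const 5 1 ⟩
                5                                ∎)

              single⇒A : ∀ t → 1 ≤ single (deg t) → 1 ≤ A (seg e t)
              single⇒A t 1≤single = complement (zeros e (seg e t)) (singles e (seg e t)) (row≡3 (seg e t))
                (≤-trans 1≤single (term≤row (λ t′ → single (deg t′)) e t))
                where
                complement : ∀ x y → 3 * x + y ≡ 3 → 1 ≤ y → 1 ≤ 1 ∸ x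
                complement zero    y _  _   = ≤-refl
                complement (suc x) y eq 1≤y = contradiction
                  (≤-trans (+-mono-≤ (*-monoʳ-≤ 3 {1} {suc x} (s≤s z≤n)) 1≤y) (≤-reflexive eq)) (from-no (4 ≤? 3))

            single≤A*A′ : ∀ e e′ (p : u e ≡ 0) (q : u e′ ≡ 0) t →
                          single (deg t) ≤ A e p (seg e t) * A e′ q (seg e′ t)
            single≤A*A′ e e′ p q t = bound (deg t) (single⇒A e p t) (single⇒A e′ q t)
              where
              bound : ∀ x {a b} → (1 ≤ single x → 1 ≤ a) → (1 ≤ single x → 1 ≤ b) → single x ≤ a * b
              bound 0 _ _ = z≤n
              bound 1 _ _ = z≤n
              bound 2 f g = *-mono-≤ (f ≤-refl) (g ≤-refl)
              bound (suc (suc (suc _))) _ _ = z≤n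

            -- In each of two empty classes the lines of degree 2 are confined to the two rows
            -- without a line of degree 0. These rows meet in only 2 * 2 lines, but there are 6
            -- lines of degree 2.
            zero-classes⇒6≤4 : ∀ e e′ → u e ≡ 0 → u e′ ≡ 0 → e ≢ e′ → 6 ≤ 4
            zero-classes⇒6≤4 e e′ p q e≢e′ =
              ≤-trans (≤-reflexive (sym sum-singles)) (≤-trans (sum-mono-≤ (single≤A*A′ e e′ p q))
                (≤-reflexive (trans (sum-seg² e≢e′ (A e p) (A e′ q)) (cong₂ _*_ (sum-A e p) (sum-A e′ q)))))

            N≡12⇒⊥ : ⊥
            N≡12⇒⊥ =
              let e , e′ , e≢e′ , p , q = sum-two (λ e → zeroᵇ (u e)) (λ e → zeroᵇ≤1 (u e)) (≤-reflexive (sym zero-classes))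
              in from-no (6 ≤? 4) (zero-classes⇒6≤4 e e′ (zeroᵇ⇒≡0 (u e) p) (zeroᵇ⇒≡0 (u e′) q) e≢e′)

          refute : ⊥
          refute with m≤n⇒m<n∨m≡n 11<N
          ... | inj₂ 12≡N = N≡12⇒⊥ (sym 12≡N)
          ... | inj₁ 12<N = N≢13 (≤-antisym N≤13 12<N)

      u≤N : ∀ e → u e ≤ N
      u≤N = term≤sum u

      -- Since `u ≤ N`, the cap leaves `5 h ≤ 15`. This makes the later search over splits into
      -- segments finite.
      h≤3 : ∀ e s → h e s ≤ 3
      h≤3 e s = *-cancelˡ-≤ 5 (+-cancelˡ-≤ (u e) _ _ (≤-trans (+-monoˡ-≤ (5 * h e s) (u≤N e))
        (≤-trans (N+5h≤15+u e s) (≤-reflexive (+-comm 15 (u e))))))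

      Q≤u² : ∀ e → Q e ≤ u e * u e
      Q≤u² e = ≤-trans (sum-mono-≤ λ s → *-monoʳ-≤ (h e s) (term≤sum (h e) s)) (≤-reflexive (sum-*ʳ (u e) (h e)))

      light⇒Q≡u : ∀ e → (∀ s → h e s ≤ 1) → Q e ≡ u e
      light⇒Q≡u e h≤1 = sum-cong-≗ λ s → ≤1⇒idem (h e s) (h≤1 s)

      -- A segment with two points forces N ≤ 7 and is unique, which is what
      -- makes up for its contribution to the sum of Q.
      u≤2⇒6Q+15N≤N²+110 : (∀ e → u e ≤ 2) → 6 * sum Q + 15 * N ≤ N * N + 110
      u≤2⇒6Q+15N≤N²+110 u≤2 with any? (λ e → any? (λ s → 2 ≤? h e s))
      ... | no light = ≤-trans (≤-reflexive (trans (cong (λ x → 6 * x + 15 * N) ΣQ≡N) (sym (*-distribʳ-+ N 6 15)))) (21n≤n²+110 N)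
        where
        ΣQ≡N : sum Q ≡ N
        ΣQ≡N = sum-cong-≗ λ e → light⇒Q≡u e λ s → s≤s⁻¹ (≰⇒> λ 2≤h → light (e , s , 2≤h))
      ... | yes (e , s , 2≤h) = ≤-trans
        (+-monoˡ-≤ (15 * N) (*-monoʳ-≤ 6 ΣQ≤N+2))
        (≤-trans (≤-reflexive (rearrange N)) (small N≤7))
        where
        N≤7 : N ≤ 7
        N≤7 = +-cancelʳ-≤ 10 N 7 (≤-trans (+-monoʳ-≤ N (*-monoʳ-≤ 5 2≤h)) (≤-trans (N+5h≤15+u e s) (+-monoʳ-≤ 15 (u≤2 e))))
        u≡2 : u e ≡ 2
        u≡2 = ≤-antisym (u≤2 e) (≤-trans 2≤h (term≤sum (h e) s))
        ΣQ≤N+2 : sum Q ≤ N + 2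
        ΣQ≤N+2 = +-cancelʳ-≤ 2 _ _ (≤-trans (≤-reflexive (cong (sum Q +_) (sym u≡2)))
          (≤-trans (≤-reflexive (sum-except Q u e λ e′ e≢e′ → light⇒Q≡u e′ λ s′ →
              s≤s⁻¹ (≰⇒> λ 2≤h′ → e≢e′ (heavy-unique 2≤h 2≤h′))))
          (≤-trans (+-monoʳ-≤ N (≤-trans (Q≤u² e) (≤-reflexive (cong₂ _*_ u≡2 u≡2))))
          (≤-reflexive (sym (+-assoc N 2 2))))))
        rearrange : ∀ x → 6 * (x + 2) + 15 * x ≡ 21 * x + 12
        rearrange = solve-∀
        -- The bound is sharp: both sides equal 159 at x = 7.
        small : ∀ {x} → x ≤ 7 → 21 * x + 12 ≤ x * x + 110
        small x≤7 = from-yes (allUpTo? (λ x → 21 * x + 12 ≤? x * x + 110) 8) (s≤s x≤7)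

-- Double counting over the whole plane

module Counting where

  open LineClass
  open Summation
  open import Data.Empty using (⊥)
  open import Data.Fin.Base using (Fin; suc)
  open import Data.Fin.Patterns using (0F; 1F; 2F; 3F; 4F)
  open import Data.Fin.Properties using () renaming (_≟_ to _≟ᶠ_)
  open import Data.Nat.Base
  open import Data.Nat.Properties
  open import Data.Nat.Tactic.RingSolver using (solve-∀)
  open import Data.Sum.Base using (_⊎_; inj₁; inj₂)
  open import Relation.Binary.PropositionalEquality
  open import Relation.Nullary.Decidable using (Dec; yes; no; from-no; from-yes; _⊎-dec_; _→-dec_)
  open import Relation.Nullary.Negation using (contradiction)

  -- The nesting and the final 0 match the form in which `sum₅` expands a sum.
  sumSq : ℕ → ℕ → ℕ → ℕ → ℕ → ℕ
  sumSq a b c d e = a * a + (b * b + (c * c + (d * d + (e * e + 0))))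

  -- α N + β Q ≤ γ for a class of u points split into segments of sizes a, …, e,
  -- given N ≤ B and N + 5 a, …, N + 5 e ≤ 15 + u.
  RowBound : (α β γ B u a b c d e : ℕ) → Set
  RowBound α β γ B u a b c d e =
    a + (b + (c + (d + (e + 0)))) ≡ u → bounded B ⊎ cap a ⊎ cap b ⊎ cap c ⊎ cap d ⊎ cap e
    where
    bounded : ℕ → Set
    bounded x = α * x + β * sumSq a b c d e ≤ γ
    cap : ℕ → Set
    cap x = bounded (15 + u ∸ 5 * x)

  RowBounds : (α β γ B u : ℕ) → Set
  RowBounds α β γ B u =
    ∀ {a} → a < 4 → ∀ {b} → b < 4 → ∀ {c} → c < 4 → ∀ {d} → d < 4 → ∀ {e} → e < 4 →
    RowBound α β γ B u a b c d e

  rowBounds? : ∀ α β γ B u → Dec (RowBounds α β γ B u)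
  rowBounds? α β γ B u =
    allUpTo? (λ a → allUpTo? (λ b → allUpTo? (λ c → allUpTo? (λ d → allUpTo? (λ e →
      (_ ≟ _) →-dec ((_ ≤? _) ⊎-dec (_ ≤? _) ⊎-dec (_ ≤? _) ⊎-dec (_ ≤? _) ⊎-dec (_ ≤? _) ⊎-dec (_ ≤? _))) 4) 4) 4) 4) 4

  -- With N at most 20 - 5 max, the splits 1+1+1+1+1, 2+2+1 and 3+2 are all tight at 85: they have N
  -- ≤ 15, 10, 5 and Q = 5, 9, 13. The value B = 20 is 15 + u and adds nothing to the segment caps.
  rowBounds₅ : RowBounds 4 5 85 20 5
  rowBounds₅ = from-yes (rowBounds? 4 5 85 20 5)

  -- Tight for 1+1+1+1 at N = 12 and for 2+2 at N = 9. In the first split the segment cap alone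
  -- would allow N = 14.
  rowBounds₄ : RowBounds 4 3 60 12 4
  rowBounds₄ = from-yes (rowBounds? 4 3 60 12 4)

  -- Tight for 1+1+1 at N = 11 and for one segment of size 3 at N = 3. In the first split the
  -- segment cap alone would allow N = 13.
  rowBounds₃ : RowBounds 3 4 45 11 3
  rowBounds₃ = from-yes (rowBounds? 3 4 45 11 3)

  -- N lies below all six candidate values, so by monotonicity any one of them that satisfies the
  -- bound suffices.
  applyRowBounds : ∀ α β γ B u → RowBounds α β γ B u → ∀ N (h : Fin 5 → ℕ) → sum h ≡ u →
    (∀ s → h s ≤ 3) → (∀ s → N + 5 * h s ≤ 15 + u) → N ≤ B →
    α * N + β * sum (λ s → h s * h s) ≤ γ
  applyRowBounds α β γ B u bounds N h Σh≡u h≤3 N+5h≤ N≤B =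
    choose (bounds (s≤s (h≤3 0F)) (s≤s (h≤3 1F)) (s≤s (h≤3 2F)) (s≤s (h≤3 3F)) (s≤s (h≤3 4F)) (trans (sym (sum₅ h)) Σh≡u))
    where
    Q = sumSq (h 0F) (h 1F) (h 2F) (h 3F) (h 4F)
    conclude : ∀ x → N ≤ x → α * x + β * Q ≤ γ → α * N + β * sum (λ s → h s * h s) ≤ γ
    conclude x N≤x ≤γ = ≤-trans (+-mono-≤ (*-monoʳ-≤ α N≤x) (≤-reflexive (cong (β *_) (sum₅ (λ s → h s * h s))))) ≤γ
    cap : ∀ s → α * (15 + u ∸ 5 * h s) + β * Q ≤ γ → α * N + β * sum (λ s → h s * h s) ≤ γ
    cap s = conclude (15 + u ∸ 5 * h s) (m+n≤o⇒m≤o∸n N (N+5h≤ s))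
    choose : _ → α * N + β * sum (λ s → h s * h s) ≤ γ
    choose (inj₁ p)                             = conclude B N≤B p
    choose (inj₂ (inj₁ p))                      = cap 0F p
    choose (inj₂ (inj₂ (inj₁ p)))               = cap 1F p
    choose (inj₂ (inj₂ (inj₂ (inj₁ p))))        = cap 2F p
    choose (inj₂ (inj₂ (inj₂ (inj₂ (inj₁ p))))) = cap 3F p
    choose (inj₂ (inj₂ (inj₂ (inj₂ (inj₂ p))))) = cap 4F p

  incidence : (Fin 31 → Fin 6 → Fin 31) → Fin 31 → Fin 31 → ℕ
  incidence pt m c = sum (λ e → δ (pt m e) c)

  -- m ranges over the line classes, pt m over the point classes on m, and the
  -- lines of class m are numbered by Fin 25; seg m e t is the segment in which
  -- line t meets the class pt m e, and label m c w the one containing point w of c.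
  module Plane
    (pt     : Fin 31 → Fin 6 → Fin 31)
    (label  : Fin 31 → Fin 31 → Fin 25 → Fin 5)
    (seg    : Fin 31 → Fin 6 → Fin 25 → Fin 5)
    (net₁   : ∀ m e s → sum (λ t → δ (seg m e t) s) ≡ 5)
    (net₂   : ∀ m e e′ → e ≢ e′ → ∀ s s′ → sum (λ t → δ (seg m e t) s * δ (seg m e′ t) s′) ≡ 1)
    (pencil : ∀ c → sum (λ m → incidence pt m c) ≡ 6)
    (joins  : ∀ c c′ → sum (λ m → incidence pt m c * incidence pt m c′) ≡ 1 + 5 * δ c c′)
    (slopes : ∀ c w w′ → sum (λ m → incidence pt m c * δ (label m c w) (label m c w′)) ≡ 1 + 5 * δ w w′)
    (cls    : Fin 44 → Fin 31)
    (pos    : Fin 44 → Fin 25)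
    (code-injective : ∀ i j → cls i ≡ cls j → pos i ≡ pos j → i ≡ j)
    (secant : ∀ m t → sum (λ i → sum (λ e → δ (pt m e) (cls i) * δ (label m (pt m e) (pos i)) (seg m e t))) ≤ 3)
    where

    open ≡-Reasoning

    segment : Fin 31 → Fin 31 → Fin 5 → ℕ
    segment m c s = sum (λ i → δ c (cls i) * δ (label m c (pos i)) s)

    U : Fin 31 → ℕ
    U c = sum (λ i → δ c (cls i))

    module M (m : Fin 31) = Net (seg m) (net₁ m) (net₂ m) (λ e → segment m (pt m e))
    open M using (N; Q; u; deg)

    deg≤3 : ∀ m t → deg m t ≤ 3
    deg≤3 m t = ≤-trans (≤-reflexive (∑-comm λ e i → δ (pt m e) (cls i) * δ (label m (pt m e) (pos i)) (seg m e t))) (secant m t)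

    u≡U : ∀ m e → u m e ≡ U (pt m e)
    u≡U m e = begin
      sum (λ s → sum (λ i → δ (pt m e) (cls i) * δ (label m (pt m e) (pos i)) s))
        ≡⟨ ∑-comm (λ s i → δ (pt m e) (cls i) * δ (label m (pt m e) (pos i)) s) ⟩
      sum (λ i → sum (λ s → δ (pt m e) (cls i) * δ (label m (pt m e) (pos i)) s))
        ≡⟨ sum-cong-≗ (λ i → trans (sum-*ˡ (δ (pt m e) (cls i)) (δ (label m (pt m e) (pos i))))
             (trans (cong (δ (pt m e) (cls i) *_) (sum-δ (label m (pt m e) (pos i)))) (*-identityʳ _))) ⟩
      U (pt m e) ∎

    sum-U : sum U ≡ 44
    sum-U = begin
      sum (λ c → sum (λ i → δ c (cls i)))  ≡⟨ ∑-comm (λ c i → δ c (cls i)) ⟩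
      sum (λ i → sum (λ c → δ c (cls i)))  ≡⟨ sum-cong-≗ (λ i → trans (sum-cong-≗ λ c → δ-sym c (cls i)) (sum-δ (cls i))) ⟩
      sum (λ (_ : Fin 44) → 1)             ≡⟨ sum-const 44 1 ⟩
      44                                   ∎

    flagSum : Fin 31 → (Fin 31 → Fin 6 → ℕ) → ℕ
    flagSum c X = sum (λ m → sum (λ e → δ (pt m e) c * X m e))

    sum-flagSum : ∀ X → sum (λ c → flagSum c X) ≡ sum (λ m → sum (X m))
    sum-flagSum X = begin
      sum (λ c → sum (λ m → sum (λ e → δ (pt m e) c * X m e)))
        ≡⟨ ∑-comm (λ c m → sum (λ e → δ (pt m e) c * X m e)) ⟩
      sum (λ m → sum (λ c → sum (λ e → δ (pt m e) c * X m e)))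
        ≡⟨ sum-cong-≗ (λ m → ∑-comm (λ c e → δ (pt m e) c * X m e)) ⟩
      sum (λ m → sum (λ e → sum (λ c → δ (pt m e) c * X m e)))
        ≡⟨ sum-cong-≗ (λ m → sum-cong-≗ λ e → sum-δˡ (pt m e) (λ _ → X m e)) ⟩
      sum (λ m → sum (X m)) ∎

    flagSum-line : ∀ c (X : Fin 31 → ℕ) → flagSum c (λ m _ → X m) ≡ sum (λ m → incidence pt m c * X m)
    flagSum-line c X = sum-cong-≗ λ m → sum-*ʳ (X m) (λ e → δ (pt m e) c)

    N-incidence : ∀ m → N m ≡ sum (λ c → incidence pt m c * U c)
    N-incidence m = begin
      sum (u m)                                        ≡⟨ sum-cong-≗ (λ e → trans (u≡U m e) (sym (sum-δˡ (pt m e) U))) ⟩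
      sum (λ e → sum (λ c → δ (pt m e) c * U c))       ≡⟨ ∑-comm (λ e c → δ (pt m e) c * U c) ⟩
      sum (λ c → sum (λ e → δ (pt m e) c * U c))       ≡⟨ sum-cong-≗ (λ c → sum-*ʳ (U c) (λ e → δ (pt m e) c)) ⟩
      sum (λ c → incidence pt m c * U c)               ∎

    -- Of the six line classes through `c`, any other class lies on exactly one, while `c` lies on
    -- all of them.
    pencil-N : ∀ c → sum (λ m → incidence pt m c * N m) ≡ 44 + 5 * U c
    pencil-N c = begin
      sum (λ m → incidence pt m c * N m)
        ≡⟨ sum-cong-≗ (λ m → trans (cong (incidence pt m c *_) (N-incidence m))
             (sym (sum-*ˡ (incidence pt m c) (λ c′ → incidence pt m c′ * U c′)))) ⟩
      sum (λ m → sum (λ c′ → incidence pt m c * (incidence pt m c′ * U c′)))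
        ≡⟨ ∑-comm (λ m c′ → incidence pt m c * (incidence pt m c′ * U c′)) ⟩
      sum (λ c′ → sum (λ m → incidence pt m c * (incidence pt m c′ * U c′)))
        ≡⟨ sum-cong-≗ (λ c′ → trans (sum-cong-≗ λ m → sym (*-assoc (incidence pt m c) (incidence pt m c′) (U c′)))
             (trans (sum-*ʳ (U c′) (λ m → incidence pt m c * incidence pt m c′)) (cong (_* U c′) (joins c c′)))) ⟩
      sum (λ c′ → U c′ + 5 * δ c c′ * U c′)
        ≡⟨ ∑-distrib-+ U (λ c′ → 5 * δ c c′ * U c′) ⟩
      sum U + sum (λ c′ → 5 * δ c c′ * U c′)
        ≡⟨ cong₂ _+_ sum-U (trans (sum-cong-≗ λ c′ → *-assoc 5 (δ c c′) (U c′))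
             (trans (sum-*ˡ 5 (λ c′ → δ c c′ * U c′)) (cong (5 *_) (sum-δˡ c U)))) ⟩
      44 + 5 * U c ∎

    sum-N : sum N ≡ 264
    sum-N = begin
      sum N                                             ≡⟨ sum-cong-≗ N-incidence ⟩
      sum (λ m → sum (λ c → incidence pt m c * U c))    ≡⟨ ∑-comm (λ m c → incidence pt m c * U c) ⟩
      sum (λ c → sum (λ m → incidence pt m c * U c))    ≡⟨ sum-cong-≗ (λ c → trans (sum-*ʳ (U c) (λ m → incidence pt m c)) (cong (_* U c) (pencil c))) ⟩
      sum (λ c → 6 * U c)                               ≡⟨ sum-*ˡ 6 U ⟩
      6 * sum U                                         ≡⟨ cong (6 *_) sum-U ⟩
      264                                               ∎

    U2 : ℕ
    U2 = sum (λ c → U c * U c)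

    -- One factor N is expanded over the point classes and the other is summed by `pencil-N`,
    -- leaving the sum of `U (44 + 5 U)`; 1936 is 44².
    sum-N² : sum (λ m → N m * N m) ≡ 1936 + 5 * U2
    sum-N² = begin
      sum (λ m → N m * N m)
        ≡⟨ sum-cong-≗ (λ m → trans (cong (_* N m) (N-incidence m)) (sym (sum-*ʳ (N m) (λ c → incidence pt m c * U c)))) ⟩
      sum (λ m → sum (λ c → incidence pt m c * U c * N m))
        ≡⟨ ∑-comm (λ m c → incidence pt m c * U c * N m) ⟩
      sum (λ c → sum (λ m → incidence pt m c * U c * N m))
        ≡⟨ sum-cong-≗ (λ c → trans (sum-cong-≗ λ m → rotate (incidence pt m c) (U c) (N m))
             (trans (sum-*ˡ (U c) (λ m → incidence pt m c * N m)) (cong (U c *_) (pencil-N c)))) ⟩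
      sum (λ c → U c * (44 + 5 * U c))
        ≡⟨ sum-cong-≗ (λ c → expand (U c)) ⟩
      sum (λ c → 44 * U c + 5 * (U c * U c))
        ≡⟨ ∑-distrib-+ (λ c → 44 * U c) (λ c → 5 * (U c * U c)) ⟩
      sum (λ c → 44 * U c) + sum (λ c → 5 * (U c * U c))
        ≡⟨ cong₂ _+_ (trans (sum-*ˡ 44 U) (cong (44 *_) sum-U)) (sum-*ˡ 5 (λ c → U c * U c)) ⟩
      1936 + 5 * U2 ∎
      where
      rotate : ∀ a b c → a * b * c ≡ b * (a * c)
      rotate = solve-∀
      expand : ∀ x → x * (44 + 5 * x) ≡ 44 * x + 5 * (x * x)
      expand = solve-∀

    -- The squares count ordered pairs of arc points of `c` in a common segment.
    sum-segment² : ∀ m c → sum (λ s → segment m c s * segment m c s) ≡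
      sum (λ i → sum (λ j → δ c (cls i) * δ c (cls j) * δ (label m c (pos i)) (label m c (pos j))))
    sum-segment² m c = begin
      sum (λ s → segment m c s * segment m c s)
        ≡⟨ sum-cong-≗ (λ s → sum-*-sum (λ i → a i * δ (l i) s) (λ j → a j * δ (l j) s)) ⟨
      sum (λ s → sum (λ i → sum (λ j → a i * δ (l i) s * (a j * δ (l j) s))))
        ≡⟨ ∑-comm (λ s i → sum (λ j → a i * δ (l i) s * (a j * δ (l j) s))) ⟩
      sum (λ i → sum (λ s → sum (λ j → a i * δ (l i) s * (a j * δ (l j) s))))
        ≡⟨ sum-cong-≗ (λ i → ∑-comm (λ s j → a i * δ (l i) s * (a j * δ (l j) s))) ⟩
      sum (λ i → sum (λ j → sum (λ s → a i * δ (l i) s * (a j * δ (l j) s))))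
        ≡⟨ sum-cong-≗ (λ i → sum-cong-≗ λ j → begin
             sum (λ s → a i * δ (l i) s * (a j * δ (l j) s))
               ≡⟨ sum-cong-≗ (λ s → interchange (a i) (δ (l i) s) (a j) (δ (l j) s)) ⟩
             sum (λ s → a i * a j * (δ (l i) s * δ (l j) s))
               ≡⟨ sum-*ˡ (a i * a j) (λ s → δ (l i) s * δ (l j) s) ⟩
             a i * a j * sum (λ s → δ (l i) s * δ (l j) s)
               ≡⟨ cong (a i * a j *_) (trans (sum-δˡ (l i) (δ (l j))) (δ-sym (l j) (l i))) ⟩
             a i * a j * δ (l i) (l j) ∎) ⟩
      sum (λ i → sum (λ j → a i * a j * δ (l i) (l j))) ∎
      where
      a = λ i → δ c (cls i)
      l = λ i → label m c (pos i)
      interchange : ∀ a b c d → a * b * (c * d) ≡ a * c * (b * d)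
      interchange = solve-∀

    -- Two points of a class lie in a common segment in exactly one direction.
    pencil-segment² : ∀ c → sum (λ m → incidence pt m c * sum (λ s → segment m c s * segment m c s)) ≡ U c * U c + 5 * U c
    pencil-segment² c = begin
      sum (λ m → I m * sum (λ s → segment m c s * segment m c s))
        ≡⟨ sum-cong-≗ (λ m → trans (cong (I m *_) (sum-segment² m c))
             (trans (sym (sum-*ˡ (I m) (λ i → sum (λ j → a i * a j * δ (l m i) (l m j)))))
               (sum-cong-≗ λ i → sym (sum-*ˡ (I m) (λ j → a i * a j * δ (l m i) (l m j)))))) ⟩
      sum (λ m → sum (λ i → sum (λ j → I m * (a i * a j * δ (l m i) (l m j)))))
        ≡⟨ ∑-comm (λ m i → sum (λ j → I m * (a i * a j * δ (l m i) (l m j)))) ⟩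
      sum (λ i → sum (λ m → sum (λ j → I m * (a i * a j * δ (l m i) (l m j)))))
        ≡⟨ sum-cong-≗ (λ i → ∑-comm (λ m j → I m * (a i * a j * δ (l m i) (l m j)))) ⟩
      sum (λ i → sum (λ j → sum (λ m → I m * (a i * a j * δ (l m i) (l m j)))))
        ≡⟨ sum-cong-≗ (λ i → sum-cong-≗ (λ j → pairs i j)) ⟩
      sum (λ i → sum (λ j → a i * a j + δ i j * (5 * a j)))
        ≡⟨ sum-cong-≗ (λ i → ∑-distrib-+ (λ j → a i * a j) (λ j → δ i j * (5 * a j))) ⟩
      sum (λ i → sum (λ j → a i * a j) + sum (λ j → δ i j * (5 * a j)))
        ≡⟨ ∑-distrib-+ (λ i → sum (λ j → a i * a j)) (λ i → sum (λ j → δ i j * (5 * a j))) ⟩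
      sum (λ i → sum (λ j → a i * a j)) + sum (λ i → sum (λ j → δ i j * (5 * a j)))
        ≡⟨ cong₂ _+_ (sum-*-sum a a) (trans (sum-cong-≗ λ i → sum-δˡ i (λ j → 5 * a j)) (sum-*ˡ 5 a)) ⟩
      U c * U c + 5 * U c ∎
      where
      I = λ m → incidence pt m c
      a = λ i → δ c (cls i)
      l = λ m i → label m c (pos i)
      rotate : ∀ x y z → x * (y * z) ≡ y * (x * z)
      rotate = solve-∀
      -- The extra term in `slopes` is concentrated on i = j, because by `code-injective` two
      -- different arc points never share both class and position.
      same : ∀ i j → a i * a j * (5 * δ (pos i) (pos j)) ≡ δ i j * (5 * a j)
      same i j with i ≟ᶠ j
      ... | yes refl = begin
        a i * a i * (5 * δ (pos i) (pos i))  ≡⟨ cong₂ (λ x y → x * (5 * y)) (δ-idem c (cls i)) (δ-refl (pos i)) ⟩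
        a i * 5                              ≡⟨ *-comm (a i) 5 ⟩
        5 * a i                              ≡⟨ trans (cong (_* (5 * a i)) (δ-refl i)) (*-identityˡ _) ⟨
        δ i i * (5 * a i)                    ∎
      ... | no i≢j = trans vanish (sym (cong (_* (5 * a j)) (δ-≢ i≢j)))
        where
        vanish : a i * a j * (5 * δ (pos i) (pos j)) ≡ 0
        vanish with c ≟ᶠ cls i | c ≟ᶠ cls j | pos i ≟ᶠ pos j
        ... | no c≢ | _ | _ = cong (λ x → x * a j * (5 * δ (pos i) (pos j))) (δ-≢ c≢)
        ... | yes _ | no c≢ | _ = trans (cong (λ x → a i * x * (5 * δ (pos i) (pos j))) (δ-≢ c≢))
                                    (cong (_* (5 * δ (pos i) (pos j))) (*-zeroʳ (a i)))
        ... | yes _ | yes _ | no pos≢ = trans (cong (λ x → a i * a j * (5 * x)) (δ-≢ pos≢)) (*-zeroʳ (a i * a j))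
        ... | yes c≡i | yes c≡j | yes pos≡ = contradiction (code-injective i j (trans (sym c≡i) c≡j) pos≡) i≢j
      pairs : ∀ i j → sum (λ m → I m * (a i * a j * δ (l m i) (l m j))) ≡ a i * a j + δ i j * (5 * a j)
      pairs i j = begin
        sum (λ m → I m * (a i * a j * δ (l m i) (l m j)))
          ≡⟨ sum-cong-≗ (λ m → rotate (I m) (a i * a j) (δ (l m i) (l m j))) ⟩
        sum (λ m → a i * a j * (I m * δ (l m i) (l m j)))
          ≡⟨ sum-*ˡ (a i * a j) (λ m → I m * δ (l m i) (l m j)) ⟩
        a i * a j * sum (λ m → I m * δ (l m i) (l m j))
          ≡⟨ cong (a i * a j *_) (slopes c (pos i) (pos j)) ⟩
        a i * a j * (1 + 5 * δ (pos i) (pos j))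
          ≡⟨ *-distribˡ-+ (a i * a j) 1 (5 * δ (pos i) (pos j)) ⟩
        a i * a j * 1 + a i * a j * (5 * δ (pos i) (pos j))
          ≡⟨ cong₂ _+_ (*-identityʳ _) (same i j) ⟩
        a i * a j + δ i j * (5 * a j) ∎

    flagSum-Q : ∀ c → flagSum c Q ≡ U c * U c + 5 * U c
    flagSum-Q c = begin
      flagSum c Q
        ≡⟨ sum-cong-≗ (λ m → sum-cong-≗ λ e → δ-subst (λ c′ → sum (λ s → segment m c′ s * segment m c′ s)) (pt m e) c) ⟩
      flagSum c (λ m _ → sum (λ s → segment m c s * segment m c s))
        ≡⟨ flagSum-line c (λ m → sum (λ s → segment m c s * segment m c s)) ⟩
      sum (λ m → incidence pt m c * sum (λ s → segment m c s * segment m c s))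
        ≡⟨ pencil-segment² c ⟩
      U c * U c + 5 * U c ∎

    -- Adds an inequality over the six line classes through `c`; both totals on the left are known,
    -- from `pencil-N` and `flagSum-Q`.
    class-bound : ∀ α β γ c → (∀ m e → pt m e ≡ c → α * N m + β * Q m e ≤ γ) →
                  α * (44 + 5 * U c) + β * (U c * U c + 5 * U c) ≤ 6 * γ
    class-bound α β γ c bound = ≤-trans (≤-reflexive (sym total)) (≤-trans termwise (≤-reflexive constant))
      where
      total : flagSum c (λ m e → α * N m + β * Q m e) ≡ α * (44 + 5 * U c) + β * (U c * U c + 5 * U c)
      total = begin
        flagSum c (λ m e → α * N m + β * Q m e)
          ≡⟨ sum-cong-≗ (λ m → trans (sum-cong-≗ λ e → split (δ (pt m e) c) α (N m) β (Q m e))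
               (trans (∑-distrib-+ (λ e → α * (δ (pt m e) c * N m)) (λ e → β * (δ (pt m e) c * Q m e)))
                 (cong₂ _+_ (sum-*ˡ α (λ e → δ (pt m e) c * N m)) (sum-*ˡ β (λ e → δ (pt m e) c * Q m e))))) ⟩
        sum (λ m → α * sum (λ e → δ (pt m e) c * N m) + β * sum (λ e → δ (pt m e) c * Q m e))
          ≡⟨ ∑-distrib-+ (λ m → α * sum (λ e → δ (pt m e) c * N m)) (λ m → β * sum (λ e → δ (pt m e) c * Q m e)) ⟩
        sum (λ m → α * sum (λ e → δ (pt m e) c * N m)) + sum (λ m → β * sum (λ e → δ (pt m e) c * Q m e))
          ≡⟨ cong₂ _+_ (sum-*ˡ α (λ m → sum (λ e → δ (pt m e) c * N m))) (sum-*ˡ β (λ m → sum (λ e → δ (pt m e) c * Q m e))) ⟩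
        α * flagSum c (λ m _ → N m) + β * flagSum c Q
          ≡⟨ cong₂ (λ x y → α * x + β * y) (trans (flagSum-line c N) (pencil-N c)) (flagSum-Q c) ⟩
        α * (44 + 5 * U c) + β * (U c * U c + 5 * U c) ∎
        where
        split : ∀ d a n b q → d * (a * n + b * q) ≡ a * (d * n) + b * (d * q)
        split = solve-∀
      termwise : flagSum c (λ m e → α * N m + β * Q m e) ≤ flagSum c (λ _ _ → γ)
      termwise = sum-mono-≤ λ m → sum-mono-≤ λ e → term m e
        where
        term : ∀ m e → δ (pt m e) c * (α * N m + β * Q m e) ≤ δ (pt m e) c * γ
        term m e with pt m e ≟ᶠ c
        ... | yes pt≡c = *-monoʳ-≤ (δ (pt m e) c) (bound m e pt≡c)
        ... | no  pt≢c = ≤-trans (≤-reflexive (cong (_* (α * N m + β * Q m e)) (δ-≢ pt≢c))) z≤n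
      constant : flagSum c (λ _ _ → γ) ≡ 6 * γ
      constant = begin
        flagSum c (λ _ _ → γ)                ≡⟨ flagSum-line c (λ _ → γ) ⟩
        sum (λ m → incidence pt m c * γ)     ≡⟨ sum-*ʳ γ (λ m → incidence pt m c) ⟩
        sum (λ m → incidence pt m c) * γ     ≡⟨ cong (_* γ) (pencil c) ⟩
        6 * γ                                ∎

    N+5segment≤ : ∀ m e s → N m + 5 * segment m (pt m e) s ≤ 15 + U (pt m e)
    N+5segment≤ m e s = ≤-trans (M.N+5h≤15+u m (deg≤3 m) e s) (≤-reflexive (cong (15 +_) (u≡U m e)))

    -- Weighting the cap of each segment by its h points gives `U N + 5 Q ≤ U (15 + U)`. Over the
    -- pencil, after cancelling U, this is 69 + 10 U ≤ 90 + 6 U, which fails from U = 6 on.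
    U≤5 : ∀ c → U c ≤ 5
    U≤5 c = ≮⇒≥ λ 5<U → impossible (U c) 5<U (class-bound (U c) 5 (U c * (15 + U c)) c weighted)
      where
      weighted : ∀ m e → pt m e ≡ c → U c * N m + 5 * Q m e ≤ U c * (15 + U c)
      weighted m e refl = ≤-trans (≤-reflexive (begin
        U (pt m e) * N m + 5 * Q m e
          ≡⟨ cong₂ _+_ (cong (_* N m) (u≡U m e)) (sum-*ˡ 5 (λ s → h s * h s)) ⟨
        u m e * N m + sum (λ s → 5 * (h s * h s))
          ≡⟨ cong (_+ sum (λ s → 5 * (h s * h s))) (sum-*ʳ (N m) h) ⟨
        sum (λ s → h s * N m) + sum (λ s → 5 * (h s * h s))
          ≡⟨ ∑-distrib-+ (λ s → h s * N m) (λ s → 5 * (h s * h s)) ⟨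
        sum (λ s → h s * N m + 5 * (h s * h s))
          ≡⟨ sum-cong-≗ (λ s → factor (h s) (N m)) ⟩
        sum (λ s → h s * (N m + 5 * h s)) ∎))
        (≤-trans (sum-mono-≤ λ s → *-monoʳ-≤ (h s) (N+5segment≤ m e s))
          (≤-reflexive (trans (sum-*ʳ (15 + U (pt m e)) h) (cong (_* (15 + U (pt m e))) (u≡U m e)))))
        where
        h = segment m (pt m e)
        factor : ∀ x n → x * n + 5 * (x * x) ≡ x * (n + 5 * x)
        factor = solve-∀
      impossible : ∀ x → 5 < x → x * (44 + 5 * x) + 5 * (x * x + 5 * x) ≤ 6 * (x * (15 + x)) → ⊥
      impossible x 5<x ≤6γ = <⇒≱ (m<m+n (6 * (x * (15 + x))) {excess x} positive)
        (≤-trans (≤-reflexive (subst (λ z → 6 * (z * (15 + z)) + excess z ≡ z * (44 + 5 * z) + 5 * (z * z + 5 * z))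
          (m+[n∸m]≡n 5<x) (identity (x ∸ 6)))) ≤6γ)
        where
        -- The two sides differ by x (4 x - 21), which is x (3 + 4 y) for x = 6 + y.
        excess : ℕ → ℕ
        excess z = z * (3 + 4 * (x ∸ 6))
        positive : 0 < excess x
        positive = *-mono-≤ (≤-trans (s≤s z≤n) 5<x) (s≤s z≤n)
        identity : ∀ y → 6 * ((6 + y) * (15 + (6 + y))) + (6 + y) * (3 + 4 * y) ≡
                   (6 + y) * (44 + 5 * (6 + y)) + 5 * ((6 + y) * (6 + y) + 5 * (6 + y))
        identity = solve-∀

    row-bound : ∀ α β γ B x → RowBounds α β γ B x → ∀ c → U c ≡ x → (∀ m → N m ≤ B) →
                α * (44 + 5 * x) + β * (x * x + 5 * x) ≤ 6 * γ
    row-bound α β γ B x bounds c refl N≤B = class-bound α β γ c λ { m e refl →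
      applyRowBounds α β γ B x bounds (N m) (segment m (pt m e)) (u≡U m e)
        (M.h≤3 m (deg≤3 m) e) (N+5segment≤ m e) (N≤B m) }

    ≤∧≢⇒≤ : ∀ {x n} → x ≤ suc n → x ≢ suc n → x ≤ n
    ≤∧≢⇒≤ x≤ x≢ = s≤s⁻¹ (≤∧≢⇒< x≤ x≢)

    module _ {b} (U≤b : ∀ c → U c ≤ b) where
      u≤b : ∀ m e → u m e ≤ b
      u≤b m e = ≤-trans (≤-reflexive (u≡U m e)) (U≤b (pt m e))

    -- At U = 5 the pencil total is 4 * 69 + 5 * 50 = 526, above 6 * 85 = 510.
    U≤4 : ∀ c → U c ≤ 4
    U≤4 c = ≤∧≢⇒≤ (U≤5 c) λ U≡5 → from-no (526 ≤? 510) (row-bound 4 5 85 20 5 rowBounds₅ c U≡5 λ m →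
      ≤-trans (m≤m+n (N m) _) (≤-trans (N+5segment≤ m 0F 0F) (+-monoʳ-≤ 15 (U≤5 (pt m 0F)))))

    -- At U = 4 the pencil total is 4 * 64 + 3 * 36 = 364, above 6 * 60 = 360.
    U≤3 : ∀ c → U c ≤ 3
    U≤3 c = ≤∧≢⇒≤ (U≤4 c) λ U≡4 → from-no (364 ≤? 360) (row-bound 4 3 60 12 4 rowBounds₄ c U≡4 λ m →
      M.u≤4⇒N≤12 m (deg≤3 m) (u≤b U≤4 m))

    -- At U = 3 the pencil total is 3 * 59 + 4 * 24 = 273, above 6 * 45 = 270.
    U≤2 : ∀ c → U c ≤ 2
    U≤2 c = ≤∧≢⇒≤ (U≤3 c) λ U≡3 → from-no (273 ≤? 270) (row-bound 3 4 45 11 3 rowBounds₃ c U≡3 λ m →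
      M.u≤3⇒N≤11 m (deg≤3 m) (u≤b U≤3 m))

    -- The choice of 10 and 11 in `(N - 10) (N - 11) ≥ 0` is dictated here. A class of two points
    -- raises the sum of N² by 10, through `5 * U2`. Its own line class has N ≤ 7 and so contributes
    -- at least 3 * 4 = 12 to the sum of these products, which outweighs 10; with 9 and 10 it would
    -- be only 2 * 3 = 6.
    U2≤66 : U2 ≤ 66
    U2≤66 = +-cancelˡ-≤ (5 * U2 + 5280) U2 66 (≤-trans (≤-reflexive (sym lhs)) (≤-trans
      (sum-mono-≤ λ m → M.u≤2⇒6Q+15N≤N²+110 m (deg≤3 m) (u≤b U≤2 m)) (≤-reflexive rhs)))
      where
      lhs : sum (λ m → 6 * sum (Q m) + 15 * N m) ≡ 5 * U2 + 5280 + U2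
      lhs = begin
        sum (λ m → 6 * sum (Q m) + 15 * N m)
          ≡⟨ ∑-distrib-+ (λ m → 6 * sum (Q m)) (λ m → 15 * N m) ⟩
        sum (λ m → 6 * sum (Q m)) + sum (λ m → 15 * N m)
          ≡⟨ cong₂ _+_ (sum-*ˡ 6 (λ m → sum (Q m))) (sum-*ˡ 15 N) ⟩
        6 * sum (λ m → sum (Q m)) + 15 * sum N
          ≡⟨ cong₂ (λ x y → 6 * x + 15 * y) (sym (sum-flagSum Q)) sum-N ⟩
        6 * sum (λ c → flagSum c Q) + 3960
          ≡⟨ cong (λ x → 6 * x + 3960) (trans (sum-cong-≗ flagSum-Q)
               (trans (∑-distrib-+ (λ c → U c * U c) (λ c → 5 * U c)) (cong (U2 +_) (trans (sum-*ˡ 5 U) (cong (5 *_) sum-U))))) ⟩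
        6 * (U2 + 220) + 3960
          ≡⟨ rearrange U2 ⟩
        5 * U2 + 5280 + U2 ∎
        where
        rearrange : ∀ x → 6 * (x + 220) + 3960 ≡ 5 * x + 5280 + x
        rearrange = solve-∀
      rhs : sum (λ m → N m * N m + 110) ≡ 5 * U2 + 5280 + 66
      rhs = begin
        sum (λ m → N m * N m + 110)                    ≡⟨ ∑-distrib-+ (λ m → N m * N m) (λ _ → 110) ⟩
        sum (λ m → N m * N m) + sum (λ (_ : Fin 31) → 110) ≡⟨ cong₂ _+_ sum-N² (sum-const 31 110) ⟩
        1936 + 5 * U2 + 3410                           ≡⟨ rearrange (5 * U2) ⟩
        5 * U2 + 5280 + 66                             ∎
        where
        rearrange : ∀ x → 1936 + x + 3410 ≡ x + 5280 + 66
        rearrange = solve-∀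

    -- Sum `(U - 1) (U - 2) ≥ 0` over the 31 classes: 3 * 44 - 2 * 31 = 70.
    70≤U2 : 70 ≤ U2
    70≤U2 = +-cancelʳ-≤ 62 70 U2 (≤-trans (≤-reflexive (sym lhs)) (≤-trans
      (sum-mono-≤ λ c → 3x≤x²+2 (U c)) (≤-reflexive rhs)))
      where
      3x≤x²+2 : ∀ x → 3 * x ≤ x * x + 2
      3x≤x²+2 0 = z≤n
      3x≤x²+2 1 = ≤-refl
      3x≤x²+2 2 = ≤-refl
      3x≤x²+2 (suc (suc (suc x))) = ≤-trans (*-monoˡ-≤ (3 + x) {3} {3 + x} (m≤m+n 3 x)) (m≤m+n _ 2)
      lhs : sum (λ c → 3 * U c) ≡ 132
      lhs = trans (sum-*ˡ 3 U) (cong (3 *_) sum-U)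
      rhs : sum (λ c → U c * U c + 2) ≡ U2 + 62
      rhs = trans (∑-distrib-+ (λ c → U c * U c) (λ _ → 2)) (cong (U2 +_) (sum-const 31 2))

    no-44-arc : ⊥
    no-44-arc = from-no (70 ≤? 66) (≤-trans 70≤U2 U2≤66)

-- Coordinates modulo 5 for the classes and their segments

module Coordinates where

  open Counting using (incidence; module Plane)
  open Summation
  open import Data.Bool.Base using (Bool; true; false; _∧_; _∨_; not; if_then_else_; T)
  open import Data.Empty using (⊥)
  open import Data.Fin.Base using (Fin; zero; suc; toℕ; splitAt; remQuot; combine; _↑ˡ_; _↑ʳ_)
  open import Data.Fin.Patterns using (0F; 1F; 2F)
  open import Data.Fin.Properties using (splitAt-↑ˡ; splitAt-↑ʳ; remQuot-combine; toℕ-injective; toℕ-fromℕ<) renaming (_≟_ to _≟ᶠ_)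
  open import Data.Nat.Base
  open import Data.Nat.DivMod using (_%_; _mod_; m%n<n; %-distribˡ-+; %-distribˡ-*; [m+kn]%n≡m%n)
  open import Data.Nat.Properties
  open import Data.Nat.Tactic.RingSolver using (solve-∀)
  open import Data.Product.Base using (_×_; _,_; ∃₂; proj₁; proj₂; uncurry)
  open import Data.Sum.Base using ([_,_]′)
  open import Data.Vec.Functional using (Vector)
  open import Function.Base using (_∘_; const)
  open import Relation.Binary.PropositionalEquality
  open import Relation.Nullary.Decidable using (yes; no; from-no)
  open import Relation.Nullary.Negation using (contradiction)

  -- Boolean-valued, so that the exhaustive checks below hold by `refl`.
  every : ∀ {n} → (Fin n → Bool) → Bool
  every {zero}  f = true
  every {suc n} f = f zero ∧ every (f ∘ suc)

  ∧-true : ∀ a b → a ∧ b ≡ true → a ≡ true × b ≡ true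
  ∧-true true true refl = refl , refl

  ∨-false : ∀ {a b} → a ∨ b ≡ true → a ≡ false → b ≡ true
  ∨-false eq refl = eq

  every-sound : ∀ {n} (f : Fin n → Bool) → every f ≡ true → ∀ i → f i ≡ true
  every-sound f eq zero    = proj₁ (∧-true (f zero) _ eq)
  every-sound f eq (suc i) = every-sound (f ∘ suc) (proj₂ (∧-true (f zero) _ eq)) i

  ≡ᵇ-sound : ∀ {m n} → (m ≡ᵇ n) ≡ true → m ≡ n
  ≡ᵇ-sound {m} {n} eq = ≡ᵇ⇒≡ m n (subst T (sym eq) _)

  ⟨_,_,_⟩ : ∀ {a} {A : Set a} → A → A → A → Vector A 3
  ⟨ x , y , z ⟩ 0F = x
  ⟨ x , y , z ⟩ 1F = y
  ⟨ x , y , z ⟩ 2F = z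

  -- Points of PG(2,5) by the position of the leading 1 in their normalised coordinates. Line
  -- classes are named by the same type, through their coefficient vectors.
  data Class : Set where
    affine  : Fin 5 → Fin 5 → Class
    ideal   : Fin 5 → Class
    extreme : Class

  class : Fin 31 → Class
  class c = [ uncurry affine ∘ remQuot 5 , [ ideal , const extreme ]′ ∘ splitAt 5 ]′ (splitAt 25 c)

  index : Class → Fin 31
  index (affine a b) = combine a b ↑ˡ 6
  index (ideal a)    = 25 ↑ʳ (a ↑ˡ 1)
  index extreme      = 25 ↑ʳ (5 ↑ʳ 0F)

  class-index : ∀ k → class (index k) ≡ k
  class-index (affine a b) rewrite splitAt-↑ˡ 25 (combine a b) 6 = cong (uncurry affine) (remQuot-combine a b)
  class-index (ideal a) rewrite splitAt-↑ʳ 25 6 (a ↑ˡ 1) | splitAt-↑ˡ 5 a 1 = refl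
  class-index extreme = refl

  everyClass : (Class → Bool) → Bool
  everyClass f = every (λ a → every (λ b → f (affine a b))) ∧ (every (f ∘ ideal) ∧ f extreme)

  everyClass-sound : ∀ f → everyClass f ≡ true → ∀ k → f k ≡ true
  everyClass-sound f eq k = go k
    where
    affines = ∧-true (every (λ a → every (f ∘ affine a))) _ eq
    ideals  = ∧-true (every (f ∘ ideal)) _ (proj₂ affines)
    go : ∀ k → f k ≡ true
    go (affine a b) = every-sound (f ∘ affine a) (every-sound (λ a → every (f ∘ affine a)) (proj₁ affines) a) b
    go (ideal a)    = every-sound (f ∘ ideal) (proj₁ ideals) a
    go extreme      = proj₂ ideals

  coordinates : Class → Vector (Fin 5) 3
  coordinates (affine a b) = ⟨ 1F , a , b ⟩
  coordinates (ideal a)    = ⟨ 0F , 1F , a ⟩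
  coordinates extreme      = ⟨ 0F , 0F , 1F ⟩

  -- The tangent vectors of a class, normalised to vanish where its leading 1 is.
  tangent : Class → Fin 5 → Fin 5 → Vector (Fin 5) 3
  tangent (affine _ _) a b = ⟨ 0F , a , b ⟩
  tangent (ideal _)    a b = ⟨ a , 0F , b ⟩
  tangent extreme      a b = ⟨ a , b , 0F ⟩

  project : Class → Vector (Fin 5) 3 → Fin 5 × Fin 5
  project (affine _ _) x = x 1F , x 2F
  project (ideal _)    x = x 0F , x 2F
  project extreme      x = x 0F , x 1F

  dot : Vector (Fin 5) 3 → Vector (Fin 5) 3 → ℕ
  dot x y = toℕ (x 0F) * toℕ (y 0F) + (toℕ (x 1F) * toℕ (y 1F) + toℕ (x 2F) * toℕ (y 2F))

  incident : Class → Class → ℕ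
  incident k l = if dot (coordinates k) (coordinates l) % 5 ≡ᵇ 0 then 1 else 0

  normalise : Vector (Fin 5) 3 → Class
  normalise x = cases (x 0F) (x 1F) (x 2F)
    where
    -- By Fermat's theorem the cube inverts a nonzero residue modulo 5.
    inverse : Fin 5 → ℕ
    inverse a = toℕ a * toℕ a * toℕ a
    cases : Fin 5 → Fin 5 → Fin 5 → Class
    cases zero      zero      c = extreme
    cases zero      b@(suc _) c = ideal ((toℕ c * inverse b) mod 5)
    cases a@(suc _) b         c = affine ((toℕ b * inverse a) mod 5) ((toℕ c * inverse a) mod 5)

  -- Representatives of the six points of the projective line over 𝔽₅.
  slopes : Fin 6 → Fin 5 × Fin 5
  slopes zero    = 0F , 1F
  slopes (suc e) = 1F , e

  -- The e-th point of the line with coordinates k is found by prescribing its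
  -- coordinates other than the one that is solved for.
  onLine : Class → Fin 6 → Class
  onLine k e = normalise (lift k (slopes e))
    where
    lift : Class → Fin 5 × Fin 5 → Vector (Fin 5) 3
    -- The factor 4 stands for -1 modulo 5, here and in the formulas below.
    lift (affine a b) (p , q) = ⟨ (4 * (toℕ a * toℕ p + toℕ b * toℕ q)) mod 5 , p , q ⟩
    lift (ideal a)    (p , q) = ⟨ p , (4 * (toℕ a * toℕ q)) mod 5 , q ⟩
    lift extreme      (p , q) = ⟨ p , q , 0F ⟩

  slope : Fin 5 × Fin 5 → Fin 5 × Fin 5 → ℕ
  slope (p , q) (a , b) = toℕ a * toℕ p + toℕ b * toℕ q

  det : Fin 5 × Fin 5 → Fin 5 × Fin 5 → ℕ
  det (p , q) (p′ , q′) = toℕ p * toℕ q′ + 4 * (toℕ q * toℕ p′)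

  -- The linear form that `l` induces on the tangent vectors of the class `k`.
  rest : Class → Class → Fin 5 × Fin 5
  rest k l = project k (coordinates l)

  δᵇ : ∀ {n} → Fin n → Fin n → Bool
  δᵇ i j = δ i j ≡ᵇ 1

  -- Cramer's rule for the point at which the forms r and r′ take the values -s and -s′; `d` is the
  -- inverse of the determinant.
  cramer : Fin 5 × Fin 5 → Fin 5 × Fin 5 → Fin 5 → Fin 5 → Fin 5 × Fin 5
  cramer r@(p , q) r′@(p′ , q′) s s′ =
    (d * (toℕ q * toℕ s′ + 4 * (toℕ q′ * toℕ s))) mod 5 , (d * (toℕ p′ * toℕ s + 4 * (toℕ p * toℕ s′))) mod 5
    where d = det r r′ * det r r′ * det r r′

  everyClass₂-sound : ∀ (f : Class → Class → Bool) → everyClass (λ k → everyClass (f k)) ≡ true → ∀ k l → f k l ≡ true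
  everyClass₂-sound f eq k = everyClass-sound (f k) (everyClass-sound (λ k → everyClass (f k)) eq k)

  incidenceᵇ joinsᵇ : Class → Class → Bool
  incidenceᵇ k l = sum (λ e → δ (index (onLine k e)) (index l)) ≡ᵇ incident k l
  joinsᵇ k l = sum (λ m → incident (class m) k * incident (class m) l) ≡ᵇ 1 + 5 * δ (index k) (index l)

  pencilᵇ : Class → Bool
  pencilᵇ k = sum (λ m → incident (class m) k) ≡ᵇ 6

  independentᵇ : Class → Fin 6 → Fin 6 → Bool
  independentᵇ k e e′ = δᵇ e e′ ∨ not (det (rest k (onLine k e)) (rest k (onLine k e′)) % 5 ≡ᵇ 0)

  solvesᵇ : (r r′ : Fin 5 × Fin 5) → Fin 5 → Fin 5 → Bool
  solvesᵇ r r′ s s′ = ((4 * slope r ab) % 5 ≡ᵇ toℕ s) ∧ ((4 * slope r′ ab) % 5 ≡ᵇ toℕ s′)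
    where ab = cramer r r′ s s′

  cramerᵇ : (p q p′ q′ : Fin 5) → Bool
  cramerᵇ p q p′ q′ = (det (p , q) (p′ , q′) % 5 ≡ᵇ 0) ∨ every (λ s → every (λ s′ → solvesᵇ (p , q) (p′ , q′) s s′))

  opaque
    unfolding sum

    incidence-check : everyClass (λ k → everyClass (incidenceᵇ k)) ≡ true
    incidence-check = refl

    pencil-check : everyClass pencilᵇ ≡ true
    pencil-check = refl

    joins-check : everyClass (λ k → everyClass (joinsᵇ k)) ≡ true
    joins-check = refl

  independent-check : everyClass (λ k → every (λ e → every (λ e′ → independentᵇ k e e′))) ≡ true
  independent-check = refl

  cramer-check : every (λ p → every (λ q → every (λ p′ → every (λ q′ → cramerᵇ p q p′ q′)))) ≡ true
  cramer-check = refl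

  index-check : every (λ c → δᵇ (index (class c)) c) ≡ true
  index-check = refl

  index-class : ∀ c → index (class c) ≡ c
  index-class c = δ≡1⇒≡ _ _ (≡ᵇ-sound (every-sound (λ c → δᵇ (index (class c)) c) index-check c))

  det≢0 : ∀ k {e e′} → e ≢ e′ → det (rest k (onLine k e)) (rest k (onLine k e′)) % 5 ≢ 0
  det≢0 k {e} {e′} e≢e′ det≡0 = not-both (subst (λ x → not (x ≡ᵇ 0) ≡ true) det≡0 holds)
    where
    not-both : false ≢ true
    not-both ()
    holds : not (det (rest k (onLine k e)) (rest k (onLine k e′)) % 5 ≡ᵇ 0) ≡ true
    holds = ∨-false
      (every-sound (independentᵇ k e) (every-sound (λ e → every (independentᵇ k e))
        (everyClass-sound (λ k → every (λ e → every (independentᵇ k e))) independent-check k) e) e′)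
       (cong (_≡ᵇ 1) (δ-≢ e≢e′))

  toℕ-mod : ∀ x → toℕ (x mod 5) ≡ x % 5
  toℕ-mod x = toℕ-fromℕ< (m%n<n x 5)

  -- The sign is chosen so that incidence of a line with a point becomes equality of this value with
  -- the label of the point.
  segLin : Fin 5 × Fin 5 → Fin 25 → Fin 5
  segLin r t = (4 * slope r (remQuot 5 t)) mod 5

  cramer-solves : ∀ r r′ → det r r′ % 5 ≢ 0 → ∀ s s′ → let t = uncurry combine (cramer r r′ s s′) in
                  segLin r t ≡ s × segLin r′ t ≡ s′
  cramer-solves r@(p , q) r′@(p′ , q′) det≢0 s s′ = solves r s (proj₁ both) , solves r′ s′ (proj₂ both)
    where
    ab = cramer r r′ s s′
    nonzero : ∀ x → x ≢ 0 → (x ≡ᵇ 0) ≡ false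
    nonzero zero    x≢0 = contradiction refl x≢0
    nonzero (suc x) _   = refl
    both = ∧-true ((4 * slope r ab) % 5 ≡ᵇ toℕ s) _
      (every-sound (solvesᵇ r r′ s) (every-sound (λ s → every (solvesᵇ r r′ s))
        (∨-false (every-sound (cramerᵇ p q p′) (every-sound (λ p′ → every (cramerᵇ p q p′))
          (every-sound (λ q → every (λ p′ → every (cramerᵇ p q p′)))
            (every-sound (λ p → every (λ q → every (λ p′ → every (cramerᵇ p q p′)))) cramer-check p) q) p′) q′)
          (nonzero _ det≢0)) s) s′)
    solves : ∀ r s → ((4 * slope r ab) % 5 ≡ᵇ toℕ s) ≡ true → segLin r (uncurry combine ab) ≡ s
    solves r s eq = toℕ-injective (trans (toℕ-mod (4 * slope r (remQuot 5 (uncurry combine ab))))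
      (trans (cong (λ x → (4 * slope r x) % 5) (remQuot-combine (proj₁ ab) (proj₂ ab))) (≡ᵇ-sound eq)))

  module _ (k : Class) where
    open ≡-Reasoning

    line : Fin 6 → Fin 25 → Fin 5
    line e = segLin (rest k (onLine k e))

    -- All 25 counts are positive and they add up to 25.
    line-net₂ : ∀ e e′ → e ≢ e′ → ∀ s s′ → sum (λ t → δ (line e t) s * δ (line e′ t) s′) ≡ 1
    line-net₂ e e′ e≢e′ s s′ = sym (sum-tight (λ s′ → positive s s′) (≤-reflexive (sym (trans (sum-const 5 1)
      (sum-tight rows (≤-reflexive (trans total (sym (sum-const 5 5)))) s)))) s′)
      where
      count : Fin 5 → Fin 5 → ℕ
      count s s′ = sum (λ t → δ (line e t) s * δ (line e′ t) s′)
      positive : ∀ s s′ → 1 ≤ count s s′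
      positive s s′ = ≤-trans (≤-reflexive (sym (cong₂ _*_ (δ-≡ (proj₁ solved)) (δ-≡ (proj₂ solved)))))
        (term≤sum (λ t → δ (line e t) s * δ (line e′ t) s′) (uncurry combine (cramer r r′ s s′)))
        where
        r  = rest k (onLine k e)
        r′ = rest k (onLine k e′)
        solved = cramer-solves r r′ (det≢0 k e≢e′) s s′
      rows : ∀ s → 5 ≤ sum (count s)
      rows s = ≤-trans (≤-reflexive (sym (sum-const 5 1))) (sum-mono-≤ (positive s))
      total : sum (λ s → sum (count s)) ≡ 25
      total = begin
        sum (λ s → sum (λ s′ → sum (λ t → δ (line e t) s * δ (line e′ t) s′)))
          ≡⟨ sum-cong-≗ (λ s → ∑-comm (λ s′ t → δ (line e t) s * δ (line e′ t) s′)) ⟩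
        sum (λ s → sum (λ t → sum (λ s′ → δ (line e t) s * δ (line e′ t) s′)))
          ≡⟨ ∑-comm (λ s t → sum (λ s′ → δ (line e t) s * δ (line e′ t) s′)) ⟩
        sum (λ t → sum (λ s → sum (λ s′ → δ (line e t) s * δ (line e′ t) s′)))
          ≡⟨ sum-cong-≗ (λ t → trans (sum-*-sum (δ (line e t)) (δ (line e′ t)))
               (cong₂ _*_ (sum-δ (line e t)) (sum-δ (line e′ t)))) ⟩
        sum (λ (_ : Fin 25) → 1)
          ≡⟨ sum-const 25 1 ⟩
        25 ∎

    -- The segment shares exactly one line with each of the five segments of any other class.
    line-net₁ : ∀ e s → sum (λ t → δ (line e t) s) ≡ 5
    line-net₁ e s = begin
      sum (λ t → δ (line e t) s)
        ≡⟨ sum-cong-≗ (λ t → trans (cong (δ (line e t) s *_) (sum-δ (line (other e) t))) (*-identityʳ _)) ⟨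
      sum (λ t → δ (line e t) s * sum (δ (line (other e) t)))
        ≡⟨ sum-cong-≗ (λ t → sum-*ˡ (δ (line e t) s) (δ (line (other e) t))) ⟨
      sum (λ t → sum (λ s′ → δ (line e t) s * δ (line (other e) t) s′))
        ≡⟨ ∑-comm (λ t s′ → δ (line e t) s * δ (line (other e) t) s′) ⟩
      sum (λ s′ → sum (λ t → δ (line e t) s * δ (line (other e) t) s′))
        ≡⟨ sum-cong-≗ (λ s′ → line-net₂ e (other e) (distinct e) s s′) ⟩
      sum (λ (_ : Fin 5) → 1)
        ≡⟨ sum-const 5 1 ⟩
      5 ∎
      where
      other : Fin 6 → Fin 6
      other zero    = 1F
      other (suc _) = 0F
      distinct : ∀ e → e ≢ other e
      distinct zero ()
      distinct (suc _) ()

    -- At most one for w ≢ w′, since two directions determine a point; and the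
    -- bounds add up to the right total.
    line-slopes : ∀ w w′ → sum (λ e → δ (line e w) (line e w′)) ≡ 1 + 5 * δ w w′
    line-slopes w = sum-tight bound (≤-reflexive (trans rhs (sym lhs)))
      where
      bound : ∀ w′ → sum (λ e → δ (line e w) (line e w′)) ≤ 1 + 5 * δ w w′
      bound w′ with w ≟ᶠ w′
      ... | yes refl = ≤-reflexive (trans (sum-cong-≗ λ e → δ-refl (line e w))
                         (trans (sum-const 6 1) (cong (λ x → 1 + 5 * x) (sym (δ-refl w)))))
      ... | no  w≢w′ = ≤-trans (≮⇒≥ λ 1<Σ → atMostOne (sum-two (λ e → δ (line e w) (line e w′)) (λ e → δ≤1 (line e w) (line e w′)) 1<Σ))
                         (m≤m+n 1 (5 * δ w w′))
        where
        atMostOne : (∃₂ λ e e′ → e ≢ e′ × 1 ≤ δ (line e w) (line e w′) × 1 ≤ δ (line e′ w) (line e′ w′)) → ⊥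
        atMostOne (e , e′ , e≢e′ , p , q) = from-no (2 ≤? 1) (≤-trans
          (+-mono-≤ (≤-reflexive (sym (cong₂ _*_ (δ-refl (line e w)) (δ-refl (line e′ w)))))
                    (≤-reflexive (sym (cong₂ _*_ (δ-≡ (sym (δ≥1⇒≡ (line e w) (line e w′) p))) (δ-≡ (sym (δ≥1⇒≡ (line e′ w) (line e′ w′) q)))))))
          (≤-trans (two-terms≤sum (λ t → δ (line e t) (line e w) * δ (line e′ t) (line e′ w)) w≢w′)
          (≤-reflexive (line-net₂ e e′ e≢e′ (line e w) (line e′ w)))))
      lhs : sum (λ w′ → sum (λ e → δ (line e w) (line e w′))) ≡ 30
      lhs = begin
        sum (λ w′ → sum (λ e → δ (line e w) (line e w′)))
          ≡⟨ ∑-comm (λ w′ e → δ (line e w) (line e w′)) ⟩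
        sum (λ e → sum (λ w′ → δ (line e w) (line e w′)))
          ≡⟨ sum-cong-≗ (λ e → trans (sum-cong-≗ λ w′ → δ-sym (line e w) (line e w′)) (line-net₁ e (line e w))) ⟩
        sum (λ (_ : Fin 6) → 5)
          ≡⟨ sum-const 6 5 ⟩
        30 ∎
      rhs : sum (λ w′ → 1 + 5 * δ w w′) ≡ 30
      rhs = begin
        sum (λ w′ → 1 + 5 * δ w w′)                        ≡⟨ ∑-distrib-+ (λ _ → 1) (λ w′ → 5 * δ w w′) ⟩
        sum (λ (_ : Fin 25) → 1) + sum (λ w′ → 5 * δ w w′) ≡⟨ cong₂ _+_ (sum-const 25 1) (trans (sum-*ˡ 5 (δ w)) (cong (5 *_) (sum-δ w))) ⟩
        30                                                 ∎

  pt : Fin 31 → Fin 6 → Fin 31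
  pt m e = index (onLine (class m) e)

  incidence-pt : ∀ m c → incidence pt m c ≡ incident (class m) (class c)
  incidence-pt m c = trans (cong (λ x → sum (λ e → δ (pt m e) x)) (sym (index-class c)))
    (≡ᵇ-sound (everyClass₂-sound incidenceᵇ incidence-check (class m) (class c)))

  dot-comm : ∀ x y → dot x y ≡ dot y x
  dot-comm x y = cong₂ _+_ (*-comm (toℕ (x 0F)) (toℕ (y 0F)))
    (cong₂ _+_ (*-comm (toℕ (x 1F)) (toℕ (y 1F))) (*-comm (toℕ (x 2F)) (toℕ (y 2F))))

  incident-sym : ∀ k l → incident k l ≡ incident l k
  incident-sym k l = cong (λ x → if x % 5 ≡ᵇ 0 then 1 else 0) (dot-comm (coordinates k) (coordinates l))

  incident≤1 : ∀ k l → incident k l ≤ 1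
  incident≤1 k l with dot (coordinates k) (coordinates l) % 5
  ... | zero  = ≤-refl
  ... | suc _ = z≤n

  incident⇒ : ∀ k l → 1 ≤ incident k l → dot (coordinates k) (coordinates l) % 5 ≡ 0
  incident⇒ k l 1≤ with dot (coordinates k) (coordinates l) % 5
  ... | zero = refl

  pencil : ∀ c → sum (λ m → incidence pt m c) ≡ 6
  pencil c = trans (sum-cong-≗ λ m → incidence-pt m c) (≡ᵇ-sound (everyClass-sound pencilᵇ pencil-check (class c)))

  joins : ∀ c c′ → sum (λ m → incidence pt m c * incidence pt m c′) ≡ 1 + 5 * δ c c′
  joins c c′ = trans (sum-cong-≗ λ m → cong₂ _*_ (incidence-pt m c) (incidence-pt m c′))
    (trans (≡ᵇ-sound (everyClass₂-sound joinsᵇ joins-check (class c) (class c′)))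
      (cong₂ (λ x y → 1 + 5 * δ x y) (index-class c) (index-class c′)))

  seg : Fin 31 → Fin 6 → Fin 25 → Fin 5
  seg m = line (class m)

  module _ (κ : Class → Class → ℕ) where
    open ≡-Reasoning

    -- κ stays arbitrary: for fixed classes it shifts every label by the same constant.
    label : Fin 31 → Fin 31 → Fin 25 → Fin 5
    label m c w = (κ (class m) (class c) + slope (rest (class c) (class m)) (remQuot 5 w)) mod 5

    private
      4κ+ : ∀ κ x → (4 * κ + (κ + x)) % 5 ≡ x % 5
      4κ+ κ x = trans (cong (_% 5) (rearrange κ x)) ([m+kn]%n≡m%n x κ 5)
        where
        rearrange : ∀ κ x → 4 * κ + (κ + x) ≡ x + κ * 5
        rearrange = solve-∀

      4*4* : ∀ x → (4 * (4 * x)) % 5 ≡ x % 5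
      4*4* x = trans (cong (_% 5) (rearrange x)) ([m+kn]%n≡m%n x (3 * x) 5)
        where
        rearrange : ∀ x → 4 * (4 * x) ≡ x + 3 * x * 5
        rearrange = solve-∀

      mod-≡ : ∀ {x y} → x % 5 ≡ y % 5 → x mod 5 ≡ y mod 5
      mod-≡ {x} {y} eq = toℕ-injective (trans (toℕ-mod x) (trans eq (sym (toℕ-mod y))))

      ≡-mod : ∀ {x y} → x mod 5 ≡ y mod 5 → x % 5 ≡ y % 5
      ≡-mod {x} {y} eq = trans (sym (toℕ-mod x)) (trans (cong toℕ eq) (toℕ-mod y))

      %-cong-+ : ∀ a {x y} → x % 5 ≡ y % 5 → (a + x) % 5 ≡ (a + y) % 5
      %-cong-+ a {x} {y} eq = trans (%-distribˡ-+ a x 5) (trans (cong (λ z → (a % 5 + z) % 5) eq) (sym (%-distribˡ-+ a y 5)))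

      %-cong-* : ∀ a {x y} → x % 5 ≡ y % 5 → (a * x) % 5 ≡ (a * y) % 5
      %-cong-* a {x} {y} eq = trans (%-distribˡ-* a x 5) (trans (cong (λ z → (a % 5 * z) % 5) eq) (sym (%-distribˡ-* a y 5)))

      δ-⇔ : ∀ {n} {i j k l : Fin n} → (i ≡ j → k ≡ l) → (k ≡ l → i ≡ j) → δ i j ≡ δ k l
      δ-⇔ {i = i} {j} {k} {l} to from with i ≟ᶠ j
      ... | yes i≡j = trans (δ-≡ i≡j) (sym (δ-≡ (to i≡j)))
      ... | no  i≢j = trans (δ-≢ i≢j) (sym (δ-≢ (i≢j ∘ from)))

    -- The shift by κ and the factor 4 are both invertible modulo 5: adding `4 * κ` undoes the
    -- first, and a second factor 4 undoes the other.
    δ-label : ∀ m c w w′ → δ (label m c w) (label m c w′) ≡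
              δ (segLin (rest (class c) (class m)) w) (segLin (rest (class c) (class m)) w′)
    δ-label m c w w′ = δ-⇔
      (λ eq → mod-≡ {4 * x} {4 * y} (%-cong-* 4 {x} {y} (trans (sym (4κ+ k x)) (trans (%-cong-+ (4 * k) {k + x} {k + y} (≡-mod {k + x} {k + y} eq)) (4κ+ k y)))))
      (λ eq → mod-≡ {k + x} {k + y} (%-cong-+ k {x} {y} (trans (sym (4*4* x)) (trans (%-cong-* 4 {4 * x} {4 * y} (≡-mod {4 * x} {4 * y} eq)) (4*4* y)))))
      where
      k = κ (class m) (class c)
      x = slope (rest (class c) (class m)) (remQuot 5 w)
      y = slope (rest (class c) (class m)) (remQuot 5 w′)

    -- Incidence is symmetric in the coordinates, so the line classes through `c` can be listed as
    -- the points on the line with the coordinates of `c`; `line-slopes` then applies.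
    label-slopes : ∀ c w w′ → sum (λ m → incidence pt m c * δ (label m c w) (label m c w′)) ≡ 1 + 5 * δ w w′
    label-slopes c w w′ = begin
      sum (λ m → incidence pt m c * δ (label m c w) (label m c w′))
        ≡⟨ sum-cong-≗ (λ m → cong₂ _*_ (trans (incidence-pt m c) (trans (incident-sym (class m) (class c)) (sym (incidence-pt c m)))) (δ-label m c w w′)) ⟩
      sum (λ m → incidence pt c m * X (class m))
        ≡⟨ sum-cong-≗ (λ m → sum-*ʳ (X (class m)) (λ e → δ (pt c e) m)) ⟨
      sum (λ m → sum (λ e → δ (pt c e) m * X (class m)))
        ≡⟨ ∑-comm (λ m e → δ (pt c e) m * X (class m)) ⟩
      sum (λ e → sum (λ m → δ (pt c e) m * X (class m)))
        ≡⟨ sum-cong-≗ (λ e → trans (sum-δˡ (pt c e) (λ m → X (class m))) (cong X (class-index (onLine (class c) e)))) ⟩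
      sum (λ e → δ (line (class c) e w) (line (class c) e w′))
        ≡⟨ line-slopes (class c) w w′ ⟩
      1 + 5 * δ w w′ ∎
      where
      X : Class → ℕ
      X l = δ (segLin (rest (class c) l) w) (segLin (rest (class c) l) w′)

    -- The left-hand side is the θ-part of the product of line and point coordinates.
    label≡seg⇒0 : ∀ m c w t → label m c w ≡ segLin (rest (class m) (class c)) t →
      (κ (class m) (class c) + slope (rest (class c) (class m)) (remQuot 5 w) + slope (rest (class m) (class c)) (remQuot 5 t)) % 5 ≡ 0
    label≡seg⇒0 m c w t eq = begin
      (x + y) % 5              ≡⟨ cong (_% 5) (+-comm x y) ⟩
      (y + x) % 5              ≡⟨ %-cong-+ y {x} {4 * y} (≡-mod {x} {4 * y} eq) ⟩
      (y + 4 * y) % 5          ≡⟨ cong (_% 5) (rearrange y) ⟩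
      (0 + y * 5) % 5          ≡⟨ [m+kn]%n≡m%n 0 y 5 ⟩
      0                        ∎
      where
      x = κ (class m) (class c) + slope (rest (class c) (class m)) (remQuot 5 w)
      y = slope (rest (class m) (class c)) (remQuot 5 t)
      rearrange : ∀ y → y + 4 * y ≡ 0 + y * 5
      rearrange = solve-∀

    no-44-arc : (cls : Fin 44 → Fin 31) (pos : Fin 44 → Fin 25) →
      (∀ i j → cls i ≡ cls j → pos i ≡ pos j → i ≡ j) →
      (∀ m t → sum (λ i → sum (λ e → δ (pt m e) (cls i) * δ (label m (pt m e) (pos i)) (seg m e t))) ≤ 3) → ⊥
    no-44-arc = Plane.no-44-arc pt label seg (λ m → line-net₁ (class m)) (λ m → line-net₂ (class m))
      pencil joins label-slopes

-- Existence of the maximum by exhaustive search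

module FiniteSearch where

  open import Algebra.Bundles using (Ring)
  open import Algebra.Module.Bundles using (RightModule)
  import Algebra.Properties.CommutativeMonoid.Sum as CommutativeMonoidSum
  open import Data.Fin.Base using (Fin; zero; suc; _↑ˡ_)
  open import Data.Fin.Properties using (all?; ↑ˡ-injective) renaming (_≟_ to _≟ᶠ_)
  open import Data.Fin.Subset using (Subset; _∈_; ∣_∣; inside; outside) renaming (⊥ to ∅)
  open import Data.Fin.Subset.Properties using (_∈?_; anySubset?; ∉⊥; ∣⊥∣≡0)
  open import Data.Nat.Base using (ℕ; zero; suc; _≤_; _+_; z≤n; s≤s⁻¹)
  open import Data.Nat.Properties using (_≤?_; ≤-refl; m≤n⇒m≤1+n; ≤∧≢⇒<)
  open import Data.Product.Base using (_×_; _,_; ∃)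
  open import Data.Vec.Base using ([]; _∷_; here; there) renaming (_++_ to _++ⱽ_)
  open import Data.Vec.Functional using (Vector; head; tail) renaming ([] to []ᶠ; _∷_ to _∷ᶠ_)
  open import Function.Base using (_∘_)
  open import Level using (Level; 0ℓ; _⊔_)
  open import Relation.Binary.Core using (Rel)
  open import Relation.Binary.Definitions using (_Respects_; Decidable; Reflexive; Symmetric)
  open import Relation.Binary.PropositionalEquality using (_≡_; refl; sym; trans; cong; subst)
  open import Relation.Nullary.Decidable using (Dec; yes; no; map′; ¬?; _×-dec_; _→-dec_; decidable-stable)
  open import Relation.Nullary.Negation using (¬_; contradiction)

  -- The carriers are infinite types with a coarse equality, so search is demanded only for
  -- predicates that respect this equality.
  Exhaustible : {A : Set} → Rel A 0ℓ → Set₁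
  Exhaustible {A} _≈_ = ∀ {P : A → Set} → P Respects _≈_ → (∀ x → Dec (P x)) → Dec (∃ P)

  Pointwise : {A : Set} → Rel A 0ℓ → ∀ {n} → Rel (Vector A n) 0ℓ
  Pointwise _≈_ v w = ∀ i → v i ≈ w i

  module _ {A : Set} {_≈_ : Rel A 0ℓ} where

    -- A predicate respecting pointwise equality cannot tell a vector from its reassembled head and
    -- tail, so the induction avoids function extensionality.
    exhaustible-vector : Reflexive _≈_ → Exhaustible _≈_ → ∀ n → Exhaustible (Pointwise _≈_ {n})
    exhaustible-vector rfl any zero    resp P? = map′ (λ p → []ᶠ , p) (λ (v , p) → resp (λ ()) p) (P? []ᶠ)
    exhaustible-vector rfl any (suc n) {P} resp P? = map′
      (λ (x , v , p) → x ∷ᶠ v , p)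
      (λ (v , p) → head v , tail v , resp (λ { zero → rfl ; (suc i) → rfl }) p)
      (any (λ x≈y (v , p) → v , resp (λ { zero → x≈y ; (suc i) → rfl }) p)
        λ x → exhaustible-vector rfl any n (λ v≈w → resp λ { zero → rfl ; (suc i) → v≈w i }) λ v → P? (x ∷ᶠ v))

    universal? : Symmetric _≈_ → Exhaustible _≈_ → {P : A → Set} → P Respects _≈_ → (∀ x → Dec (P x)) → Dec (∀ x → P x)
    universal? sm any resp P? with any (λ x≈y ¬p p → ¬p (resp (sm x≈y) p)) (λ x → ¬? (P? x))
    ... | yes (x , ¬p) = no λ all → ¬p (all x)
    ... | no  ¬∃       = yes λ x → decidable-stable (P? x) λ ¬p → ¬∃ (x , ¬p)

  module Span {r ℓr m ℓm : Level} {R : Ring r ℓr} (M : RightModule R m ℓm) where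
    open Ring R using (Carrier; _≈_; 0#; 1#; _*_) renaming (_+_ to _+ʳ_; refl to ≈-refl)
    open RightModule M
    open CommutativeMonoidSum +ᴹ-commutativeMonoid using (sum; sum-cong-≋; ∑-distrib-+)
    open IsSubmodule
    open IsBasisOf

    lc : ∀ {n} → Vector Carrierᴹ n → Vector Carrier n → Carrierᴹ
    lc = linearCombination M

    Independent : ∀ {n} → Vector Carrierᴹ n → Set (r ⊔ ℓr ⊔ ℓm)
    Independent b = ∀ a → lc b a ≈ᴹ 0ᴹ → ∀ i → a i ≈ 0#

    Span : ∀ {n} → Vector Carrierᴹ n → Carrierᴹ → Set (r ⊔ ℓm)
    Span b x = ∃ λ a → x ≈ᴹ lc b a

    lc-cong : ∀ {n} {b b′ : Vector Carrierᴹ n} {a a′ : Vector Carrier n} →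
              (∀ i → b i ≈ᴹ b′ i) → (∀ i → a i ≈ a′ i) → lc b a ≈ᴹ lc b′ a′
    lc-cong b≈b′ a≈a′ = sum-cong-≋ λ i → *ᵣ-cong (b≈b′ i) (a≈a′ i)

    lc-+ : ∀ {n} (b : Vector Carrierᴹ n) a a′ → lc b (λ i → a i +ʳ a′ i) ≈ᴹ lc b a +ᴹ lc b a′
    lc-+ b a a′ = ≈ᴹ-trans (sum-cong-≋ λ i → *ᵣ-distribˡ (b i) (a i) (a′ i)) (∑-distrib-+ (λ i → b i *ᵣ a i) (λ i → b i *ᵣ a′ i))

    lc-0 : ∀ {n} (b : Vector Carrierᴹ n) → lc b (λ _ → 0#) ≈ᴹ 0ᴹ
    lc-0 {zero}  b = ≈ᴹ-refl
    lc-0 {suc n} b = ≈ᴹ-trans (+ᴹ-cong (*ᵣ-zeroʳ (b zero)) (lc-0 (b ∘ suc))) (+ᴹ-identityˡ 0ᴹ)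

    lc-*ᵣ : ∀ {n} (b : Vector Carrierᴹ n) a c → lc b a *ᵣ c ≈ᴹ lc b (λ i → a i * c)
    lc-*ᵣ {zero}  b a c = *ᵣ-zeroˡ c
    lc-*ᵣ {suc n} b a c = ≈ᴹ-trans (*ᵣ-distribʳ c _ _) (+ᴹ-cong (*ᵣ-assoc (b zero) (a zero) c) (lc-*ᵣ (b ∘ suc) (a ∘ suc) c))

    Span-member : ∀ {n} (b : Vector Carrierᴹ n) i → Span b (b i)
    Span-member b zero = (1# ∷ᶠ λ _ → 0#) ,
      ≈ᴹ-sym (≈ᴹ-trans (+ᴹ-cong (*ᵣ-identityʳ (b zero)) (lc-0 (b ∘ suc))) (+ᴹ-identityʳ (b zero)))
    Span-member b (suc i) with a , eq ← Span-member (b ∘ suc) i = (0# ∷ᶠ a) ,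
      ≈ᴹ-trans eq (≈ᴹ-sym (≈ᴹ-trans (+ᴹ-congʳ (*ᵣ-zeroʳ (b zero))) (+ᴹ-identityˡ _)))

    Span-isSubmodule : ∀ {n} (b : Vector Carrierᴹ n) → IsSubmodule M (Span b)
    Span-isSubmodule b = record
      { respects  = λ x≈y (a , eq) → a , ≈ᴹ-trans (≈ᴹ-sym x≈y) eq
      ; 0-closed  = (λ _ → 0#) , ≈ᴹ-sym (lc-0 b)
      ; +-closed  = λ (a , eq) (a′ , eq′) → _ , ≈ᴹ-trans (+ᴹ-cong eq eq′) (≈ᴹ-sym (lc-+ b a a′))
      ; *ᵣ-closed = λ c (a , eq) → _ , ≈ᴹ-trans (*ᵣ-congʳ eq) (lc-*ᵣ b a c)
      }

    spanFree : ∀ {n} (b : Vector Carrierᴹ n) → Independent b → FreeSubmodule M n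
    spanFree b independent = record
      { carrier     = Span b
      ; isSubmodule = Span-isSubmodule b
      ; basis       = b
      ; isBasis     = record { member = Span-member b ; spans = λ x∈ → x∈ ; independent = independent }
      }

    lc-closed : ∀ {p n} {N : Carrierᴹ → Set p} → IsSubmodule M N → {b : Vector Carrierᴹ n} → (∀ i → N (b i)) → ∀ a → N (lc b a)
    lc-closed {n = zero}  sub N-b a = 0-closed sub
    lc-closed {n = suc n} sub N-b a = +-closed sub (*ᵣ-closed sub (a zero) (N-b zero)) (lc-closed sub (N-b ∘ suc) (a ∘ suc))

    free⊆ : ∀ {p n} (F : FreeSubmodule M n) {N : Carrierᴹ → Set p} → IsSubmodule M N →
            (∀ i → N (FreeSubmodule.basis F i)) → ∀ {x} → FreeSubmodule.carrier F x → N x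
    free⊆ F sub N-b x∈F with a , x≈ ← spans (FreeSubmodule.isBasis F) x∈F =
      respects sub (≈ᴹ-sym x≈) (lc-closed sub N-b a)

    Span-resp : ∀ {n} {b b′ : Vector Carrierᴹ n} {x y} → (∀ i → b i ≈ᴹ b′ i) → x ≈ᴹ y → Span b x → Span b′ y
    Span-resp b≈b′ x≈y (a , eq) = a , ≈ᴹ-trans (≈ᴹ-sym x≈y) (≈ᴹ-trans eq (lc-cong b≈b′ λ _ → ≈-refl))

    Independent-resp : ∀ {n} {b b′ : Vector Carrierᴹ n} → (∀ i → b i ≈ᴹ b′ i) → Independent b → Independent b′
    Independent-resp b≈b′ ind a eq = ind a (≈ᴹ-trans (lc-cong b≈b′ λ _ → ≈-refl) eq)

  module _ {r ℓ} {R : Ring r ℓ} where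
    open PHG R

    -- Cuts a larger arc down to 44 points, the size that the counting treats.
    restrict : ∀ {k} l {n} → ProjectiveArc (k + l) n → ProjectiveArc k n
    restrict l arc = record
      { point    = λ i → point (i ↑ˡ l)
      ; distinct = λ {i} {j} eq → ↑ˡ-injective l i j (distinct eq)
      ; secant   = λ L S on-L → subst (_≤ _) (∣S++∅∣ S) (secant L (S ++ⱽ ∅) λ i∈ →
          let i′ , eq , i′∈S = ∈-++∅ S i∈ in subst (λ i → point i on L) (sym eq) (on-L i′∈S))
      }
      where
      open ProjectiveArc arc
      ∣S++∅∣ : ∀ {k} (S : Subset k) → ∣ S ++ⱽ ∅ {l} ∣ ≡ ∣ S ∣
      ∣S++∅∣ []            = ∣⊥∣≡0 l
      ∣S++∅∣ (inside  ∷ S) = cong suc (∣S++∅∣ S)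
      ∣S++∅∣ (outside ∷ S) = ∣S++∅∣ S
      ∈-++∅ : ∀ {k} (S : Subset k) {i : Fin (k + l)} → i ∈ S ++ⱽ ∅ → ∃ λ i′ → i ≡ i′ ↑ˡ l × i′ ∈ S
      ∈-++∅ []      i∈         = contradiction i∈ ∉⊥
      ∈-++∅ (_ ∷ S) here       = zero , refl , here
      ∈-++∅ (_ ∷ S) (there i∈) with i′ , eq , i′∈S ← ∈-++∅ S i∈ = suc i′ , cong suc eq , there i′∈S

  module Decide (R : Ring 0ℓ 0ℓ) (_≟_ : Decidable (Ring._≈_ R)) (any : Exhaustible (Ring._≈_ R)) where

    open Ring R using (Carrier; _≈_; 0#) renaming (refl to ≈-refl; sym to ≈-sym; trans to ≈-trans)
    open PHG R
    open FreeSubmodule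
    open Span (R ^ 3)
    open RightModule (R ^ 3) using (_≈ᴹ_; ≈ᴹ-refl; ≈ᴹ-sym; ≈ᴹ-trans)

    V : Set
    V = Vector Carrier 3

    anyᵃ : ∀ n → Exhaustible (Pointwise _≈_ {n})
    anyᵃ = exhaustible-vector ≈-refl any

    anyᵇ : ∀ n → Exhaustible (Pointwise _≈ᴹ_ {n})
    anyᵇ = exhaustible-vector (λ i → ≈-refl) (anyᵃ 3)

    _≟ᴹ_ : Decidable _≈ᴹ_
    v ≟ᴹ w = all? λ i → v i ≟ w i

    span? : ∀ {n} (b : Vector V n) x → Dec (Span b x)
    span? b x = anyᵃ _ (λ a≈a′ eq → ≈ᴹ-trans eq (lc-cong {b = b} (λ _ → ≈ᴹ-refl) a≈a′)) λ a → x ≟ᴹ lc b a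

    independent? : ∀ {n} (b : Vector V n) → Dec (Independent b)
    independent? b = universal? (λ a≈a′ i → ≈-sym (a≈a′ i)) (anyᵃ _)
      (λ {a} {a′} a≈a′ ind eq i → ≈-trans (≈-sym (a≈a′ i)) (ind (≈ᴹ-trans (lc-cong {b = b} (λ _ → ≈ᴹ-refl) a≈a′) eq) i))
      λ a → (lc b a ≟ᴹ _) →-dec all? λ i → a i ≟ 0#

    infix 4 _⊑_
    _⊑_ : ∀ {m n} → Vector V m → Vector V n → Set
    p ⊑ q = ∀ i → Span q (p i)

    ⊑-resp : ∀ {m n} {p p′ : Vector V m} {q q′ : Vector V n} →
             (∀ i → p i ≈ᴹ p′ i) → (∀ i → q i ≈ᴹ q′ i) → p ⊑ q → p′ ⊑ q′
    ⊑-resp p≈ q≈ p⊑q i = Span-resp q≈ (p≈ i) (p⊑q i)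

    -- Stated as the absence of a violating subset, which a search over subsets decides; the bound
    -- itself returns because `≤` is stable under double negation.
    Secant : ∀ {k} → ℕ → Vector (Vector V 1) k → Vector V 2 → Set
    Secant n f b = Independent b → ¬ ∃ λ S → (∀ i → i ∈ S → f i ⊑ b) × ¬ ∣ S ∣ ≤ n

    -- Describes an arc by basis vectors alone. Arbitrary submodules are replaced by spans, which
    -- brings the question into the range of a finite search.
    IsArc : ∀ {k} → ℕ → Vector (Vector V 1) k → Set
    IsArc n f = (∀ i → Independent (f i)) × (∀ i j → f i ⊑ f j → f j ⊑ f i → i ≡ j) × (∀ b → Secant n f b)

    Secant-resp : ∀ {k n} {f g : Vector (Vector V 1) k} {b b′} → (∀ i j → f i j ≈ᴹ g i j) → (∀ i → b i ≈ᴹ b′ i) →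
                  Secant n f b → Secant n g b′
    Secant-resp f≈g b≈b′ sec ind (S , on , ∣S∣≰n) = sec (Independent-resp (λ i → ≈ᴹ-sym (b≈b′ i)) ind)
      (S , (λ i i∈S → ⊑-resp (λ j → ≈ᴹ-sym (f≈g i j)) (λ j → ≈ᴹ-sym (b≈b′ j)) (on i i∈S)) , ∣S∣≰n)

    IsArc-resp : ∀ {k n} → IsArc {k} n Respects Pointwise (Pointwise _≈ᴹ_)
    IsArc-resp f≈g (ind , dis , sec) =
      (λ i → Independent-resp (f≈g i) (ind i)) ,
      (λ i j i⊑j j⊑i → dis i j (⊑-resp (λ l → ≈ᴹ-sym (f≈g i l)) (λ l → ≈ᴹ-sym (f≈g j l)) i⊑j)
                               (⊑-resp (λ l → ≈ᴹ-sym (f≈g j l)) (λ l → ≈ᴹ-sym (f≈g i l)) j⊑i)) ,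
      λ b → Secant-resp {b = b} f≈g (λ _ → ≈ᴹ-refl) (sec b)

    isArc? : ∀ {k} n (f : Vector (Vector V 1) k) → Dec (IsArc n f)
    isArc? n f =
      (all? λ i → independent? (f i)) ×-dec
      (all? λ i → all? λ j → (f i ⊑? f j) →-dec ((f j ⊑? f i) →-dec (i ≟ᶠ j))) ×-dec
      universal? (λ b≈b′ i → ≈ᴹ-sym (b≈b′ i)) (anyᵇ 2) (Secant-resp (λ _ _ → ≈ᴹ-refl))
        λ b → independent? b →-dec ¬? (anySubset? λ S →
          (all? λ i → (i ∈? S) →-dec (f i ⊑? b)) ×-dec ¬? (∣ S ∣ ≤? n))
      where
      _⊑?_ : ∀ {m n} (p : Vector V m) (q : Vector V n) → Dec (p ⊑ q)
      p ⊑? q = all? λ i → span? q (p i)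

    fromArc : ∀ {k n} → ProjectiveArc k n → ∃ (IsArc {k} n)
    fromArc {k} {n} arc = (λ i → basis (point i)) ,
      (λ i → IsBasisOf.independent (isBasis (point i))) ,
      (λ i j i⊑j j⊑i → distinct ((λ {x} → inside-point i j i⊑j {x}) , λ {x} → inside-point j i j⊑i {x})) ,
      λ b ind (S , on , ∣S∣≰n) → ∣S∣≰n (secant (spanFree b ind) S λ {i} i∈S {x} →
        free⊆ (point i) (Span-isSubmodule b) (on i i∈S) {x})
      where
      open ProjectiveArc arc
      inside-point : ∀ i j → basis (point i) ⊑ basis (point j) → ∀ {x} → carrier (point i) x → carrier (point j) x
      inside-point i j i⊑j = free⊆ (point i) (isSubmodule (point j)) λ l →
        let a , eq = i⊑j l in IsSubmodule.respects (isSubmodule (point j)) (≈ᴹ-sym eq)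
          (lc-closed (isSubmodule (point j)) (IsBasisOf.member (isBasis (point j))) a)

    toArc : ∀ {k n} → ∃ (IsArc {k} n) → ProjectiveArc k n
    toArc {k} {n} (f , ind , dis , sec) = record
      { point    = λ i → spanFree (f i) (ind i)
      ; distinct = λ {i} {j} (i⊆j , j⊆i) → dis i j (λ l → i⊆j (Span-member (f i) l)) (λ l → j⊆i (Span-member (f j) l))
      ; secant   = λ L S on-L → decidable-stable (∣ S ∣ ≤? n) λ ∣S∣≰n →
          sec (basis L) (IsBasisOf.independent (isBasis L))
            (S , (λ i i∈S l → IsBasisOf.spans (isBasis L) (on-L i∈S (Span-member (f i) l))) , ∣S∣≰n)
      }

    arc? : ∀ k n → Dec (ProjectiveArc k n)
    arc? k n = map′ toArc fromArc (exhaustible-vector (λ _ → ≈ᴹ-refl) (anyᵇ 1) k IsArc-resp (isArc? n))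

    emptyArc : ∀ n → ProjectiveArc 0 n
    emptyArc n = record { point = λ () ; distinct = λ { {()} } ; secant = λ { _ [] _ → z≤n } }

    -- Either the bound is attained or it can be lowered by one; the descent ends at the empty arc
    -- at the latest.
    maximum : ∀ n B → (∀ {j} → ProjectiveArc j n → j ≤ B) → ∃ λ m → IsMaxArcSize R n m × m ≤ B
    maximum n zero    bound = 0 , record { attained = emptyArc n ; largest = bound } , z≤n
    maximum n (suc B) bound = step (arc? (suc B) n)
      where
      step : Dec (ProjectiveArc (suc B) n) → ∃ λ m → IsMaxArcSize R n m × m ≤ suc B
      step (yes arc) = suc B , record { attained = arc ; largest = bound } , ≤-refl
      step (no ¬arc) =
        let m , isMax , m≤B = maximum n B (λ arc → s≤s⁻¹ (≤∧≢⇒< (bound arc) λ { refl → ¬arc arc }))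
        in  m , isMax , m≤n⇒m≤1+n m≤B

-- Points and lines over a chain ring of length 2

module ChainRing where

  open Coordinates
  open FiniteSearch
  open Summation using (m*n≥1⇒m≥1; δ; δ≥1⇒≡; δ≤1; sum; sum-mono-≤; sum-positive; term≤sum; sum-tabulate)
  open import Algebra.Bundles using (CommutativeRing)
  import Algebra.Properties.Semiring.Mult as Mult
  import Algebra.Solver.Ring.NaturalCoefficients.Default as Solver
  open import Data.Bool.Base using (true; if_then_else_)
  open import Data.Fin.Base using (Fin; zero; suc; toℕ; remQuot; combine)
  open import Data.Fin.Patterns using (0F; 1F; 2F; 3F; 4F)
  open import Data.Fin.Properties using (any?; remQuot-combine)
  open import Data.Fin.Subset using (Subset; _∈_)
  open import Data.Nat.Base as ℕ using (ℕ; zero; suc; _≤_; z≤n; s≤s; _%_; _/_)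
  open import Data.Nat.DivMod using (m≡m%n+[m/n]*n)
  import Data.Nat.Properties as ℕ
  open import Data.Nat.Tactic.RingSolver using (solve-∀)
  open import Data.Product.Base using (_×_; _,_; ∃; ∃₂; proj₁; proj₂; uncurry)
  open import Data.Sum.Base using (_⊎_; inj₁; inj₂)
  open import Data.Vec.Base using (tabulate)
  open import Data.Vec.Functional using (Vector)
  open import Data.Vec.Properties using ([]=⇒lookup; lookup∘tabulate)
  open import Level using (0ℓ)
  open import Relation.Binary.Definitions using (Decidable)
  open import Relation.Binary.PropositionalEquality as ≡ using (_≡_; _≢_; cong; cong₂; subst)
  import Relation.Binary.Reasoning.Setoid as SetoidReasoning
  open import Relation.Nullary.Decidable using (Dec; yes; does; map′)
  open import Relation.Nullary.Negation using (¬_; contradiction)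

  -- A chain ring of length 2 with residue field 𝔽₅ and radical (θ), where
  -- 5 = ε θ: ε = 1 for ℤ₂₅ and ε = 0 for 𝕊₅.
  record IsChainRing (CR : CommutativeRing 0ℓ 0ℓ) : Set where
    open CommutativeRing CR
    open Mult semiring using () renaming (_×_ to _·_)
    field
      θ      : Carrier
      ε      : ℕ
      digits : ∀ x → ∃₂ λ (a b : Fin 5) → x ≈ toℕ a · 1# + (toℕ b · 1#) * θ
      θθ≈0   : θ * θ ≈ 0#
      5≈εθ   : 5 · 1# ≈ (ε · 1#) * θ
      θ≉0    : ¬ θ ≈ 0#
      _≟_    : Decidable _≈_

  module Chain (CR : CommutativeRing 0ℓ 0ℓ) (chain : IsChainRing CR) where
    open CommutativeRing CR
    open IsChainRing chain
    open Mult semiring using (×-homo-+; ×1-homo-*; ×-congˡ) renaming (_×_ to _·_)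
    open SetoidReasoning setoid
    open Solver commutativeSemiring using (solve; _:=_; _:+_; _:*_; con)

    φ : ℕ → Carrier
    φ n = n · 1#

    φ-+ : ∀ m n → φ (m ℕ.+ n) ≈ φ m + φ n
    φ-+ = ×-homo-+ 1#

    φ-* : ∀ m n → φ (m ℕ.* n) ≈ φ m * φ n
    φ-* = ×1-homo-*

    φ-1 : φ 1 ≈ 1#
    φ-1 = +-identityʳ 1#

    φ-≡ : ∀ {m n} → m ≡ n → φ m ≈ φ n
    φ-≡ = ×-congˡ

    any : Exhaustible _≈_
    any resp P? = map′ (λ (a , b , p) → _ , p)
      (λ (x , p) → let a , b , eq = digits x in a , b , resp eq p)
      (any? λ a → any? λ b → P? (φ (toℕ a) + φ (toℕ b) * θ))

    5θ≈0 : φ 5 * θ ≈ 0#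
    5θ≈0 = begin
      φ 5 * θ          ≈⟨ *-congʳ 5≈εθ ⟩
      φ ε * θ * θ      ≈⟨ *-assoc (φ ε) θ θ ⟩
      φ ε * (θ * θ)    ≈⟨ *-congˡ θθ≈0 ⟩
      φ ε * 0#         ≈⟨ zeroʳ (φ ε) ⟩
      0#               ∎

    multiple-of-5 : ∀ n → n % 5 ≡ 0 → φ n ≈ φ (n / 5) * φ 5
    multiple-of-5 n n%5≡0 = trans (φ-≡ (≡.trans (m≡m%n+[m/n]*n n 5) (cong (ℕ._+ n / 5 ℕ.* 5) n%5≡0))) (φ-* (n / 5) 5)

    %5≡0⇒φθ≈0 : ∀ n → n % 5 ≡ 0 → φ n * θ ≈ 0#
    %5≡0⇒φθ≈0 n n%5≡0 = begin
      φ n * θ               ≈⟨ *-congʳ (multiple-of-5 n n%5≡0) ⟩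
      φ (n / 5) * φ 5 * θ   ≈⟨ *-assoc (φ (n / 5)) (φ 5) θ ⟩
      φ (n / 5) * (φ 5 * θ) ≈⟨ *-congˡ 5θ≈0 ⟩
      φ (n / 5) * 0#        ≈⟨ zeroʳ _ ⟩
      0#                    ∎

    %5≡0⇒φ : ∀ n → n % 5 ≡ 0 → φ n ≈ φ (ε ℕ.* (n / 5)) * θ
    %5≡0⇒φ n n%5≡0 = begin
      φ n                       ≈⟨ multiple-of-5 n n%5≡0 ⟩
      φ (n / 5) * φ 5           ≈⟨ *-congˡ 5≈εθ ⟩
      φ (n / 5) * (φ ε * θ)     ≈⟨ rotate (φ (n / 5)) (φ ε) θ ⟩
      φ ε * φ (n / 5) * θ       ≈⟨ *-congʳ (φ-* ε (n / 5)) ⟨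
      φ (ε ℕ.* (n / 5)) * θ     ∎
      where
      rotate : ∀ x y z → x * (y * z) ≈ y * x * z
      rotate = solve 3 (λ x y z → x :* (y :* z) := y :* x :* z) refl

    V : Set
    V = Vector Carrier 3

    vec : Class → Fin 5 × Fin 5 → V
    vec k w i = φ (toℕ (coordinates k i)) + φ (toℕ (uncurry (tangent k) w i)) * θ

    pairing : V → V → Carrier
    pairing l v = l 0F * v 0F + (l 1F * v 1F + l 2F * v 2F)

    dot-tangent : ∀ k w x → dot (uncurry (tangent k) w) x ≡ slope (project k x) w
    dot-tangent (affine _ _) w x = ≡.refl
    dot-tangent (ideal _)    w x = ≡.refl
    dot-tangent extreme (a , b) x = cong (toℕ a ℕ.* toℕ (x 0F) ℕ.+_) (ℕ.+-identityʳ (toℕ b ℕ.* toℕ (x 1F)))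

    -- The carry: an integer product 5 q contributes `ε q θ`, because 5 = ε θ.
    κ : Class → Class → ℕ
    κ k l = ε ℕ.* (dot (coordinates k) (coordinates l) / 5)

    -- The products of two tangent parts vanish with θ², and the cross terms are the forms `rest`
    -- evaluated at tangent vectors.
    pairing-expand : ∀ k t l w → pairing (vec k t) (vec l w) ≈
      φ (dot (coordinates k) (coordinates l)) + φ (slope (rest l k) w ℕ.+ slope (rest k l) t) * θ
    pairing-expand k t l w = begin
      pairing (vec k t) (vec l w)
        ≈⟨ +-cong (term 0F) (+-cong (term 1F) (term 2F)) ⟩
      (φ (A 0F) + φ (B 0F) * θ) + ((φ (A 1F) + φ (B 1F) * θ) + (φ (A 2F) + φ (B 2F) * θ))
        ≈⟨ collect (φ (A 0F)) (φ (B 0F)) (φ (A 1F)) (φ (B 1F)) (φ (A 2F)) (φ (B 2F)) θ ⟩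
      (φ (A 0F) + (φ (A 1F) + φ (A 2F))) + (φ (B 0F) + (φ (B 1F) + φ (B 2F))) * θ
        ≈⟨ +-cong (φ-sum A) (*-congʳ (φ-sum B)) ⟨
      φ (dot x x′) + φ (B 0F ℕ.+ (B 1F ℕ.+ B 2F)) * θ
        ≈⟨ +-congˡ (*-congʳ (φ-≡ sumB)) ⟩
      φ (dot x x′) + φ (slope (rest l k) w ℕ.+ slope (rest k l) t) * θ ∎
      where
      x  = coordinates k
      y  = uncurry (tangent k) t
      x′ = coordinates l
      y′ = uncurry (tangent l) w
      A B : Fin 3 → ℕ
      A i = toℕ (x i) ℕ.* toℕ (x′ i)
      B i = toℕ (x i) ℕ.* toℕ (y′ i) ℕ.+ toℕ (y i) ℕ.* toℕ (x′ i)
      φ-sum : ∀ (f : Fin 3 → ℕ) → φ (f 0F ℕ.+ (f 1F ℕ.+ f 2F)) ≈ φ (f 0F) + (φ (f 1F) + φ (f 2F))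
      φ-sum f = trans (φ-+ (f 0F) _) (+-congˡ (φ-+ (f 1F) (f 2F)))
      collect : ∀ a b c d e f θ → (a + b * θ) + ((c + d * θ) + (e + f * θ)) ≈ (a + (c + e)) + (b + (d + f)) * θ
      collect = solve 7 (λ a b c d e f θ → (a :+ b :* θ) :+ ((c :+ d :* θ) :+ (e :+ f :* θ)) := (a :+ (c :+ e)) :+ (b :+ (d :+ f)) :* θ) refl
      expand : ∀ x y x′ y′ θ → (x + y * θ) * (x′ + y′ * θ) ≈ x * x′ + (x * y′ + y * x′) * θ + y * y′ * (θ * θ)
      expand = solve 5 (λ x y x′ y′ θ → (x :+ y :* θ) :* (x′ :+ y′ :* θ) := x :* x′ :+ (x :* y′ :+ y :* x′) :* θ :+ y :* y′ :* (θ :* θ)) refl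
      term : ∀ i → vec k t i * vec l w i ≈ φ (A i) + φ (B i) * θ
      term i = begin
        (X + Y * θ) * (X′ + Y′ * θ)                            ≈⟨ expand X Y X′ Y′ θ ⟩
        X * X′ + (X * Y′ + Y * X′) * θ + Y * Y′ * (θ * θ)      ≈⟨ +-congˡ (trans (*-congˡ θθ≈0) (zeroʳ _)) ⟩
        X * X′ + (X * Y′ + Y * X′) * θ + 0#                    ≈⟨ +-identityʳ _ ⟩
        X * X′ + (X * Y′ + Y * X′) * θ                         ≈⟨ +-cong (φ-* (toℕ (x i)) (toℕ (x′ i))) (*-congʳ
                                                                    (trans (φ-+ (toℕ (x i) ℕ.* toℕ (y′ i)) _)
                                                                    (+-cong (φ-* (toℕ (x i)) (toℕ (y′ i))) (φ-* (toℕ (y i)) (toℕ (x′ i)))))) ⟨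
        φ (A i) + φ (B i) * θ                                  ∎
        where
        X  = φ (toℕ (x i))
        Y  = φ (toℕ (y i))
        X′ = φ (toℕ (x′ i))
        Y′ = φ (toℕ (y′ i))
      sumB : B 0F ℕ.+ (B 1F ℕ.+ B 2F) ≡ slope (rest l k) w ℕ.+ slope (rest k l) t
      sumB = ≡.trans (interleave (toℕ (x 0F) ℕ.* toℕ (y′ 0F)) _ (toℕ (x 1F) ℕ.* toℕ (y′ 1F)) _ (toℕ (x 2F) ℕ.* toℕ (y′ 2F)) _)
        (cong₂ ℕ._+_ (≡.trans (dot-comm x y′) (dot-tangent l w x)) (dot-tangent k t x′))
        where
        interleave : ∀ a b c d e f → (a ℕ.+ b) ℕ.+ ((c ℕ.+ d) ℕ.+ (e ℕ.+ f)) ≡ (a ℕ.+ (c ℕ.+ e)) ℕ.+ (b ℕ.+ (d ℕ.+ f))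
        interleave = solve-∀

    pairing≈0 : ∀ k t l w → dot (coordinates k) (coordinates l) % 5 ≡ 0 →
      (κ k l ℕ.+ slope (rest l k) w ℕ.+ slope (rest k l) t) % 5 ≡ 0 → pairing (vec k t) (vec l w) ≈ 0#
    pairing≈0 k t l w D%5≡0 E%5≡0 = begin
      pairing (vec k t) (vec l w)         ≈⟨ pairing-expand k t l w ⟩
      φ D + φ E * θ                       ≈⟨ +-congʳ (%5≡0⇒φ D D%5≡0) ⟩
      φ (κ k l) * θ + φ E * θ             ≈⟨ distribʳ θ (φ (κ k l)) (φ E) ⟨
      (φ (κ k l) + φ E) * θ               ≈⟨ *-congʳ (φ-+ (κ k l) E) ⟨
      φ (κ k l ℕ.+ E) * θ                 ≈⟨ %5≡0⇒φθ≈0 (κ k l ℕ.+ E) (≡.trans (cong (_% 5) (≡.sym (ℕ.+-assoc (κ k l) _ _))) E%5≡0) ⟩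
      0#                                  ∎
      where
      D = dot (coordinates k) (coordinates l)
      E = slope (rest l k) w ℕ.+ slope (rest k l) t

    open Span (ring ^ 3)

    -- When the leading entry of `l` is 1, the equation `pairing l v ≈ 0#` can be solved for that
    -- coordinate of v and the other two are free.
    kernel : Class → V → Vector V 2
    kernel (affine _ _) l 0F = ⟨ - l 1F , 1# , 0# ⟩
    kernel (affine _ _) l 1F = ⟨ - l 2F , 0# , 1# ⟩
    kernel (ideal _)    l 0F = ⟨ 1# , - l 0F , 0# ⟩
    kernel (ideal _)    l 1F = ⟨ 0# , - l 2F , 1# ⟩
    kernel extreme      l 0F = ⟨ 1# , 0# , - l 0F ⟩
    kernel extreme      l 1F = ⟨ 0# , 1# , - l 1F ⟩

    private
      first : ∀ x y → 1# * x + (0# * y + 0#) ≈ x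
      first = solve 2 (λ x y → con 1 :* x :+ (con 0 :* y :+ con 0) := x) refl

      second : ∀ x y → 0# * x + (1# * y + 0#) ≈ y
      second = solve 2 (λ x y → con 0 :* x :+ (con 1 :* y :+ con 0) := y) refl

      solve-lead : ∀ l v x p y q → l ≈ 1# → l * v + (x * p + y * q) ≈ 0# → v ≈ - x * p + (- y * q + 0#)
      solve-lead l v x p y q l≈1 eq = begin
        v                                                    ≈⟨ +-identityʳ v ⟨
        v + 0#                                               ≈⟨ +-cong (trans (*-congʳ l≈1) (*-identityˡ v)) cancel ⟨
        l * v + (x * p + y * q + (- x * p + (- y * q + 0#))) ≈⟨ +-assoc (l * v) _ _ ⟨
        l * v + (x * p + y * q) + (- x * p + (- y * q + 0#)) ≈⟨ +-congʳ eq ⟩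
        0# + (- x * p + (- y * q + 0#))                      ≈⟨ +-identityˡ _ ⟩
        - x * p + (- y * q + 0#)                             ∎
        where
        regroup : ∀ x x′ p y y′ q → x * p + y * q + (x′ * p + (y′ * q + 0#)) ≈ (x + x′) * p + (y + y′) * q
        regroup = solve 6 (λ x x′ p y y′ q → x :* p :+ y :* q :+ (x′ :* p :+ (y′ :* q :+ con 0)) := (x :+ x′) :* p :+ (y :+ y′) :* q) refl
        cancel : x * p + y * q + (- x * p + (- y * q + 0#)) ≈ 0#
        cancel = trans (regroup x (- x) p y (- y) q) (trans (+-cong
          (trans (*-congʳ (-‿inverseʳ x)) (zeroˡ p)) (trans (*-congʳ (-‿inverseʳ y)) (zeroˡ q))) (+-identityˡ 0#))

      swap : ∀ x y z → x + (y + z) ≈ y + (x + z)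
      swap = solve 3 (λ x y z → x :+ (y :+ z) := y :+ (x :+ z)) refl

      rotate : ∀ x y z → x + (y + z) ≈ z + (x + y)
      rotate = solve 3 (λ x y z → x :+ (y :+ z) := z :+ (x :+ y)) refl

      one : φ 1 + φ 0 * θ ≈ 1#
      one = trans (+-cong φ-1 (zeroˡ θ)) (+-identityʳ 1#)

    kernel-independent : ∀ k l → Independent (kernel k l)
    kernel-independent (affine _ _) l a eq 0F = trans (sym (first (a 0F) (a 1F))) (eq 1F)
    kernel-independent (affine _ _) l a eq 1F = trans (sym (second (a 0F) (a 1F))) (eq 2F)
    kernel-independent (ideal _)    l a eq 0F = trans (sym (first (a 0F) (a 1F))) (eq 0F)
    kernel-independent (ideal _)    l a eq 1F = trans (sym (second (a 0F) (a 1F))) (eq 2F)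
    kernel-independent extreme      l a eq 0F = trans (sym (first (a 0F) (a 1F))) (eq 0F)
    kernel-independent extreme      l a eq 1F = trans (sym (second (a 0F) (a 1F))) (eq 1F)

    kernel-spans : ∀ k t v → pairing (vec k t) v ≈ 0# → Span (kernel k (vec k t)) v
    kernel-spans (affine a b) t v eq = (λ { 0F → v 1F ; 1F → v 2F }) ,
      λ { 0F → solve-lead (vec (affine a b) t 0F) (v 0F) _ (v 1F) _ (v 2F) one eq
        ; 1F → sym (first (v 1F) (v 2F)) ; 2F → sym (second (v 1F) (v 2F)) }
    kernel-spans (ideal a) t v eq = (λ { 0F → v 0F ; 1F → v 2F }) ,
      λ { 1F → solve-lead (vec (ideal a) t 1F) (v 1F) _ (v 0F) _ (v 2F) one (trans (swap _ _ _) eq)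
        ; 0F → sym (first (v 0F) (v 2F)) ; 2F → sym (second (v 0F) (v 2F)) }
    kernel-spans extreme t v eq = (λ { 0F → v 0F ; 1F → v 1F }) ,
      λ { 2F → solve-lead (vec extreme t 2F) (v 2F) _ (v 0F) _ (v 1F) one (trans (sym (rotate _ _ _)) eq)
        ; 0F → sym (first (v 0F) (v 1F)) ; 1F → sym (second (v 0F) (v 1F)) }

    -- An integer inverse of the first digit turns x into 1 + z θ. The product of this with 1 + 4 z
    -- θ is 1, because 5 θ = 0 and θ² = 0; using 4 for -1 keeps the identity free of negation.
    unit : ∀ x (a b : Fin 5) → a ≢ 0F → x ≈ φ (toℕ a) + φ (toℕ b) * θ → ∃ λ r → x * r ≈ 1#
    unit x a b a≢0 x≈ = φ n * (1# + φ 4 * z * θ) , (begin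
      x * (φ n * (1# + φ 4 * z * θ))                                   ≈⟨ *-assoc x (φ n) _ ⟨
      x * φ n * (1# + φ 4 * z * θ)                                     ≈⟨ *-congʳ xn≈ ⟩
      (1# + z * θ) * (1# + φ 4 * z * θ)                                ≈⟨ expand z (φ 4) θ ⟩
      1# + (φ 5 * θ) * z + φ 4 * z * z * (θ * θ)                       ≈⟨ +-cong (+-congˡ (trans (*-congʳ 5θ≈0) (zeroˡ z))) (trans (*-congˡ θθ≈0) (zeroʳ _)) ⟩
      1# + 0# + 0#                                                     ≈⟨ trans (+-identityʳ _) (+-identityʳ 1#) ⟩
      1#                                                               ∎)
      where
      inverse : ∀ (a : Fin 5) → a ≢ 0F → ∃₂ λ n k → toℕ a ℕ.* n ≡ 1 ℕ.+ 5 ℕ.* k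
      inverse 0F a≢0 = contradiction ≡.refl a≢0
      inverse 1F _ = 1 , 0 , ≡.refl
      inverse 2F _ = 3 , 1 , ≡.refl
      inverse 3F _ = 2 , 1 , ≡.refl
      inverse 4F _ = 4 , 3 , ≡.refl
      n = proj₁ (inverse a a≢0)
      k = proj₁ (proj₂ (inverse a a≢0))
      z = φ ε * φ k + φ (toℕ b) * φ n
      expand : ∀ z f θ → (1# + z * θ) * (1# + f * z * θ) ≈ 1# + ((1# + f) * θ) * z + f * z * z * (θ * θ)
      expand = solve 3 (λ z f θ → (con 1 :+ z :* θ) :* (con 1 :+ f :* z :* θ) := con 1 :+ ((con 1 :+ f) :* θ) :* z :+ f :* z :* z :* (θ :* θ)) refl
      distribute : ∀ a b n θ → (a + b * θ) * n ≈ a * n + b * n * θ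
      distribute = solve 4 (λ a b n θ → (a :+ b :* θ) :* n := a :* n :+ b :* n :* θ) refl
      regroup : ∀ o e k c θ → o + e * θ * k + c * θ ≈ o + (e * k + c) * θ
      regroup = solve 5 (λ o e k c θ → o :+ e :* θ :* k :+ c :* θ := o :+ (e :* k :+ c) :* θ) refl
      xn≈ : x * φ n ≈ 1# + z * θ
      xn≈ = begin
        x * φ n                                        ≈⟨ *-congʳ x≈ ⟩
        (φ (toℕ a) + φ (toℕ b) * θ) * φ n              ≈⟨ distribute (φ (toℕ a)) (φ (toℕ b)) (φ n) θ ⟩
        φ (toℕ a) * φ n + φ (toℕ b) * φ n * θ          ≈⟨ +-congʳ (φ-* (toℕ a) n) ⟨
        φ (toℕ a ℕ.* n) + φ (toℕ b) * φ n * θ          ≈⟨ +-congʳ (φ-≡ (proj₂ (proj₂ (inverse a a≢0)))) ⟩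
        φ (1 ℕ.+ 5 ℕ.* k) + φ (toℕ b) * φ n * θ        ≈⟨ +-congʳ (+-congˡ (trans (φ-* 5 k) (*-congʳ 5≈εθ))) ⟩
        1# + φ ε * θ * φ k + φ (toℕ b) * φ n * θ       ≈⟨ regroup 1# (φ ε) (φ k) (φ (toℕ b) * φ n) θ ⟩
        1# + z * θ                                     ∎

    θ-digit : ∀ x → ∃ λ (b : Fin 5) → x * θ ≈ φ (toℕ b) * θ
    θ-digit x = let a , b , x≈ = digits x in a , (begin
      x * θ                                   ≈⟨ *-congʳ x≈ ⟩
      (φ (toℕ a) + φ (toℕ b) * θ) * θ         ≈⟨ trans (distribʳ θ _ _) (+-congˡ (trans (*-assoc _ θ θ) (trans (*-congˡ θθ≈0) (zeroʳ _)))) ⟩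
      φ (toℕ a) * θ + 0#                      ≈⟨ +-identityʳ _ ⟩
      φ (toℕ a) * θ                           ∎)

    record NormalForm (v : V) : Set where
      constructor normalForm
      field
        cls   : Class
        pos   : Fin 5 × Fin 5
        r r⁻¹ : Carrier
        to    : ∀ i → v i * r ≈ vec cls pos i
        from  : ∀ i → vec cls pos i * r⁻¹ ≈ v i

    private
      fromLead : ∀ v j r k w → v j * r ≈ 1# → (∀ i → v i * r ≈ vec k w i) → NormalForm v
      -- The leading entry itself is the inverse of the scalar r.
      fromLead v j r k w vr≈1 to = normalForm k w r (v j) to λ i → begin
        vec k w i * v j    ≈⟨ *-congʳ (to i) ⟨
        v i * r * v j      ≈⟨ reorder (v i) r (v j) ⟩
        v i * (v j * r)    ≈⟨ *-congˡ vr≈1 ⟩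
        v i * 1#           ≈⟨ *-identityʳ (v i) ⟩
        v i                ∎
        where
        reorder : ∀ x y z → x * y * z ≈ x * (z * y)
        reorder = solve 3 (λ x y z → x :* y :* z := x :* (z :* y)) refl

      zero-digit : ∀ {x} (b : Fin 5) → x ≈ φ 0 + φ (toℕ b) * θ → x ≈ φ (toℕ b) * θ
      zero-digit b eq = trans eq (+-identityˡ _)

      scaled-digit : ∀ {x} {b : Fin 5} r → x ≈ φ 0 + φ (toℕ b) * θ → ∃ λ (b′ : Fin 5) → x * r ≈ φ 0 + φ (toℕ b′) * θ
      scaled-digit {x} {b} r eq = let b′ , eq′ = θ-digit (φ (toℕ b) * r) in b′ , (begin
        x * r                   ≈⟨ *-congʳ (zero-digit b eq) ⟩
        φ (toℕ b) * θ * r       ≈⟨ reorder (φ (toℕ b)) θ r ⟩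
        φ (toℕ b) * r * θ       ≈⟨ eq′ ⟩
        φ (toℕ b′) * θ          ≈⟨ +-identityˡ _ ⟨
        φ 0 + φ (toℕ b′) * θ    ∎)
        where
        reorder : ∀ x y z → x * y * z ≈ x * z * y
        reorder = solve 3 (λ x y z → x :* y :* z := x :* z :* y) refl

      θ-torsion : ∀ {x} {b : Fin 5} → x ≈ φ 0 + φ (toℕ b) * θ → x * θ ≈ 0#
      θ-torsion {b = b} eq = trans (*-congʳ (zero-digit b eq)) (trans (*-assoc _ θ θ) (trans (*-congˡ θθ≈0) (zeroʳ _)))

    -- The leading position is the first entry with nonzero first digit, hence a unit; the entries
    -- before it lie in the radical and stay there under scaling. Without a unit entry θ annihilates
    -- v, which is impossible for a basis vector since θ is nonzero.
    normalise-vector : ∀ v → NormalForm v ⊎ (∀ i → v i * θ ≈ 0#)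
    normalise-vector v = cases (digits (v 0F)) (digits (v 1F)) (digits (v 2F))
      where
      Digits : Carrier → Set
      Digits x = ∃₂ λ (a b : Fin 5) → x ≈ φ (toℕ a) + φ (toℕ b) * θ
      cases : Digits (v 0F) → Digits (v 1F) → Digits (v 2F) → NormalForm v ⊎ (∀ i → v i * θ ≈ 0#)
      cases (a@(suc _) , b , v₀≈) _ _ =
        let r , vr≈1 = unit (v 0F) a b (λ ()) v₀≈
            c₁ , d₁ , eq₁ = digits (v 1F * r)
            c₂ , d₂ , eq₂ = digits (v 2F * r)
        in inj₁ (fromLead v 0F r (affine c₁ c₂) (d₁ , d₂) vr≈1 λ { 0F → trans vr≈1 (sym one) ; 1F → eq₁ ; 2F → eq₂ })
      cases (zero , b₀ , v₀≈) (a@(suc _) , b , v₁≈) _ =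
        let r , vr≈1 = unit (v 1F) a b (λ ()) v₁≈
            d₀ , eq₀ = scaled-digit {b = b₀} r v₀≈
            c₂ , d₂ , eq₂ = digits (v 2F * r)
        in inj₁ (fromLead v 1F r (ideal c₂) (d₀ , d₂) vr≈1 λ { 0F → eq₀ ; 1F → trans vr≈1 (sym one) ; 2F → eq₂ })
      cases (zero , b₀ , v₀≈) (zero , b₁ , v₁≈) (a@(suc _) , b , v₂≈) =
        let r , vr≈1 = unit (v 2F) a b (λ ()) v₂≈
            d₀ , eq₀ = scaled-digit {b = b₀} r v₀≈
            d₁ , eq₁ = scaled-digit {b = b₁} r v₁≈
        in inj₁ (fromLead v 2F r extreme (d₀ , d₁) vr≈1 λ { 0F → eq₀ ; 1F → eq₁ ; 2F → trans vr≈1 (sym one) })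
      cases (zero , b₀ , v₀≈) (zero , b₁ , v₁≈) (zero , b₂ , v₂≈) =
        inj₂ λ { 0F → θ-torsion {b = b₀} v₀≈ ; 1F → θ-torsion {b = b₁} v₁≈ ; 2F → θ-torsion {b = b₂} v₂≈ }

    open PHG ring
    open FreeSubmodule

    no-44-arc-in-PHG : ¬ ProjectiveArc 44 3
    no-44-arc-in-PHG arc = no-44-arc κ cls pos code-injective bound
      where
      open ProjectiveArc arc

      nonzero : ∀ i → NormalForm (basis (point i) 0F) ⊎ (∀ j → basis (point i) 0F j * θ ≈ 0#) → NormalForm (basis (point i) 0F)
      nonzero i (inj₁ form)    = form
      nonzero i (inj₂ torsion) = contradiction
        (IsBasisOf.independent (isBasis (point i)) (λ _ → θ) (λ j → trans (+-identityʳ _) (torsion j)) 0F) θ≉0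

      form : ∀ i → NormalForm (basis (point i) 0F)
      form i = nonzero i (normalise-vector (basis (point i) 0F))

      module F i = NormalForm (form i)

      cls : Fin 44 → Fin 31
      cls i = index (F.cls i)

      pos : Fin 44 → Fin 25
      pos i = uncurry combine (F.pos i)

      generator : Fin 31 → Fin 25 → V
      generator c w = vec (class c) (remQuot 5 w)

      generator≡ : ∀ i → generator (cls i) (pos i) ≡ vec (F.cls i) (F.pos i)
      generator≡ i = cong₂ vec (class-index (F.cls i)) (remQuot-combine (proj₁ (F.pos i)) (proj₂ (F.pos i)))

      ∋generator : ∀ i → carrier (point i) (generator (cls i) (pos i))
      ∋generator i = subst (carrier (point i)) (≡.sym (generator≡ i)) (IsSubmodule.respects (isSubmodule (point i)) (F.to i)
        (IsSubmodule.*ᵣ-closed (isSubmodule (point i)) (F.r i) (IsBasisOf.member (isBasis (point i)) 0F)))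

      point⊆ : ∀ i {N : V → Set} → IsSubmodule (ring ^ 3) N → N (generator (cls i) (pos i)) →
               ∀ {x} → carrier (point i) x → N x
      point⊆ i {N} sub N-gen = free⊆ (point i) sub λ { 0F → IsSubmodule.respects sub (F.from i)
        (IsSubmodule.*ᵣ-closed sub (F.r⁻¹ i) (subst N (generator≡ i) N-gen)) }

      code-injective : ∀ i j → cls i ≡ cls j → pos i ≡ pos j → i ≡ j
      code-injective i j cls≡ pos≡ = distinct
        ((λ {x} → inclusion i j cls≡ pos≡ {x}) , (λ {x} → inclusion j i (≡.sym cls≡) (≡.sym pos≡) {x}))
        where
        inclusion : ∀ i j → cls i ≡ cls j → pos i ≡ pos j → ∀ {x} → carrier (point i) x → carrier (point j) x
        inclusion i j cls≡ pos≡ = point⊆ i (isSubmodule (point j))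
          (≡.subst₂ (λ c w → carrier (point j) (generator c w)) (≡.sym cls≡) (≡.sym pos≡) (∋generator j))

      module _ (m : Fin 31) (t : Fin 25) where
        theLine : Line
        theLine = spanFree (kernel (class m) (generator m t)) (kernel-independent (class m) (generator m t))

        meets : Fin 44 → Fin 6 → ℕ
        meets i e = δ (pt m e) (cls i) ℕ.* δ (label κ m (pt m e) (pos i)) (seg m e t)

        inc : Fin 44 → ℕ
        inc i = sum (meets i)

        -- The class of a point occurs at most once among the six classes on m, so counting
        -- incidences is the same as counting points.
        inc≤1 : ∀ i → inc i ≤ 1
        inc≤1 i = ℕ.≤-trans (sum-mono-≤ λ e → ℕ.≤-trans
            (ℕ.*-monoʳ-≤ (δ (pt m e) (cls i)) (δ≤1 (label κ m (pt m e) (pos i)) (seg m e t)))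
            (ℕ.≤-reflexive (ℕ.*-identityʳ _)))
          (ℕ.≤-trans (ℕ.≤-reflexive (incidence-pt m (cls i))) (incident≤1 (class m) (class (cls i))))

        meets⇒on : ∀ i e → 1 ≤ meets i e → point i on theLine
        meets⇒on i e 1≤meets = point⊆ i (Span-isSubmodule (kernel (class m) (generator m t)))
          (kernel-spans (class m) (remQuot 5 t) (generator (cls i) (pos i))
            (pairing≈0 (class m) (remQuot 5 t) (class (cls i)) (remQuot 5 (pos i)) dot%5≡0
              (label≡seg⇒0 κ m (cls i) (pos i) t (label≡ (cls i) pt≡ seg≡))))
          where
          pt≡ : pt m e ≡ cls i
          pt≡ = δ≥1⇒≡ (pt m e) (cls i) (m*n≥1⇒m≥1 (δ (pt m e) (cls i)) _ 1≤meets)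
          seg≡ : label κ m (pt m e) (pos i) ≡ seg m e t
          seg≡ = δ≥1⇒≡ (label κ m (pt m e) (pos i)) (seg m e t) (m*n≥1⇒m≥1 _ (δ (pt m e) (cls i))
            (subst (1 ≤_) (ℕ.*-comm (δ (pt m e) (cls i)) _) 1≤meets))
          label≡ : ∀ c → pt m e ≡ c → label κ m (pt m e) (pos i) ≡ seg m e t →
                   label κ m c (pos i) ≡ segLin (rest (class m) (class c)) t
          label≡ c ≡.refl eq = ≡.trans eq (cong (λ l → segLin (rest (class m) l) t) (≡.sym (class-index (onLine (class m) e))))
          dot%5≡0 : dot (coordinates (class m)) (coordinates (class (cls i))) % 5 ≡ 0
          dot%5≡0 = incident⇒ (class m) (class (cls i)) (ℕ.≤-trans (m*n≥1⇒m≥1 (δ (pt m e) (cls i)) _ 1≤meets)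
            (ℕ.≤-trans (term≤sum (λ e → δ (pt m e) (cls i)) e) (ℕ.≤-reflexive (incidence-pt m (cls i)))))

        S : Subset 44
        S = tabulate (λ i → does (1 ℕ.≤? inc i))

        S⇒on : ∀ {i} → i ∈ S → point i on theLine
        S⇒on {i} i∈S = let e , 1≤ = sum-positive (meets i) (positive (1 ℕ.≤? inc i)
                              (≡.trans (≡.sym (lookup∘tabulate (λ i → does (1 ℕ.≤? inc i)) i)) ([]=⇒lookup i∈S)))
                       in meets⇒on i e 1≤
          where
          positive : ∀ {A : Set} (d : Dec A) → does d ≡ true → A
          positive (yes a) _ = a

        bound : sum inc ≤ 3
        bound = ℕ.≤-trans (sum-mono-≤ λ i → indicator (inc i) (inc≤1 i))
          (ℕ.≤-trans (ℕ.≤-reflexive (≡.sym (sum-tabulate (λ i → does (1 ℕ.≤? inc i))))) (secant theLine S S⇒on))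
          where
          indicator : ∀ x → x ≤ 1 → x ≤ (if does (1 ℕ.≤? x) then 1 else 0)
          indicator 0 _ = z≤n
          indicator 1 _ = ℕ.≤-refl
          indicator (suc (suc _)) (s≤s ())

    maximum-3 : ∃ λ m → IsMaxArcSize ring 3 m × m ≤ 43
    maximum-3 = Decide.maximum ring _≟_ any 3 43 λ {j} arc → ℕ.≮⇒≥ λ 43<j →
      no-44-arc-in-PHG (restrict (j ℕ.∸ 44) (subst (λ k → ProjectiveArc k 3) (≡.sym (ℕ.m+[n∸m]≡n 43<j)) arc))

-- ℤ₂₅ and 𝕊₅ as chain rings

module Rings where

  open ChainRing
  open import Algebra.Bundles using (CommutativeRing)
  open import Algebra.Definitions.RawMagma using (_,_)
  import Algebra.Properties.Semiring.Mult as Mult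
  open import Data.Fin.Base using (Fin; zero; suc; toℕ; fromℕ<)
  open import Data.Fin.Properties using (toℕ-fromℕ<)
  open import Data.Integer.Base as ℤ using (ℤ; +_)
  open import Data.Integer.DivMod using (_%ℕ_; _/ℕ_; n%ℕd<d; a≡a%ℕn+[a/ℕn]*n)
  open import Data.Integer.Divisibility.Signed as ℤ∣ using (divides)
  import Data.Integer.Properties as ℤ
  import Data.Integer.Tactic.RingSolver as ℤ-Solver
  open import Data.List.Base using ([]; _∷_; drop)
  open import Data.Nat.Base as ℕ using (ℕ; zero; suc; _≤_; NonZero)
  open import Data.Nat.DivMod using (m≡m%n+[m/n]*n; m%n<n; m<n*o⇒m/o<n)
  open import Data.Product.Base using (_×_; _,_; ∃; ∃₂; proj₂)
  open import Relation.Binary.Definitions using (Decidable)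
  open import Relation.Binary.PropositionalEquality as ≡ using (_≡_; cong; cong₂)
  import Relation.Binary.Reasoning.Setoid as SetoidReasoning
  open import Relation.Nullary.Decidable using (map′; _×-dec_; from-no; from-yes)

  module Residues (n : ℕ) .{{_ : NonZero n}} where
    open CommutativeRing (ℤ/ n) public
    open Mult semiring public using () renaming (_×_ to _·_)
    open Quotient ℤ.+-*-commutativeRing (+ n) public using (congruent; fromEq)

    fromMultiple : ∀ x y q → x ≡ y ℤ.+ q ℤ.* + n → x ≈ y
    fromMultiple x y q x≡ = congruent (q , ≡.sym (≡.trans (cong (ℤ._- y) x≡) (cancel y (q ℤ.* + n))))
      where
      cancel : ∀ y z → y ℤ.+ z ℤ.- y ≡ z
      cancel = ℤ-Solver.solve-∀

    infix 4 _≟_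
    _≟_ : Decidable _≈_
    x ≟ y = map′ (λ (divides q eq) → congruent (q , ≡.sym eq)) (λ { (congruent (q , eq)) → divides q (≡.sym eq) })
      (+ n ℤ∣.∣? x ℤ.- y)

    ·1 : ∀ k → k · 1# ≡ + k
    ·1 zero    = ≡.refl
    ·1 (suc k) = cong (λ x → + 1 ℤ.+ x) (·1 k)

    remainder : ∀ x → x ≈ + (x %ℕ n)
    remainder x = fromMultiple x (+ (x %ℕ n)) (x /ℕ n) (a≡a%ℕn+[a/ℕn]*n x n)

  ℤ₂₅-isChainRing : IsChainRing (ℤ/ 25)
  ℤ₂₅-isChainRing = record
    { θ      = + 5
    ; ε      = 1
    ; digits = digits
    ; θθ≈0   = fromMultiple (+ 25) (+ 0) (+ 1) ≡.refl
    ; 5≈εθ   = refl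
    ; θ≉0    = from-no (+ 5 ≟ + 0)
    ; _≟_    = _≟_
    }
    where
    open Residues 25
    -- The base-5 digits of the remainder modulo 25.
    digits : ∀ x → ∃₂ λ (a b : Fin 5) → x ≈ toℕ a · 1# + (toℕ b · 1#) * + 5
    digits x = a , b , trans (remainder x) (fromEq (begin
      + r                                       ≡⟨ cong +_ (m≡m%n+[m/n]*n r 5) ⟩
      + (r ℕ.% 5 ℕ.+ r ℕ./ 5 ℕ.* 5)             ≡⟨ cong (λ x → + (r ℕ.% 5) ℤ.+ x) (ℤ.pos-* (r ℕ./ 5) 5) ⟩
      + (r ℕ.% 5) ℤ.+ + (r ℕ./ 5) ℤ.* + 5       ≡⟨ cong₂ (λ x y → x ℤ.+ y ℤ.* + 5)
                                                     (≡.trans (·1 (toℕ a)) (cong +_ (toℕ-fromℕ< (m%n<n r 5))))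
                                                     (≡.trans (·1 (toℕ b)) (cong +_ (toℕ-fromℕ< r/5<5))) ⟨
      toℕ a · 1# ℤ.+ (toℕ b · 1#) ℤ.* + 5       ∎))
      where
      open ≡.≡-Reasoning
      r = x %ℕ 25
      r/5<5 : r ℕ./ 5 ℕ.< 5
      r/5<5 = m<n*o⇒m/o<n {r} {5} {5} (n%ℕd<d x 25)
      a b : Fin 5
      a = fromℕ< (m%n<n r 5)
      b = fromℕ< r/5<5

  module 𝔽 = Residues 5
  open Quotient using (quotientRing)
  open Polynomial using (polynomialRing)
  open Polynomial 𝔽₅ hiding (polynomialRing)
  private
    module ℙ = CommutativeRing (polynomialRing 𝔽₅)
    module 𝕊 = CommutativeRing (quotientRing (polynomialRing 𝔽₅) (Polynomial._*ₚ_ 𝔽₅ (Polynomial.X 𝔽₅) (Polynomial.X 𝔽₅)))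
    module 𝔽-Reasoning = SetoidReasoning 𝔽.setoid

  coeff-≈ : ∀ {p q} → p ≈ₚ q → ∀ n → coeff p n 𝔽.≈ coeff q n
  coeff-≈ = _≈ₚ_.coeff-≈

  coeff-X* : ∀ p n → coeff (X *ₚ p) n 𝔽.≈ coeff (𝔽.0# ∷ p) n
  coeff-X* p zero = begin
    coeff (𝔽.0# · p +ₚ (𝔽.0# ∷ 𝔽.1# · p +ₚ (𝔽.0# ∷ []))) 0  ≈⟨ coeff-+ (𝔽.0# · p) _ 0 ⟩
    coeff (𝔽.0# · p) 0 𝔽.+ 𝔽.0#                               ≈⟨ 𝔽.+-identityʳ _ ⟩
    coeff (𝔽.0# · p) 0                                        ≈⟨ coeff-· 𝔽.0# p 0 ⟩
    𝔽.0# 𝔽.* coeff p 0                                        ≈⟨ 𝔽.zeroˡ (coeff p 0) ⟩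
    𝔽.0#                                                      ∎
    where open 𝔽-Reasoning
  coeff-X* p (suc n) = begin
    coeff (𝔽.0# · p +ₚ (𝔽.0# ∷ 𝔽.1# · p +ₚ (𝔽.0# ∷ []))) (suc n)
      ≈⟨ coeff-+ (𝔽.0# · p) _ (suc n) ⟩
    coeff (𝔽.0# · p) (suc n) 𝔽.+ coeff (𝔽.1# · p +ₚ (𝔽.0# ∷ [])) n
      ≈⟨ 𝔽.+-cong (𝔽.trans (coeff-· 𝔽.0# p (suc n)) (𝔽.zeroˡ (coeff p (suc n)))) (coeff-+ (𝔽.1# · p) (𝔽.0# ∷ []) n) ⟩
    𝔽.0# 𝔽.+ (coeff (𝔽.1# · p) n 𝔽.+ coeff (𝔽.0# ∷ []) n)
      ≈⟨ 𝔽.+-identityˡ _ ⟩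
    coeff (𝔽.1# · p) n 𝔽.+ coeff (𝔽.0# ∷ []) n
      ≈⟨ 𝔽.+-cong (𝔽.trans (coeff-· 𝔽.1# p n) (𝔽.*-identityˡ _)) (zeros n) ⟩
    coeff p n 𝔽.+ 𝔽.0#
      ≈⟨ 𝔽.+-identityʳ _ ⟩
    coeff p n ∎
    where
    open 𝔽-Reasoning
    zeros : ∀ n → coeff (𝔽.0# ∷ []) n 𝔽.≈ 𝔽.0#
    zeros zero    = 𝔽.refl
    zeros (suc n) = 𝔽.refl

  coeff-*X² : ∀ p n → coeff (p *ₚ (X *ₚ X)) n 𝔽.≈ coeff (𝔽.0# ∷ 𝔽.0# ∷ p) n
  coeff-*X² p n = 𝔽.trans (coeff-≈ (ℙ.trans (ℙ.*-comm p (X *ₚ X)) (ℙ.*-assoc X X p)) n)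
    (𝔽.trans (coeff-X* (X *ₚ p) n) (shifted n))
    where
    shifted : ∀ n → coeff (𝔽.0# ∷ X *ₚ p) n 𝔽.≈ coeff (𝔽.0# ∷ 𝔽.0# ∷ p) n
    shifted zero    = 𝔽.refl
    shifted (suc n) = coeff-X* p n

  SameHead : Poly → Poly → Set
  SameHead p q = coeff p 0 𝔽.≈ coeff q 0 × coeff p 1 𝔽.≈ coeff q 1

  -- The difference starts with two zero coefficients, and the list without them is its quotient by
  -- X².
  fromCoeffs : ∀ {p q} → SameHead p q → p 𝕊.≈ q
  fromCoeffs {p} {q} (eq₀ , eq₁) = Quotient.congruent (drop 2 d , coeffwise λ n → 𝔽.trans (coeff-*X² (drop 2 d) n) (restore d n
      (difference 0 eq₀) (difference 1 eq₁)))
    where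
    d = p +ₚ (-ₚ q)
    difference : ∀ n → coeff p n 𝔽.≈ coeff q n → coeff d n 𝔽.≈ 𝔽.0#
    difference n eq = 𝔽.trans (coeff-+ p (-ₚ q) n) (𝔽.trans (𝔽.+-cong eq (coeff-neg q n)) (𝔽.-‿inverseʳ (coeff q n)))
    restore : ∀ d n → coeff d 0 𝔽.≈ 𝔽.0# → coeff d 1 𝔽.≈ 𝔽.0# → coeff (𝔽.0# ∷ 𝔽.0# ∷ drop 2 d) n 𝔽.≈ coeff d n
    restore d           zero          eq₀ eq₁ = 𝔽.sym eq₀
    restore d           (suc zero)    eq₀ eq₁ = 𝔽.sym eq₁
    restore []          (suc (suc n)) eq₀ eq₁ = 𝔽.refl
    restore (_ ∷ [])    (suc (suc n)) eq₀ eq₁ = 𝔽.refl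
    restore (_ ∷ _ ∷ d) (suc (suc n)) eq₀ eq₁ = 𝔽.refl

  -- Together with `fromCoeffs` this reduces equality in 𝕊₅ to two comparisons in 𝔽₅, which makes it
  -- decidable.
  toCoeffs : ∀ {p q} → p 𝕊.≈ q → SameHead p q
  toCoeffs {p} {q} (Quotient.congruent (r , eq)) = same 0 𝔽.refl , same 1 𝔽.refl
    where
    same : ∀ n → coeff (𝔽.0# ∷ 𝔽.0# ∷ r) n 𝔽.≈ 𝔽.0# → coeff p n 𝔽.≈ coeff q n
    same n zero-coeff = begin
      coeff p n                                          ≈⟨ 𝔽.+-identityʳ _ ⟨
      coeff p n 𝔽.+ 𝔽.0#                                 ≈⟨ 𝔽.+-congˡ {coeff p n} (𝔽.-‿inverseˡ (coeff q n)) ⟨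
      coeff p n 𝔽.+ (𝔽.- coeff q n 𝔽.+ coeff q n)        ≈⟨ 𝔽.+-assoc (coeff p n) _ _ ⟨
      coeff p n 𝔽.+ 𝔽.- coeff q n 𝔽.+ coeff q n          ≈⟨ 𝔽.+-congʳ {coeff q n} (𝔽.trans (coeff-+ p (-ₚ q) n) (𝔽.+-congˡ {coeff p n} (coeff-neg q n))) ⟨
      coeff (p +ₚ (-ₚ q)) n 𝔽.+ coeff q n                ≈⟨ 𝔽.+-congʳ {coeff q n} (𝔽.trans (𝔽.sym (coeff-≈ eq n)) (𝔽.trans (coeff-*X² r n) zero-coeff)) ⟩
      𝔽.0# 𝔽.+ coeff q n                                 ≈⟨ 𝔽.+-identityˡ _ ⟩
      coeff q n                                          ∎
      where open 𝔽-Reasoning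

  𝕊₅-isChainRing : IsChainRing (quotientRing (polynomialRing 𝔽₅) (Polynomial._*ₚ_ 𝔽₅ (Polynomial.X 𝔽₅) (Polynomial.X 𝔽₅)))
  𝕊₅-isChainRing = record
    { θ      = X
    ; ε      = 0
    ; digits = digits
    ; θθ≈0   = fromCoeffs (coeff-X* X 0 , coeff-X* X 1)
    -- The only condition is that the constant coefficient 5 vanishes in 𝔽₅, since ε = 0 makes the
    -- right-hand side zero.
    ; 5≈εθ   = fromCoeffs {5 ×ₚ 1ₚ} {[]} (from-yes (+ 5 𝔽.≟ + 0) , 𝔽.refl)
    ; θ≉0    = λ X≈0 → from-no (+ 1 𝔽.≟ + 0) (proj₂ (toCoeffs X≈0))
    ; _≟_    = λ p q → map′ fromCoeffs toCoeffs ((coeff p 0 𝔽.≟ coeff q 0) ×-dec (coeff p 1 𝔽.≟ coeff q 1))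
    }
    where
    open Mult 𝕊.semiring using () renaming (_×_ to _×ₚ_)

    coeff-φ₀ : ∀ k → coeff (k ×ₚ 1ₚ) 0 𝔽.≈ + k
    coeff-φ₀ zero    = 𝔽.refl
    coeff-φ₀ (suc k) = 𝔽.trans (coeff-+ 1ₚ (k ×ₚ 1ₚ) 0) (𝔽.+-congˡ {+ 1} (coeff-φ₀ k))

    coeff-φ₁ : ∀ k → coeff (k ×ₚ 1ₚ) 1 𝔽.≈ 𝔽.0#
    coeff-φ₁ zero    = 𝔽.refl
    coeff-φ₁ (suc k) = 𝔽.trans (coeff-+ 1ₚ (k ×ₚ 1ₚ) 1) (𝔽.trans (𝔽.+-identityˡ _) (coeff-φ₁ k))

    digit : ∀ x → ∃ λ (a : Fin 5) → x 𝔽.≈ + toℕ a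
    digit x = fromℕ< (n%ℕd<d x 5) , 𝔽.trans (𝔽.remainder x) (𝔽.fromEq (cong +_ (≡.sym (toℕ-fromℕ< (n%ℕd<d x 5)))))

    digits : ∀ p → ∃₂ λ (a b : Fin 5) → p 𝕊.≈ (toℕ a ×ₚ 1ₚ) +ₚ (toℕ b ×ₚ 1ₚ) *ₚ X
    digits p =
      let a , p₀≈a = digit (coeff p 0)
          b , p₁≈b = digit (coeff p 1)
          φa = toℕ a ×ₚ 1ₚ
          φb = toℕ b ×ₚ 1ₚ
          coeff-φb*X = λ n → 𝔽.trans (coeff-≈ (ℙ.*-comm φb X) n) (coeff-X* φb n)
      in a , b , fromCoeffs
        ( 𝔽.trans p₀≈a (𝔽.sym (𝔽.trans (coeff-+ φa (φb *ₚ X) 0)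
            (𝔽.trans (𝔽.+-cong (coeff-φ₀ (toℕ a)) (coeff-φb*X 0)) (𝔽.+-identityʳ (+ toℕ a)))))
        , 𝔽.trans p₁≈b (𝔽.sym (𝔽.trans (coeff-+ φa (φb *ₚ X) 1)
            (𝔽.trans (𝔽.+-cong (coeff-φ₁ (toℕ a)) (𝔽.trans (coeff-φb*X 1) (coeff-φ₀ (toℕ b)))) (𝔽.+-identityˡ (+ toℕ b))))) )

  -- R is kept apart from CommutativeRing.ring CR because a conversion check between
  -- the two inside IsMaxArcSize unfolds all the ring laws.
  maximum≤43 : ∀ CR → IsChainRing CR → ∀ R → R ≡ CommutativeRing.ring CR → ∃ λ m → IsMaxArcSize R 3 m × m ≤ 43
  maximum≤43 CR chain R ≡.refl = Chain.maximum-3 CR chain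

  𝕊₅≡ : 𝕊₅ ≡ CommutativeRing.ring (quotientRing (polynomialRing 𝔽₅) (Polynomial._*ₚ_ 𝔽₅ (Polynomial.X 𝔽₅) (Polynomial.X 𝔽₅)))
  𝕊₅≡ = ≡.refl

open Rings using (maximum≤43; ℤ₂₅-isChainRing; 𝕊₅-isChainRing; 𝕊₅≡)

theorem4p22 : (∃ λ m → IsMaxArcSize ℤ₂₅ 3 m × m ≤ 43) × (∃ λ m → IsMaxArcSize 𝕊₅ 3 m × m ≤ 43)
theorem4p22 =
  maximum≤43 (ℤ/ 25) ℤ₂₅-isChainRing ℤ₂₅ ≡.refl ,
  maximum≤43 (Quotient.quotientRing (Polynomial.polynomialRing 𝔽₅) (Polynomial._*ₚ_ 𝔽₅ (Polynomial.X 𝔽₅) (Polynomial.X 𝔽₅))) 𝕊₅-isChainRing 𝕊₅ 𝕊₅≡
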